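{- Let $n\geq 1$ and let $A$ and $B$ be two $n\times n$ generalized tournament matrices. The following assertions are equivalent: (i) $A$ and $B$ have the same principal minors of orders at most $4$ (i.e. $\det A[X]=\det B[X]$ for every $X\subseteq[n]$ with $1\le |X|\le 4$); (ii) $A$ and $B$ have the same principal minors of every order (i.e. $\det A[X]=\det B[X]$ for every nonempty $X\subseteq [n]$); (iii) there exists a sequence $A_0=A, A_1,\ldots,A_m=B$ of $n\times n$ generalized tournament matrices such that for each $k=0,\ldots,m-1$, $A_{k+1}=\mathrm{Inv}(A_k,X_k)$ where $X_k$ is a clan of $A_k$.
   Context: A generalized tournament matrix of order $n$ is a real $n\times n$ matrix $M=(m_{ij})$ with nonnegative entries satisfying $M+M^{t}=J_n-I_n$, where $J_n$ is the all-ones matrix and $I_n$ the identity matrix (so $m_{ii}=0$ and $m_{ij}=1-m_{ji}\in[0,1]$ for $i\neq j$). Write $[n]=\{1,\ldots,n\}$. For nonempty $X\subseteq[n]$, $M[X]$ is the principal submatrix with rows and columns indexed by $X$. A clan of $M$ is a subset $X\subseteq[n]$ such that for all $i,j\in X$ and $k\in[n]\setminus X$, $m_{ik}=m_{jk}$ and $m_{ki}=m_{kj}$. For $Y\subseteq[n]$, $\mathrm{Inv}(M,Y)$ denotes the matrix obtained from $M$ by replacing the entry $m_{ij}$ by $m_{ji}$ for all $i,j\in Y$. -}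

module Defs where

open import Algebra.Bundles using (CommutativeRing)
open import Algebra.Definitions using (Invertible)
import Algebra.Properties.CommutativeMonoid.Sum as Sum
import Algebra.Properties.Semiring.Exp as Exp
open import Data.Bool.Base using (if_then_else_; _∧_)
open import Data.Fin.Base using (Fin; zero; suc; toℕ; fromℕ; inject₁; punchIn)
open import Data.Fin.Properties using (_≟_)
open import Data.Fin.Subset using (Subset; ∣_∣; _∈_; _∉_; Nonempty; inside; outside)
open import Data.Fin.Subset.Properties using (_∈?_)
open import Data.Nat.Base as ℕ using (ℕ; zero; suc)
open import Data.Product.Base using (∃; ∃-syntax; Σ-syntax; _×_)
open import Data.Vec.Base using (_∷_)
open import Level using (_⊔_) renaming (suc to lsuc)
open import Relation.Binary.Core using (Rel)
open import Relation.Binary.Structures using (IsDecTotalOrder)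
open import Relation.Nullary.Decidable.Core using (does)
open import Relation.Nullary.Negation.Core using (¬_)
open import Relation.Unary using (Pred)

-- The library has no real numbers, so ℝ is given by its classical axioms: it
-- is the Dedekind-complete ordered field, unique up to isomorphism. Equality
-- and order are decidable because the reals are meant classically here.
record CompleteOrderedField c ℓ₁ ℓ₂ : Set (lsuc (c ⊔ ℓ₁ ⊔ ℓ₂)) where
  field
    commutativeRing : CommutativeRing c ℓ₁

  open CommutativeRing commutativeRing public

  infix 4 _≤_

  field
    1≉0             : ¬ (1# ≈ 0#)
    invertible      : ∀ x → ¬ (x ≈ 0#) → Invertible _≈_ 1# _*_ x
    _≤_             : Rel Carrier ℓ₂
    isDecTotalOrder : IsDecTotalOrder _≈_ _≤_
    +-monoˡ-≤       : ∀ z {x y} → x ≤ y → x + z ≤ y + z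
    *-nonNeg        : ∀ {x y} → 0# ≤ x → 0# ≤ y → 0# ≤ x * y

  UpperBound : Pred Carrier ℓ₂ → Carrier → Set (c ⊔ ℓ₂)
  UpperBound P u = ∀ x → P x → x ≤ u

  field
    supremum : (P : Pred Carrier ℓ₂) → ∃ P → ∃ (UpperBound P) →
               ∃[ s ] (UpperBound P s × (∀ u → UpperBound P u → s ≤ u))

-- The increasing enumeration of the elements of a subset.
enum : ∀ {n} (X : Subset n) → Fin ∣ X ∣ → Fin n
enum (inside  ∷ X) zero    = zero
enum (inside  ∷ X) (suc i) = suc (enum X i)
enum (outside ∷ X) i       = suc (enum X i)

module RealMatrices {c ℓ₁ ℓ₂} (ℝ : CompleteOrderedField c ℓ₁ ℓ₂) where

  open CompleteOrderedField ℝ hiding (zero)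
  open Sum +-commutativeMonoid using (sum-syntax)
  open Exp semiring using (_^_)

  Matrix : ℕ → Set c
  Matrix n = Fin n → Fin n → Carrier

  infix 4 _≋_
  _≋_ : ∀ {n} → Matrix n → Matrix n → Set ℓ₁
  A ≋ B = ∀ i j → A i j ≈ B i j

  J : ∀ n → Matrix n
  J n i j = 1#

  I : ∀ n → Matrix n
  I n i j = if does (i ≟ j) then 1# else 0#

  -- Laplace expansion along the first row; the determinant of the 0 × 0
  -- matrix is 1.
  det : ∀ {n} → Matrix n → Carrier
  det {zero}  M = 1#
  det {suc n} M =
    ∑[ j < suc n ] ((- 1#) ^ toℕ j * (M zero j * det (λ i k → M (suc i) (punchIn j k))))

  infixl 10 _[_]
  _[_] : ∀ {n} → Matrix n → (X : Subset n) → Matrix ∣ X ∣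
  (M [ X ]) i j = M (enum X i) (enum X j)

  record IsGeneralizedTournament {n} (M : Matrix n) : Set (ℓ₁ ⊔ ℓ₂) where
    field
      nonNeg : ∀ i j → 0# ≤ M i j
      M+Mᵗ   : ∀ i j → M i j + M j i ≈ J n i j - I n i j

  IsClan : ∀ {n} → Matrix n → Subset n → Set ℓ₁
  IsClan M X = ∀ i j k → i ∈ X → j ∈ X → k ∉ X →
               (M i k ≈ M j k) × (M k i ≈ M k j)

  Inv : ∀ {n} → Matrix n → Subset n → Matrix n
  Inv M Y i j = if does (i ∈? Y) ∧ does (j ∈? Y) then M j i else M i j

  SamePrincipalMinors : ∀ {n} → Matrix n → Matrix n → Set ℓ₁
  SamePrincipalMinors {n} A B =
    (X : Subset n) → Nonempty X → det (A [ X ]) ≈ det (B [ X ])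

  SamePrincipalMinorsUpTo : ℕ → ∀ {n} → Matrix n → Matrix n → Set ℓ₁
  SamePrincipalMinorsUpTo r {n} A B =
    (X : Subset n) → 1 ℕ.≤ ∣ X ∣ → ∣ X ∣ ℕ.≤ r → det (A [ X ]) ≈ det (B [ X ])

  ClanInversionSequence : ∀ {n} → Matrix n → Matrix n → Set (c ⊔ ℓ₁ ⊔ ℓ₂)
  ClanInversionSequence {n} A B =
    ∃[ m ] Σ[ S ∈ (Fin (suc m) → Matrix n) ]
      ( (S zero ≋ A)
      × (S (fromℕ m) ≋ B)
      × ((k : Fin (suc m)) → IsGeneralizedTournament (S k))
      × ((k : Fin m) → ∃[ X ] ( IsClan (S (inject₁ k)) X
                              × (S (suc k) ≋ Inv (S (inject₁ k)) X))))

{-# OPTIONS --safe #-}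

-- Inverting a clan replaces P by Pᵗ in a block matrix [[N, v 1ᵗ], [1 uᵗ, P]], which does
-- not change the determinant. Conversely, put K = A − Aᵗ. The principal minors of orders 2
-- and 3 fix the entries of K up to sign and the sums k_ij k_jk + k_jk k_ki + k_ki k_ij;
-- those of order 4 then fix the second symmetric function of the three terms of each
-- Pfaffian of order 4. Colour a pair with k_ij ≠ 0 according to whether B keeps or
-- reverses it. If exactly one pair of a triple has a given colour, the third vertex has
-- the same weight to both ends of that pair; hence a connected component of either colour
-- is a clan of both A and B, and if it is proper the induction applies to it and to the
-- quotient. If both colours are connected, a cut (a bipartition across which K is a
-- nonzero constant) of a small set of vertices can be extended one vertex at a time to a
-- cut of the whole set; the two sides are then treated by induction and their blocks
-- rearranged by inversions.
module Submission where

open import Defs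
open import Algebra.Bundles using (CommutativeRing; RawRing)
import Algebra.Properties.Ring as RingProperties
import Algebra.Properties.Semiring.Exp as Exp
import Algebra.Properties.Semiring.Mult as SemiringMult
import Algebra.Properties.Semiring.Sum as SemiringSum
import Algebra.Solver.Ring as RingSolver
open import Algebra.Solver.Ring.AlmostCommutativeRing using (fromCommutativeRing; _-Raw-AlmostCommutative⟶_)
open import Data.Bool.Base using (Bool; true; false; not; if_then_else_)
open import Data.Empty using (⊥; ⊥-elim)
open import Data.Fin.Base as Fin using (Fin; zero; suc; toℕ; fromℕ; inject₁; punchIn; _↑ˡ_; _↑ʳ_; splitAt)
import Data.Fin.Properties as Fin
open import Data.Fin.Subset using (Subset; ∣_∣; _∈_; _∉_; _⊆_; _⊂_; _⊃_; _∪_; _∩_; ∁; ⁅_⁆; ⊤; inside; outside; Nonempty)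
open import Data.Fin.Subset.Induction using (⊂-wellFounded; ⊃-wellFounded; Acc; acc)
import Data.Fin.Subset.Properties as Subset
open import Data.Fin.Subset.Properties using (_∈?_)
open import Data.Maybe.Base using (Maybe; just; nothing)
open import Data.Nat.Base as ℕ using (ℕ; zero; suc; z≤n; s≤s)
import Data.Nat.Properties as ℕ
open import Data.Product.Base using (∃; ∃-syntax; ∃₂; Σ-syntax; _×_; _,_; proj₁; proj₂)
open import Data.Sum.Base using (_⊎_; inj₁; inj₂; map₁; swap; [_,_]′)
import Data.Vec.Base as Vec
open import Data.Vec.Functional using (Vector; []; _∷_; tail)
import Data.Vec.Properties as Vec
open import Function.Base using (_∘_; id; const; flip)
open import Function.Bundles using (_⇔_; mk⇔)
import Level
open import Relation.Binary.PropositionalEquality.Core as ≡ using (_≡_; _≢_)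
import Relation.Binary.Reasoning.Setoid as SetoidReasoning
open import Relation.Binary.Structures using (IsDecTotalOrder)
open import Relation.Nullary using (¬_; Dec; yes; no; does)
open import Relation.Nullary.Decidable using (map′; decidable-stable; dec-true; dec-false; _×-dec_; _⊎-dec_; ¬?)
open import Relation.Nullary.Negation using (contradiction)
open import Relation.Unary using (Pred; Decidable)

-- Minors of order 4 are consulted for a single configuration: four vertices on which each of the
-- two colours forms a path. There the equations of order 3 leave one weight for each path, and
-- order 4 makes these two weights equal up to sign. The configuration arises when a vertex `v` is
-- added to a cut. If each side contains a vertex whose pair with `v` lacks the weight of the cut,
-- `v` can join neither side. A new left side is then started from the vertices of one old side that
-- have the weight of the cut to `v` in one fixed colour. This succeeds as soon as they also point,
-- in that colour, to all the obstructing vertices of their own side, and the two paths are what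
-- could prevent it. Obstructing vertices whose weight to `v` is 0 carry no colour; they are dealt
-- with by comparing several of them. All inductions run over subsets `U` of one fixed index set,
-- with clans, minors and chains of inversions taken relative to `U`. Passing to a clan or to a
-- quotient then needs no reindexing, and the inversions found for a part can be read as inversions
-- of the whole.

-- A ring solver with integer coefficients.

module IntegerCoefficients {c ℓ} (R : CommutativeRing c ℓ) where
  open CommutativeRing R hiding (zero)
  open SemiringMult semiring using (×-homo-+; ×1-homo-*) renaming (_×_ to _·_)
  open import Relation.Binary.Reasoning.Setoid setoid
  open RingProperties ring
  open import Algebra.Properties.CommutativeSemigroup +-commutativeSemigroup using (interchange)

  -- (a , b) stands for the integer a - b. The solver compares normal forms
  -- definitionally, so the operations cancel, and the numerals 0 and 1 are
  -- interpreted by 0# and 1# on the nose.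
  Coefficient : Set
  Coefficient = ℕ × ℕ

  embed : Coefficient → Carrier
  embed (a , b) = a · 1# - b · 1#

  interpret : Coefficient → Carrier
  interpret (0 , 0) = 0#
  interpret (1 , 0) = 1#
  interpret ab      = embed ab

  interpret≈embed : ∀ ab → interpret ab ≈ embed ab
  interpret≈embed (0 , 0)           = sym (-‿inverseʳ 0#)
  interpret≈embed (1 , 0)           = sym (trans (+-cong (+-identityʳ 1#) -0#≈0#) (+-identityʳ 1#))
  interpret≈embed (suc (suc a) , 0) = refl
  interpret≈embed (0 , suc b)       = refl
  interpret≈embed (1 , suc b)       = refl
  interpret≈embed (suc (suc a) , suc b) = refl

  cancel : Coefficient → Coefficient
  cancel (suc a , suc b) = cancel (a , b)
  cancel ab              = ab

  rawRing′ : RawRing _ _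
  rawRing′ = record
    { Carrier = Coefficient
    ; _≈_ = _≡_
    ; _+_ = λ (a , b) (c , d) → cancel (a ℕ.+ c , b ℕ.+ d)
    ; _*_ = λ (a , b) (c , d) → cancel (a ℕ.* c ℕ.+ b ℕ.* d , a ℕ.* d ℕ.+ b ℕ.* c)
    ; -_  = λ (a , b) → b , a
    ; 0#  = 0 , 0
    ; 1#  = 1 , 0
    }

  private module C = RawRing rawRing′

  +-interchange : ∀ a b c d → (a + c) - (b + d) ≈ (a - b) + (c - d)
  +-interchange a b c d = trans (+-congˡ (sym (-‿+-comm b d))) (interchange a c (- b) (- d))

  embed-cancel : ∀ ab → embed (cancel ab) ≈ embed ab
  embed-cancel (zero , b)      = refl
  embed-cancel (suc a , zero)  = refl
  embed-cancel (suc a , suc b) = begin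
    embed (cancel (a , b))            ≈⟨ embed-cancel (a , b) ⟩
    a · 1# - b · 1#                   ≈⟨ +-identityˡ _ ⟨
    0# + (a · 1# - b · 1#)            ≈⟨ +-congʳ (-‿inverseʳ 1#) ⟨
    (1# - 1#) + (a · 1# - b · 1#)     ≈⟨ +-interchange 1# 1# _ _ ⟨
    (1# + a · 1#) - (1# + b · 1#)     ∎

  embed-+ : ∀ x y → embed (x C.+ y) ≈ embed x + embed y
  embed-+ (a , b) (c , d) = trans (embed-cancel (a ℕ.+ c , b ℕ.+ d)) (trans
    (+-cong (×-homo-+ 1# a c) (-‿cong (×-homo-+ 1# b d))) (+-interchange _ _ _ _))

  embed-* : ∀ x y → embed (x C.* y) ≈ embed x * embed y
  embed-* (a , b) (c , d) = trans (embed-cancel (a ℕ.* c ℕ.+ b ℕ.* d , a ℕ.* d ℕ.+ b ℕ.* c)) (begin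
    (a ℕ.* c ℕ.+ b ℕ.* d) · 1# - (a ℕ.* d ℕ.+ b ℕ.* c) · 1#
      ≈⟨ +-cong (homo a c b d) (-‿cong (homo a d b c)) ⟩
    (a′ * c′ + b′ * d′) - (a′ * d′ + b′ * c′)
      ≈⟨ +-interchange _ _ _ _ ⟩
    (a′ * c′ - a′ * d′) + (b′ * d′ - b′ * c′)
      ≈⟨ +-cong (x[y-z]≈xy-xz a′ c′ d′) (trans (-‿cong (x[y-z]≈xy-xz b′ c′ d′)) (-‿swap _ _)) ⟨
    a′ * (c′ - d′) + - (b′ * (c′ - d′))
      ≈⟨ +-congˡ (-‿distribˡ-* _ _) ⟩
    a′ * (c′ - d′) + - b′ * (c′ - d′)
      ≈⟨ distribʳ _ _ _ ⟨
    (a′ - b′) * (c′ - d′) ∎)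
    where
    a′ = a · 1#
    b′ = b · 1#
    c′ = c · 1#
    d′ = d · 1#
    homo : ∀ i j k l → (i ℕ.* j ℕ.+ k ℕ.* l) · 1# ≈ (i · 1#) * (j · 1#) + (k · 1#) * (l · 1#)
    homo i j k l = trans (×-homo-+ 1# (i ℕ.* j) (k ℕ.* l)) (+-cong (×1-homo-* i j) (×1-homo-* k l))
    -‿swap : ∀ x y → - (x - y) ≈ y - x
    -‿swap x y = trans (sym (-‿+-comm x (- y))) (trans (+-congˡ (-‿involutive y)) (+-comm (- x) y))

  embed-neg : ∀ x → embed (C.- x) ≈ - embed x
  embed-neg (a , b) = trans (+-comm _ _) (trans (+-congˡ (sym (-‿involutive _))) (-‿+-comm _ _))

  morphism : rawRing′ -Raw-AlmostCommutative⟶ fromCommutativeRing R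
  morphism = record
    { ⟦_⟧    = interpret
    ; +-homo = λ x y → trans (interpret≈embed (x C.+ y)) (trans (embed-+ x y) (sym (+-cong (interpret≈embed x) (interpret≈embed y))))
    ; *-homo = λ x y → trans (interpret≈embed (x C.* y)) (trans (embed-* x y) (sym (*-cong (interpret≈embed x) (interpret≈embed y))))
    ; -‿homo = λ x → trans (interpret≈embed (C.- x)) (trans (embed-neg x) (sym (-‿cong (interpret≈embed x))))
    ; 0-homo = refl
    ; 1-homo = refl
    }

  equal? : (x y : Coefficient) → Maybe (interpret x ≈ interpret y)
  equal? x@(a , b) y@(c , d) with a ℕ.+ d ℕ.≟ c ℕ.+ b
  ... | no _  = nothing
  ... | yes e = just (trans (interpret≈embed x) (trans ab≈cd (sym (interpret≈embed y))))
    where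
    x+y-y≈x : ∀ x y → x + y - y ≈ x
    x+y-y≈x x y = trans (+-assoc x y (- y)) (trans (+-congˡ (-‿inverseʳ y)) (+-identityʳ x))
    a+d≈c+b : a · 1# + d · 1# ≈ c · 1# + b · 1#
    a+d≈c+b = trans (sym (×-homo-+ 1# a d)) (trans (reflexive (≡.cong (_· 1#) e)) (×-homo-+ 1# c b))
    ab≈cd : embed x ≈ embed y
    ab≈cd = begin
      a · 1# - b · 1#                         ≈⟨ +-congʳ (x+y-y≈x _ _) ⟨
      a · 1# + d · 1# - d · 1# - b · 1#       ≈⟨ +-congʳ (+-congʳ a+d≈c+b) ⟩
      c · 1# + b · 1# - d · 1# - b · 1#       ≈⟨ +-assoc _ _ _ ⟩
      c · 1# + b · 1# + (- (d · 1#) - b · 1#) ≈⟨ +-congˡ (+-comm _ _) ⟩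
      c · 1# + b · 1# + (- (b · 1#) - d · 1#) ≈⟨ +-assoc _ _ _ ⟨
      c · 1# + b · 1# - b · 1# - d · 1#       ≈⟨ +-congʳ (x+y-y≈x _ _) ⟩
      c · 1# - d · 1# ∎

  open RingSolver rawRing′ (fromCommutativeRing R) morphism equal? public
    using (Polynomial; solve; _:=_; con; _:+_; _:*_; :-_; _:-_)

-- Determinants and block matrices.

module Determinant {c ℓ₁ ℓ₂} (ℝ : CompleteOrderedField c ℓ₁ ℓ₂) where
  open CompleteOrderedField ℝ hiding (zero)
  open RealMatrices ℝ
  open IntegerCoefficients commutativeRing using (solve; _:=_; con; _:+_; _:*_; :-_; _:-_)
  open SemiringSum semiring using (sum; sum-syntax; sum-cong-≋; ∑-distrib-+; ∑-comm; *-distribˡ-sum)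
  open Exp semiring using (_^_)
  open RingProperties ring using (-‿involutive; -0#≈0#; +-inverseˡ-unique)
  open IsDecTotalOrder isDecTotalOrder using (_≟_; ≤-respʳ-≈; ≤-respˡ-≈) renaming (antisym to ≤-antisym; total to ≤-total)
  open SetoidReasoning setoid

  -- Halving is used throughout: entries are recovered from the differences `A i j - A j i`, and a
  -- number equal to its negative has to vanish.
  1+1≉0 : ¬ 1# + 1# ≈ 0#
  1+1≉0 2≈0 with ≤-total 0# 1#
  ... | inj₁ 0≤1 = 1≉0 (≤-antisym 1≤0 0≤1)
    where
    1≤0 : 1# ≤ 0#
    1≤0 = ≤-respʳ-≈ 2≈0 (≤-respˡ-≈ (+-identityˡ 1#) (+-monoˡ-≤ 1# 0≤1))
  ... | inj₂ 1≤0 = 1≉0 (≤-antisym 1≤0 0≤1)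
    where
    0≤-1 : 0# ≤ - 1#
    0≤-1 = ≤-respʳ-≈ (+-identityˡ _) (≤-respˡ-≈ (-‿inverseʳ 1#) (+-monoˡ-≤ (- 1#) 1≤0))
    0≤1 : 0# ≤ 1#
    0≤1 = ≤-respʳ-≈ (solve 0 (:- con (1 , 0) :* :- con (1 , 0) := con (1 , 0)) refl) (*-nonNeg 0≤-1 0≤-1)

  x*y≈0⇒y≈0 : ∀ {x y} → ¬ x ≈ 0# → x * y ≈ 0# → y ≈ 0#
  x*y≈0⇒y≈0 {x} {y} x≉0 xy≈0 with invertible x x≉0
  ... | x⁻¹ , x⁻¹x≈1 , _ = begin
    y              ≈⟨ *-identityˡ y ⟨
    1# * y         ≈⟨ *-congʳ x⁻¹x≈1 ⟨
    x⁻¹ * x * y    ≈⟨ *-assoc _ _ _ ⟩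
    x⁻¹ * (x * y)  ≈⟨ *-congˡ xy≈0 ⟩
    x⁻¹ * 0#       ≈⟨ zeroʳ x⁻¹ ⟩
    0#             ∎

  x*y≈0⇒x≈0∨y≈0 : ∀ x y → x * y ≈ 0# → x ≈ 0# ⊎ y ≈ 0#
  x*y≈0⇒x≈0∨y≈0 x y xy≈0 with x ≟ 0#
  ... | yes x≈0 = inj₁ x≈0
  ... | no  x≉0 = inj₂ (x*y≈0⇒y≈0 x≉0 xy≈0)

  x≈-x⇒x≈0 : ∀ {x} → x ≈ - x → x ≈ 0#
  x≈-x⇒x≈0 {x} x≈-x = x*y≈0⇒y≈0 1+1≉0 (begin
    (1# + 1#) * x ≈⟨ solve 1 (λ x → (con (1 , 0) :+ con (1 , 0)) :* x := x :+ x) refl x ⟩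
    x + x         ≈⟨ +-congˡ x≈-x ⟩
    x - x         ≈⟨ -‿inverseʳ x ⟩
    0#            ∎)

  x-y≈0⇒x≈y : ∀ {x y} → x - y ≈ 0# → x ≈ y
  x-y≈0⇒x≈y {x} {y} x-y≈0 = trans (+-inverseˡ-unique x (- y) x-y≈0) (-‿involutive y)

  infix 8 _ᵗ
  _ᵗ : ∀ {n} → Matrix n → Matrix n
  (M ᵗ) i j = M j i

  cofactor : ∀ {n} → Matrix (suc n) → (i j : Fin (suc n)) → Matrix n
  cofactor M i j k l = M (punchIn i k) (punchIn j l)

  det-cong : ∀ {n} {A B : Matrix n} → A ≋ B → det A ≈ det B
  det-cong {zero}  A≋B = refl
  det-cong {suc n} A≋B = sum-cong-≋ λ j →
    *-congˡ {(- 1#) ^ toℕ j} (*-cong (A≋B zero j) (det-cong λ i k → A≋B (suc i) (punchIn j k)))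

  -- The two expansions share the corner term. In the others, expanding the minors once more, along
  -- the column on one side and along the row on the other, gives the same double sum over the
  -- minors with two rows and two columns removed.
  det-expand-column : ∀ {n} (M : Matrix (suc n)) →
    det M ≈ ∑[ i < suc n ] ((- 1#) ^ toℕ i * (M i zero * det (cofactor M i zero)))
  det-expand-column {zero}  M = refl
  det-expand-column {suc n} M = +-congˡ (begin
    ∑[ j < suc n ] (- 1# * s j * (M zero (suc j) * det (cofactor M zero (suc j))))
      ≈⟨ (sum-cong-≋ λ j → *-congˡ {(- 1#) * s j} (*-congˡ {M zero (suc j)}
           (det-expand-column (cofactor M zero (suc j))))) ⟩
    ∑[ j < suc n ] (- 1# * s j * (M zero (suc j) * ∑[ i < suc n ] (s i * (M (suc i) zero * m i j))))
      ≈⟨ sum-cong-≋ (λ j → pull j (λ i → s i * (M (suc i) zero * m i j))) ⟩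
    ∑[ j < suc n ] ∑[ i < suc n ] (- 1# * s j * (M zero (suc j) * (s i * (M (suc i) zero * m i j))))
      ≈⟨ ∑-comm (λ j i → - 1# * s j * (M zero (suc j) * (s i * (M (suc i) zero * m i j)))) ⟩
    ∑[ i < suc n ] ∑[ j < suc n ] (- 1# * s j * (M zero (suc j) * (s i * (M (suc i) zero * m i j))))
      ≈⟨ (sum-cong-≋ λ i → sum-cong-≋ λ j → reorder (s j) (M zero (suc j)) (s i) (M (suc i) zero) (m i j)) ⟩
    ∑[ i < suc n ] ∑[ j < suc n ] (- 1# * s i * (M (suc i) zero * (s j * (M zero (suc j) * m i j))))
      ≈⟨ sum-cong-≋ (λ i → pull′ i (λ j → s j * (M zero (suc j) * m i j))) ⟨
    ∑[ i < suc n ] (- 1# * s i * (M (suc i) zero * ∑[ j < suc n ] (s j * (M zero (suc j) * m i j)))) ∎)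
    where
    s : Fin (suc n) → Carrier
    s j = (- 1#) ^ toℕ j
    m : (i j : Fin (suc n)) → Carrier
    m i j = det λ k l → M (suc (punchIn i k)) (suc (punchIn j l))
    pull : ∀ j (f : Fin (suc n) → Carrier) →
      - 1# * s j * (M zero (suc j) * sum f) ≈ ∑[ i < suc n ] (- 1# * s j * (M zero (suc j) * f i))
    pull j f = trans (*-congˡ (*-distribˡ-sum (M zero (suc j)) f)) (*-distribˡ-sum (- 1# * s j) λ i → M zero (suc j) * f i)
    pull′ : ∀ i (f : Fin (suc n) → Carrier) →
      - 1# * s i * (M (suc i) zero * sum f) ≈ ∑[ j < suc n ] (- 1# * s i * (M (suc i) zero * f j))
    pull′ i f = trans (*-congˡ (*-distribˡ-sum (M (suc i) zero) f)) (*-distribˡ-sum (- 1# * s i) λ j → M (suc i) zero * f j)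
    reorder : ∀ s x t y d → - 1# * s * (x * (t * (y * d))) ≈ - 1# * t * (y * (s * (x * d)))
    reorder = solve 5 (λ s x t y d →
      :- con (1 , 0) :* s :* (x :* (t :* (y :* d))) := :- con (1 , 0) :* t :* (y :* (s :* (x :* d)))) refl

  det-transpose : ∀ {n} (M : Matrix n) → det (M ᵗ) ≈ det M
  det-transpose {zero}  M = refl
  det-transpose {suc n} M = trans
    (sum-cong-≋ λ j → *-congˡ {(- 1#) ^ toℕ j} (*-congˡ {M j zero} (det-transpose (cofactor M j zero))))
    (sym (det-expand-column M))

  swap₀₁ : ∀ {n} → Fin (suc (suc n)) → Fin (suc (suc n))
  swap₀₁ zero          = suc zero
  swap₀₁ (suc zero)    = zero
  swap₀₁ (suc (suc i)) = suc (suc i)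

  -- Expansion along the first column turns the two rows into two summands of opposite sign, which
  -- trade places. In every other summand both rows survive in the minor, which changes sign by
  -- induction.
  det-swap₀₁ : ∀ {n} (M : Matrix (suc (suc n))) → det (λ i → M (swap₀₁ i)) ≈ - det M
  det-swap₀₁ {n} M = begin
    det M′
      ≈⟨ det-expand-column M′ ⟩
    1# * (M (suc zero) zero * det (cofactor M′ zero zero)) + (- 1# * 1# * (M zero zero * det (cofactor M′ (suc zero) zero)) + rest M′)
      ≈⟨ +-cong (*-congˡ (*-congˡ (det-cong first))) (+-cong (*-congˡ (*-congˡ (det-cong second))) (others n M)) ⟩
    1# * (M (suc zero) zero * det (cofactor M (suc zero) zero)) + (- 1# * 1# * (M zero zero * det (cofactor M zero zero)) + - rest M)
      ≈⟨ solve 5 (λ x d y e r →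
           con (1 , 0) :* (x :* d) :+ (:- con (1 , 0) :* con (1 , 0) :* (y :* e) :+ :- r)
           := :- (con (1 , 0) :* (y :* e) :+ (:- con (1 , 0) :* con (1 , 0) :* (x :* d) :+ r))) refl _ _ _ _ _ ⟩
    - (1# * (M zero zero * det (cofactor M zero zero)) + (- 1# * 1# * (M (suc zero) zero * det (cofactor M (suc zero) zero)) + rest M))
      ≈⟨ -‿cong (det-expand-column M) ⟨
    - det M ∎
    where
    M′ : Matrix (suc (suc n))
    M′ i = M (swap₀₁ i)
    rest : ∀ {n} → Matrix (suc (suc n)) → Carrier
    rest {n} M = ∑[ i < n ] (- 1# * (- 1# * (- 1#) ^ toℕ i) * (M (suc (suc i)) zero * det (cofactor M (suc (suc i)) zero)))
    first : cofactor M′ zero zero ≋ cofactor M (suc zero) zero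
    first zero    l = refl
    first (suc k) l = refl
    second : cofactor M′ (suc zero) zero ≋ cofactor M zero zero
    second zero    l = refl
    second (suc k) l = refl
    sum-neg : ∀ {n} (f g : Fin n → Carrier) → (∀ i → f i ≈ - g i) → sum f ≈ - sum g
    sum-neg {zero}  f g f≈-g = sym -0#≈0#
    sum-neg {suc n} f g f≈-g = trans (+-cong (f≈-g zero) (sum-neg (f ∘ suc) (g ∘ suc) (f≈-g ∘ suc)))
      (solve 2 (λ x y → :- x :+ :- y := :- (x :+ y)) refl _ _)
    others : ∀ n (M : Matrix (suc (suc n))) → rest (λ i → M (swap₀₁ i)) ≈ - rest M
    others zero    M = sym -0#≈0#
    others (suc n) M = sum-neg _ _ λ i → trans
      (*-congˡ {(- 1#) * (- 1# * (- 1#) ^ toℕ i)} (*-congˡ {M (suc (suc i)) zero} (trans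
        (det-cong {A = cofactor (λ k → M (swap₀₁ k)) (suc (suc i)) zero} {B = λ k → cofactor M (suc (suc i)) zero (swap₀₁ k)}
          λ { zero l → refl ; (suc zero) l → refl ; (suc (suc k)) l → refl })
        (det-swap₀₁ (cofactor M (suc (suc i)) zero)))))
      (solve 3 (λ s x d → s :* (x :* :- d) := :- (s :* (x :* d))) refl _ _ _)

  det-equal-rows : ∀ {n} (M : Matrix (suc (suc n))) → (∀ j → M zero j ≈ M (suc zero) j) → det M ≈ 0#
  det-equal-rows M eq = x≈-x⇒x≈0 (trans
    (det-cong {A = M} {B = λ i → M (swap₀₁ i)} λ { zero j → eq j ; (suc zero) j → sym (eq j) ; (suc (suc i)) j → refl }) (det-swap₀₁ M))

  det-linear-row₀ : ∀ {n} {t} (M X Y : Matrix (suc n)) →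
    (∀ j → M zero j ≈ X zero j + t * Y zero j) →
    (∀ i j → M (suc i) j ≈ X (suc i) j) → (∀ i j → M (suc i) j ≈ Y (suc i) j) →
    det M ≈ det X + t * det Y
  det-linear-row₀ {n} {t} M X Y first M≈X M≈Y = begin
    ∑[ j < suc n ] (s j * (M zero j * det (cofactor M zero j)))
      ≈⟨ (sum-cong-≋ λ j → trans (*-congˡ {s j} (*-congʳ {det (cofactor M zero j)} (first j)))
           (trans (distribute (s j) (X zero j) (Y zero j) t _)
             (+-cong (*-congˡ {s j} (*-congˡ {X zero j} (det-cong λ i k → M≈X i (punchIn j k))))
                     (*-congˡ {t} (*-congˡ {s j} (*-congˡ {Y zero j} (det-cong λ i k → M≈Y i (punchIn j k)))))))) ⟩
    ∑[ j < suc n ] (s j * (X zero j * det (cofactor X zero j)) + t * (s j * (Y zero j * det (cofactor Y zero j))))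
      ≈⟨ ∑-distrib-+ (λ j → s j * (X zero j * det (cofactor X zero j))) (λ j → t * (s j * (Y zero j * det (cofactor Y zero j)))) ⟩
    det X + ∑[ j < suc n ] (t * (s j * (Y zero j * det (cofactor Y zero j))))
      ≈⟨ +-congˡ (*-distribˡ-sum t λ j → s j * (Y zero j * det (cofactor Y zero j))) ⟨
    det X + t * det Y ∎
    where
    s : Fin (suc n) → Carrier
    s j = (- 1#) ^ toℕ j
    distribute : ∀ s x y t d → s * ((x + t * y) * d) ≈ s * (x * d) + t * (s * (y * d))
    distribute = solve 5 (λ s x y t d →
      s :* ((x :+ t :* y) :* d) := s :* (x :* d) :+ t :* (s :* (y :* d))) refl

  det-zero-row₀ : ∀ {n} (M : Matrix (suc n)) → (∀ j → M zero j ≈ 0#) → det M ≈ 0#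
  det-zero-row₀ M row≈0 = begin
    det M              ≈⟨ det-linear-row₀ {t = - 1#} M M M (λ j → trans (row≈0 j) (sym (zero-sum j))) (λ _ _ → refl) (λ _ _ → refl) ⟩
    det M + - 1# * det M ≈⟨ solve 1 (λ x → x :+ :- con (1 , 0) :* x := con (0 , 0)) refl (det M) ⟩
    0#                 ∎
    where
    zero-sum : ∀ j → M zero j + - 1# * M zero j ≈ 0#
    zero-sum j = solve 1 (λ x → x :+ :- con (1 , 0) :* x := con (0 , 0)) refl (M zero j)

  det-scale-row₀ : ∀ {n} {t} (M Y : Matrix (suc n)) → (∀ j → M zero j ≈ t * Y zero j) →
    (∀ i j → M (suc i) j ≈ Y (suc i) j) → det M ≈ t * det Y
  det-scale-row₀ {n} {t} M Y first M≈Y = begin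
    det M               ≈⟨ det-linear-row₀ M X Y (λ j → trans (first j) (sym (+-identityˡ _))) (λ _ _ → refl) M≈Y ⟩
    det X + t * det Y   ≈⟨ +-congʳ (det-zero-row₀ X λ _ → refl) ⟩
    0# + t * det Y      ≈⟨ +-identityˡ _ ⟩
    t * det Y           ∎
    where
    X : Matrix (suc n)
    X = (λ _ → 0#) ∷ tail M

  -- The block matrix [[N, v 1ᵗ], [1 uᵗ, P]].
  block : ∀ {q p} → Matrix q → (u v : Vector Carrier q) → Matrix p →
          Fin q ⊎ Fin p → Fin q ⊎ Fin p → Carrier
  block N u v P (inj₁ i) (inj₁ j) = N i j
  block N u v P (inj₁ i) (inj₂ j) = v i
  block N u v P (inj₂ i) (inj₁ j) = u j
  block N u v P (inj₂ i) (inj₂ j) = P i j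

  blockMatrix : ∀ {q p} → Matrix q → (u v : Vector Carrier q) → Matrix p → Matrix (q ℕ.+ p)
  blockMatrix {q} N u v P i j = block N u v P (splitAt q i) (splitAt q j)

  splitAt-punchIn : ∀ {q} p (j : Fin (suc q)) (k : Fin (q ℕ.+ p)) →
    splitAt (suc q) (punchIn (j ↑ˡ p) k) ≡ map₁ (punchIn j) (splitAt q k)
  splitAt-punchIn p zero k = ≡.refl
  splitAt-punchIn {suc q} p (suc j) zero = ≡.refl
  splitAt-punchIn {suc q} p (suc j) (suc k) rewrite splitAt-punchIn {q} p j k with splitAt q k
  ... | inj₁ _ = ≡.refl
  ... | inj₂ _ = ≡.refl

  cofactor-block : ∀ {q p} (N : Matrix (suc q)) u v (P : Matrix p) j →
    cofactor (blockMatrix N u v P) zero (j ↑ˡ p) ≋ blockMatrix (cofactor N zero j) (λ k → u (punchIn j k)) (tail v) P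
  cofactor-block {q} {p} N u v P j i k rewrite splitAt-punchIn p j k with splitAt q i | splitAt q k
  ... | inj₁ _ | inj₁ _ = refl
  ... | inj₁ _ | inj₂ _ = refl
  ... | inj₂ _ | inj₁ _ = refl
  ... | inj₂ _ | inj₂ _ = refl

  TransposeInvariant : ∀ {q p} → Matrix q → (u v : Vector Carrier q) → Matrix p → Set _
  TransposeInvariant N u v P = det (blockMatrix N u v P) ≈ det (blockMatrix N u v (P ᵗ))

  -- Expanding along the first row would break up the block `P` at the entries v₀ 1ᵗ. They are
  -- isolated here as v₀ times the border row (0, 1ᵗ); the cofactors of the remaining entries keep
  -- `P` whole.
  split-row₀ : ∀ {q p} (N : Matrix (suc q)) u v (P : Matrix p) →
    det (blockMatrix N u v P) ≈
    det (blockMatrix N u (0# ∷ tail v) P) + v zero * det (blockMatrix ((λ _ → 0#) ∷ tail N) u (1# ∷ tail v) P)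
  split-row₀ {q} {p} N u v P = det-linear-row₀ M X Y first second third
    where
    M = blockMatrix N u v P
    X = blockMatrix N u (0# ∷ tail v) P
    Y = blockMatrix ((λ _ → 0#) ∷ tail N) u (1# ∷ tail v) P
    first : ∀ j → M zero j ≈ X zero j + v zero * Y zero j
    first j with splitAt (suc q) j
    ... | inj₁ j = sym (trans (+-congˡ (zeroʳ _)) (+-identityʳ _))
    ... | inj₂ j = sym (trans (+-identityˡ _) (*-identityʳ _))
    second : ∀ i j → M (suc i) j ≈ X (suc i) j
    second i j with splitAt q i | splitAt (suc q) j
    ... | inj₁ _ | inj₁ _ = refl
    ... | inj₁ _ | inj₂ _ = refl
    ... | inj₂ _ | inj₁ _ = refl
    ... | inj₂ _ | inj₂ _ = refl
    third : ∀ i j → M (suc i) j ≈ Y (suc i) j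
    third i j with splitAt q i | splitAt (suc q) j
    ... | inj₁ _ | inj₁ _ = refl
    ... | inj₁ _ | inj₂ _ = refl
    ... | inj₂ _ | inj₁ _ = refl
    ... | inj₂ _ | inj₂ _ = refl

  transposeInvariant-step : ∀ {q p} (N : Matrix (suc q)) u v (P : Matrix p) →
    (∀ j → TransposeInvariant (cofactor N zero j) (λ k → u (punchIn j k)) (tail v) P) →
    TransposeInvariant ((λ _ → 0#) ∷ tail N) u (1# ∷ tail v) P →
    TransposeInvariant N u v P
  transposeInvariant-step {q} {p} N u v P minors border = begin
    det (blockMatrix N u v P)     ≈⟨ split-row₀ N u v P ⟩
    _ + v zero * _                ≈⟨ +-cong (sum-cong-≋ term) (*-congˡ border) ⟩
    _ + v zero * _                ≈⟨ split-row₀ N u v (P ᵗ) ⟨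
    det (blockMatrix N u v (P ᵗ)) ∎
    where
    X X′ : Matrix (suc q ℕ.+ p)
    X  = blockMatrix N u (0# ∷ tail v) P
    X′ = blockMatrix N u (0# ∷ tail v) (P ᵗ)
    term : ∀ j → (- 1#) ^ toℕ j * (X zero j * det (cofactor X zero j)) ≈ (- 1#) ^ toℕ j * (X′ zero j * det (cofactor X′ zero j))
    term j with splitAt (suc q) j in eq
    ... | inj₂ _ = *-congˡ (trans (zeroˡ _) (sym (zeroˡ _)))
    ... | inj₁ k with ≡.refl ← Fin.splitAt⁻¹-↑ˡ {i = j} eq = *-congˡ (*-congˡ (begin
      det (cofactor X zero (k ↑ˡ p))  ≈⟨ det-cong (cofactor-block N u (0# ∷ tail v) P k) ⟩
      _                               ≈⟨ minors k ⟩
      _                               ≈⟨ det-cong (cofactor-block N u (0# ∷ tail v) (P ᵗ) k) ⟨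
      det (cofactor X′ zero (k ↑ˡ p)) ∎))

  -- If the border row is the only row above `P`, the scalar `u zero` can be pulled out of the first
  -- column. What remains is bordered by ones on both sides, so that transposing it just replaces
  -- `P` by `P ᵗ`.
  transposeInvariant-border : ∀ {q p} (N : Matrix (suc q)) u v (P : Matrix p) →
    (∀ j → N zero j ≈ 0#) → v zero ≈ 1# → TransposeInvariant N u v P
  transposeInvariant-border {zero} {p} N u v P N≈0 v≈1 = begin
    det (blockMatrix N u v P)              ≈⟨ standard P ⟩
    u zero * det (bordered 1# 1# (P ᵗ))    ≈⟨ *-congˡ (det-transpose (bordered 1# 1# (P ᵗ))) ⟨
    u zero * det (bordered 1# 1# (P ᵗ) ᵗ)  ≈⟨ *-congˡ (det-cong (bordered-ᵗ 1# 1# (P ᵗ))) ⟩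
    u zero * det (bordered 1# 1# P)        ≈⟨ standard (P ᵗ) ⟨
    det (blockMatrix N u v (P ᵗ))          ∎
    where
    bordered : Carrier → Carrier → Matrix p → Matrix (suc p)
    bordered t w Q = blockMatrix (λ _ _ → 0#) (λ _ → w) (λ _ → t) Q
    bordered-ᵗ : ∀ t w Q → bordered t w Q ᵗ ≋ bordered w t (Q ᵗ)
    bordered-ᵗ t w Q zero    zero    = refl
    bordered-ᵗ t w Q zero    (suc j) = refl
    bordered-ᵗ t w Q (suc i) zero    = refl
    bordered-ᵗ t w Q (suc i) (suc j) = refl
    as-bordered : ∀ Q → blockMatrix N u v Q ≋ bordered 1# (u zero) Q
    as-bordered Q zero    zero    = N≈0 zero
    as-bordered Q zero    (suc j) = v≈1
    as-bordered Q (suc i) zero    = refl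
    as-bordered Q (suc i) (suc j) = refl
    scaled : ∀ w Q j → bordered w 1# Q zero j ≈ w * bordered 1# 1# Q zero j
    scaled w Q zero    = sym (zeroʳ w)
    scaled w Q (suc j) = sym (*-identityʳ w)
    rows : ∀ w Q i j → bordered w 1# Q (suc i) j ≈ bordered 1# 1# Q (suc i) j
    rows w Q i zero    = refl
    rows w Q i (suc j) = refl
    standard : ∀ Q → det (blockMatrix N u v Q) ≈ u zero * det (bordered 1# 1# (Q ᵗ))
    standard Q = begin
      det (blockMatrix N u v Q)              ≈⟨ det-cong (as-bordered Q) ⟩
      det (bordered 1# (u zero) Q)           ≈⟨ det-transpose (bordered 1# (u zero) Q) ⟨
      det (bordered 1# (u zero) Q ᵗ)         ≈⟨ det-cong (bordered-ᵗ 1# (u zero) Q) ⟩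
      det (bordered (u zero) 1# (Q ᵗ))       ≈⟨ det-scale-row₀ (bordered (u zero) 1# (Q ᵗ)) (bordered 1# 1# (Q ᵗ)) (scaled (u zero) (Q ᵗ)) (rows (u zero) (Q ᵗ)) ⟩
      u zero * det (bordered 1# 1# (Q ᵗ))    ∎
  -- The next row is brought to the top and split in its turn: its cofactors still contain the
  -- border row, and its own border part makes two rows equal.
  transposeInvariant-border {suc q} {p} N u v P N≈0 v≈1 = begin
    det (blockMatrix N u v P)            ≈⟨ swapped P ⟩
    - det (blockMatrix N′ u v′ P)        ≈⟨ -‿cong (transposeInvariant-step N′ u v′ P minors border) ⟩
    - det (blockMatrix N′ u v′ (P ᵗ))    ≈⟨ swapped (P ᵗ) ⟨
    det (blockMatrix N u v (P ᵗ))        ∎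
    where
    N′ : Matrix (suc (suc q))
    N′ i = N (swap₀₁ i)
    v′ : Vector Carrier (suc (suc q))
    v′ i = v (swap₀₁ i)
    swapped : ∀ Q → det (blockMatrix N u v Q) ≈ - det (blockMatrix N′ u v′ Q)
    swapped Q = trans (det-cong eq) (det-swap₀₁ (blockMatrix N′ u v′ Q))
      where
      eq : blockMatrix N u v Q ≋ λ i → blockMatrix N′ u v′ Q (swap₀₁ i)
      eq zero j with splitAt (suc (suc q)) j
      ... | inj₁ _ = refl
      ... | inj₂ _ = refl
      eq (suc zero) j with splitAt (suc (suc q)) j
      ... | inj₁ _ = refl
      ... | inj₂ _ = refl
      eq (suc (suc i)) j with splitAt q i | splitAt (suc (suc q)) j
      ... | inj₁ _ | inj₁ _ = refl
      ... | inj₁ _ | inj₂ _ = refl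
      ... | inj₂ _ | inj₁ _ = refl
      ... | inj₂ _ | inj₂ _ = refl
    minors : ∀ j → TransposeInvariant (cofactor N′ zero j) (λ k → u (punchIn j k)) (tail v′) P
    minors j = transposeInvariant-border (cofactor N′ zero j) (λ k → u (punchIn j k)) (tail v′) P (λ k → N≈0 (punchIn j k)) v≈1
    vanish : ∀ Q → det (blockMatrix ((λ _ → 0#) ∷ tail N′) u (1# ∷ tail v′) Q) ≈ 0#
    vanish Q = det-equal-rows (blockMatrix ((λ _ → 0#) ∷ tail N′) u (1# ∷ tail v′) Q) eq
      where
      eq : ∀ j → blockMatrix ((λ _ → 0#) ∷ tail N′) u (1# ∷ tail v′) Q zero j ≈
                 blockMatrix ((λ _ → 0#) ∷ tail N′) u (1# ∷ tail v′) Q (suc zero) j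
      eq j with splitAt (suc (suc q)) j
      ... | inj₁ k = sym (N≈0 k)
      ... | inj₂ _ = sym v≈1
    border : TransposeInvariant ((λ _ → 0#) ∷ tail N′) u (1# ∷ tail v′) P
    border = trans (vanish P) (sym (vanish (P ᵗ)))

  transposeInvariant : ∀ {q p} (N : Matrix q) u v (P : Matrix p) → TransposeInvariant N u v P
  transposeInvariant {zero}  N u v P = sym (det-transpose P)
  transposeInvariant {suc q} N u v P = transposeInvariant-step N u v P
    (λ j → transposeInvariant (cofactor N zero j) (λ k → u (punchIn j k)) (tail v) P)
    (transposeInvariant-border ((λ _ → 0#) ∷ tail N) u (1# ∷ tail v) P (λ _ → refl) refl)

-- Inverting a clan preserves the determinant.

module ClanInversion {c ℓ₁ ℓ₂} (ℝ : CompleteOrderedField c ℓ₁ ℓ₂) where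
  open CompleteOrderedField ℝ hiding (zero)
  open RealMatrices ℝ
  open IntegerCoefficients commutativeRing using (solve; _:=_; con; _:*_; :-_; _:-_)
  open Determinant ℝ
  open SemiringSum semiring using (sum-syntax; sum-cong-≋; *-distribˡ-sum)
  open Exp semiring using (_^_)
  open RingProperties ring using (-1*x≈-x)
  open SetoidReasoning setoid

  -- Permutations are recorded through their effect on determinants. Only the square of the sign
  -- matters, because rows and columns are always permuted together.
  record Signed {n} (f : Fin n → Fin n) : Set (c Level.⊔ ℓ₁) where
    field
      sign      : Carrier
      sign²     : sign * sign ≈ 1#
      injective : ∀ {i j} → f i ≡ f j → i ≡ j
      det-rows  : ∀ M → det (λ i → M (f i)) ≈ sign * det M

    det-conjugate : ∀ M → det (λ i j → M (f i) (f j)) ≈ det M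
    det-conjugate M = begin
      det (λ i j → M (f i) (f j))      ≈⟨ det-rows (λ i j → M i (f j)) ⟩
      sign * det (λ i j → M i (f j))   ≈⟨ *-congˡ (det-transpose (λ i j → M i (f j))) ⟨
      sign * det (λ i → (M ᵗ) (f i))   ≈⟨ *-congˡ (det-rows (M ᵗ)) ⟩
      sign * (sign * det (M ᵗ))        ≈⟨ *-assoc _ _ _ ⟨
      sign * sign * det (M ᵗ)          ≈⟨ *-cong sign² (det-transpose M) ⟩
      1# * det M                       ≈⟨ *-identityˡ _ ⟩
      det M                            ∎

  open Signed

  signed-id : ∀ {n} → Signed {n} id
  signed-id = record
    { sign = 1# ; sign² = *-identityˡ 1# ; injective = id ; det-rows = λ M → sym (*-identityˡ _) }

  signed-∘ : ∀ {n} {f g : Fin n → Fin n} → Signed f → Signed g → Signed (f ∘ g)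
  signed-∘ {f = f} F G = record
    { sign = sign G * sign F
    ; sign² = trans (solve 2 (λ x y → (x :* y) :* (x :* y) := (x :* x) :* (y :* y)) refl (sign G) (sign F))
                (trans (*-cong (sign² G) (sign² F)) (*-identityˡ 1#))
    ; injective = injective G ∘ injective F
    ; det-rows = λ M → trans (det-rows G (λ i → M (f i))) (trans (*-congˡ (det-rows F M)) (sym (*-assoc _ _ _)))
    }

  lift : ∀ {n} → (Fin n → Fin n) → Fin (suc n) → Fin (suc n)
  lift f zero    = zero
  lift f (suc i) = suc (f i)

  signed-lift : ∀ {n} {f : Fin n → Fin n} → Signed f → Signed (lift f)
  signed-lift {n} {f} F = record
    { sign = sign F ; sign² = sign² F ; injective = inj
    ; det-rows = λ M → begin
        det (λ i → M (lift f i))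
          ≈⟨ (sum-cong-≋ λ j → trans
               (*-congˡ {(- 1#) ^ toℕ j} (*-congˡ {M zero j} (det-rows F (cofactor M zero j))))
               (solve 4 (λ s x t d → s :* (x :* (t :* d)) := t :* (s :* (x :* d))) refl _ _ _ _)) ⟩
        ∑[ j < suc n ] (sign F * ((- 1#) ^ toℕ j * (M zero j * det (cofactor M zero j))))
          ≈⟨ *-distribˡ-sum (sign F) (λ j → (- 1#) ^ toℕ j * (M zero j * det (cofactor M zero j))) ⟨
        sign F * det M ∎
    }
    where
    inj : ∀ {i j} → lift f i ≡ lift f j → i ≡ j
    inj {zero}  {zero}  e = ≡.refl
    inj {suc i} {suc j} e = ≡.cong suc (injective F (Fin.suc-injective e))

  signed-swap₀₁ : ∀ {n} → Signed (swap₀₁ {n})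
  signed-swap₀₁ = record
    { sign = - 1# ; sign² = solve 0 (:- con (1 , 0) :* :- con (1 , 0) := con (1 , 0)) refl
    ; injective = λ {i} {j} e → ≡.trans (≡.sym (involutive i)) (≡.trans (≡.cong swap₀₁ e) (involutive j))
    ; det-rows = λ M → trans (det-swap₀₁ M) (sym (-1*x≈-x (det M)))
    }
    where
    involutive : ∀ {n} (i : Fin (suc (suc n))) → swap₀₁ (swap₀₁ i) ≡ i
    involutive zero          = ≡.refl
    involutive (suc zero)    = ≡.refl
    involutive (suc (suc i)) = ≡.refl

  Sorted : ∀ {n} → (Fin n → ℕ) → Set
  Sorted key = ∀ i j → i Fin.< j → key i ℕ.≤ key j

  private
    insert : ∀ {n} (key : Fin (suc n) → ℕ) → Sorted (key ∘ suc) → ∃[ f ] Signed f × Sorted (key ∘ f)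
    insert {zero} key sorted = id , signed-id , λ { zero zero () }
    insert {suc n} key sorted with key zero ℕ.≤? key (suc zero)
    ... | yes k₀≤k₁ = id , signed-id , sorted′
      where
      sorted′ : Sorted key
      sorted′ zero (suc zero)    _ = k₀≤k₁
      sorted′ zero (suc (suc j)) _ = ℕ.≤-trans k₀≤k₁ (sorted zero (suc j) (s≤s z≤n))
      sorted′ (suc i) (suc j) (s≤s i<j) = sorted i j i<j
    ... | no k₀≰k₁ with insert (key ∘ swap₀₁ ∘ suc) (λ i j i<j → sorted (suc i) (suc j) (s≤s i<j))
    ... | g , G , sorted-g = swap₀₁ ∘ lift g , signed-∘ signed-swap₀₁ (signed-lift G) , sorted′
      where
      least : ∀ k → key (suc zero) ℕ.≤ key (swap₀₁ (suc k))
      least zero    = ℕ.<⇒≤ (ℕ.≰⇒> k₀≰k₁)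
      least (suc k) = sorted zero (suc k) (s≤s z≤n)
      sorted′ : Sorted (key ∘ swap₀₁ ∘ lift g)
      sorted′ zero    (suc j) _         = least (g j)
      sorted′ (suc i) (suc j) (s≤s i<j) = sorted-g i j i<j

  -- Insertion sort by adjacent transpositions. It serves twice: with keys 0 and 1 it moves a clan
  -- to the end, and with the indices as keys it makes an injective tuple increasing.
  sort : ∀ {n} (key : Fin n → ℕ) → ∃[ f ] Signed f × Sorted (key ∘ f)
  sort {zero}  key = id , signed-id , λ ()
  sort {suc n} key with sort (key ∘ suc)
  ... | f , F , sorted-f with insert (key ∘ lift f) sorted-f
  ... | g , G , sorted-g = lift f ∘ g , signed-∘ (signed-lift F) G , sorted-g

  -- Phrased with an indicator function, the relation passes to principal submatrices and to
  -- permuted indices by mere composition.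
  record TransposedOnClan {n} (χ : Fin n → Bool) (M M′ : Matrix n) : Set ℓ₁ where
    field
      rows         : ∀ {i j k} → χ i ≡ true → χ j ≡ true → χ k ≡ false → M i k ≈ M j k
      columns      : ∀ {i j k} → χ i ≡ true → χ j ≡ true → χ k ≡ false → M k i ≈ M k j
      transposed   : ∀ {i j} → χ i ≡ true → χ j ≡ true → M′ i j ≈ M j i
      unchangedʳ   : ∀ {i j} → χ i ≡ false → M′ i j ≈ M i j
      unchangedᶜ   : ∀ {i j} → χ j ≡ false → M′ i j ≈ M i j

  reindex : ∀ {m n} {χ : Fin n → Bool} {M M′} (f : Fin m → Fin n) → TransposedOnClan χ M M′ →
    TransposedOnClan (χ ∘ f) (λ i j → M (f i) (f j)) (λ i j → M′ (f i) (f j))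
  reindex f T = record
    { rows = T.rows ; columns = T.columns ; transposed = T.transposed
    ; unchangedʳ = T.unchangedʳ ; unchangedᶜ = T.unchangedᶜ }
    where module T = TransposedOnClan T

  private
    weight : Bool → ℕ
    weight b = if b then 1 else 0

    isRight : ∀ {q p} → Fin q ⊎ Fin p → Bool
    isRight = [ const false , const true ]′

    split-sorted : ∀ {n} (χ : Fin n → Bool) → Sorted (weight ∘ χ) →
      ∃₂ λ q p → Σ[ e ∈ q ℕ.+ p ≡ n ] (∀ i → χ (≡.subst Fin e i) ≡ isRight (splitAt q i))
    split-sorted {zero} χ sorted = 0 , 0 , ≡.refl , λ ()
    split-sorted {suc n} χ sorted with χ zero in eq
    ... | true = 0 , suc n , ≡.refl , right
      where
      right : ∀ i → χ i ≡ true
      right zero = eq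
      right (suc i) with χ (suc i) | sorted zero (suc i) (s≤s z≤n)
      ... | true  | _ = ≡.refl
      ... | false | 1≤0 rewrite eq = contradiction 1≤0 λ ()
    ... | false with split-sorted (χ ∘ suc) (λ i j i<j → sorted (suc i) (suc j) (s≤s i<j))
    ... | q , p , ≡.refl , h = suc q , p , ≡.refl , right
      where
      right : ∀ i → χ i ≡ isRight (splitAt (suc q) i)
      right zero = eq
      right (suc i) with splitAt q i | h i
      ... | inj₁ _ | e = e
      ... | inj₂ _ | e = e

    det-transposed-sorted : ∀ {n} {χ : Fin n → Bool} {M M′} → Sorted (weight ∘ χ) →
      TransposedOnClan χ M M′ → det M ≈ det M′
    det-transposed-sorted {χ = χ} {M} {M′} sorted T with split-sorted χ sorted
    ... | q , p , ≡.refl , h = begin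
      det M                         ≈⟨ det-cong M≋ ⟩
      det (blockMatrix N u v P)     ≈⟨ transposeInvariant N u v P ⟩
      det (blockMatrix N u v (P ᵗ)) ≈⟨ det-cong M′≋ ⟨
      det M′                        ∎
      where
      open TransposedOnClan T
      N : Matrix q
      N i j = M (i ↑ˡ p) (j ↑ˡ p)
      P : Matrix p
      P i j = M (q ↑ʳ i) (q ↑ʳ j)
      -- If the clan is empty, the vectors `u` and `v` label no entry, and 0 is a default.
      representative : ∀ {p} → (Fin p → Carrier) → Carrier
      representative {zero}  f = 0#
      representative {suc p} f = f zero
      representative≈ : ∀ {p} (f : Fin p → Carrier) → (∀ i j → f i ≈ f j) → ∀ i → f i ≈ representative f
      representative≈ {suc p} f const i = const i zero
      u v : Fin q → Carrier
      u j = representative λ k → M (q ↑ʳ k) (j ↑ˡ p)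
      v i = representative λ k → M (i ↑ˡ p) (q ↑ʳ k)
      left : ∀ i → χ (i ↑ˡ p) ≡ false
      left i = ≡.trans (h (i ↑ˡ p)) (≡.cong isRight (Fin.splitAt-↑ˡ q i p))
      right : ∀ i → χ (q ↑ʳ i) ≡ true
      right i = ≡.trans (h (q ↑ʳ i)) (≡.cong isRight (Fin.splitAt-↑ʳ q p i))
      u≈ : ∀ i j → M (q ↑ʳ i) (j ↑ˡ p) ≈ u j
      u≈ i j = representative≈ _ (λ k l → rows (right k) (right l) (left j)) i
      v≈ : ∀ i j → M (i ↑ˡ p) (q ↑ʳ j) ≈ v i
      v≈ i j = representative≈ _ (λ k l → columns (right k) (right l) (left i)) j
      M≋ : M ≋ blockMatrix N u v P
      M≋ i j with splitAt q i in ei | splitAt q j in ej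
      ... | inj₁ k | inj₁ l with ≡.refl ← Fin.splitAt⁻¹-↑ˡ {i = i} ei | ≡.refl ← Fin.splitAt⁻¹-↑ˡ {i = j} ej = refl
      ... | inj₁ k | inj₂ l with ≡.refl ← Fin.splitAt⁻¹-↑ˡ {i = i} ei | ≡.refl ← Fin.splitAt⁻¹-↑ʳ {i = j} ej = v≈ k l
      ... | inj₂ k | inj₁ l with ≡.refl ← Fin.splitAt⁻¹-↑ʳ {i = i} ei | ≡.refl ← Fin.splitAt⁻¹-↑ˡ {i = j} ej = u≈ k l
      ... | inj₂ k | inj₂ l with ≡.refl ← Fin.splitAt⁻¹-↑ʳ {i = i} ei | ≡.refl ← Fin.splitAt⁻¹-↑ʳ {i = j} ej = refl
      M′≋ : M′ ≋ blockMatrix N u v (P ᵗ)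
      M′≋ i j with splitAt q i in ei | splitAt q j in ej
      ... | inj₁ k | inj₁ l with ≡.refl ← Fin.splitAt⁻¹-↑ˡ {i = i} ei | ≡.refl ← Fin.splitAt⁻¹-↑ˡ {i = j} ej = unchangedʳ (left k)
      ... | inj₁ k | inj₂ l with ≡.refl ← Fin.splitAt⁻¹-↑ˡ {i = i} ei | ≡.refl ← Fin.splitAt⁻¹-↑ʳ {i = j} ej = trans (unchangedʳ (left k)) (v≈ k l)
      ... | inj₂ k | inj₁ l with ≡.refl ← Fin.splitAt⁻¹-↑ʳ {i = i} ei | ≡.refl ← Fin.splitAt⁻¹-↑ˡ {i = j} ej = trans (unchangedᶜ (left l)) (u≈ k l)
      ... | inj₂ k | inj₂ l with ≡.refl ← Fin.splitAt⁻¹-↑ʳ {i = i} ei | ≡.refl ← Fin.splitAt⁻¹-↑ʳ {i = j} ej = transposed (right k) (right l)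

  det-transposedOnClan : ∀ {n} {χ : Fin n → Bool} {M M′} → TransposedOnClan χ M M′ → det M ≈ det M′
  det-transposedOnClan {χ = χ} {M} {M′} T with sort (weight ∘ χ)
  ... | f , F , sorted = begin
    det M                           ≈⟨ det-conjugate F M ⟨
    det (λ i j → M (f i) (f j))     ≈⟨ det-transposed-sorted sorted (reindex f T) ⟩
    det (λ i j → M′ (f i) (f j))    ≈⟨ det-conjugate F M′ ⟩
    det M′                          ∎

-- Minors of orders 2, 3 and 4 in terms of the weights.

module SmallMinors {c ℓ₁ ℓ₂} (ℝ : CompleteOrderedField c ℓ₁ ℓ₂) where
  open CompleteOrderedField ℝ hiding (zero)
  open RealMatrices ℝ
  open IntegerCoefficients commutativeRing using (Polynomial; solve; _:=_; con; _:+_; _:*_; :-_; _:-_)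
  open Determinant ℝ
  open ClanInversion ℝ
  open SemiringSum semiring using (sum-syntax; sum-cong-≋; *-distribˡ-sum)
  open Exp semiring using (_^_)
  open RingProperties ring using (-0#≈0#)
  open SetoidReasoning setoid

  -- The syntax follows the recursion of `det` literally, so that a determinant of concrete size is
  -- by computation the value of its `symDet` and the solver can expand it.
  symSum : ∀ {m n} → (Fin n → Polynomial m) → Polynomial m
  symSum {n = zero}  f = con (0 , 0)
  symSum {n = suc n} f = f zero :+ symSum (λ i → f (suc i))

  symSign : ∀ {m} → ℕ → Polynomial m
  symSign zero    = con (1 , 0)
  symSign (suc k) = :- con (1 , 0) :* symSign k

  symDet : ∀ {m n} → (Fin n → Fin n → Polynomial m) → Polynomial m
  symDet {n = zero}  M = con (1 , 0)
  symDet {n = suc n} M =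
    symSum λ j → symSign (toℕ j) :* (M zero j :* symDet (λ i k → M (suc i) (punchIn j k)))

  -- One pattern serves both for matrices over the field and for matrices of solver polynomials.
  module _ {a} {A : Set a} (o : A) (_⁺ _⁻ : A → A) where
    pattern₂ : A → Fin 2 → Fin 2 → A
    pattern₂ x₀₁ =
      (o       ∷ (x₀₁ ⁺) ∷ []) ∷
      ((x₀₁ ⁻) ∷ o       ∷ []) ∷ []

    pattern₃ : (x₀₁ x₀₂ x₁₂ : A) → Fin 3 → Fin 3 → A
    pattern₃ x₀₁ x₀₂ x₁₂ =
      (o       ∷ (x₀₁ ⁺) ∷ (x₀₂ ⁺) ∷ []) ∷
      ((x₀₁ ⁻) ∷ o       ∷ (x₁₂ ⁺) ∷ []) ∷
      ((x₀₂ ⁻) ∷ (x₁₂ ⁻) ∷ o       ∷ []) ∷ []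

    pattern₄ : (x₀₁ x₀₂ x₀₃ x₁₂ x₁₃ x₂₃ : A) → Fin 4 → Fin 4 → A
    pattern₄ x₀₁ x₀₂ x₀₃ x₁₂ x₁₃ x₂₃ =
      (o       ∷ (x₀₁ ⁺) ∷ (x₀₂ ⁺) ∷ (x₀₃ ⁺) ∷ []) ∷
      ((x₀₁ ⁻) ∷ o       ∷ (x₁₂ ⁺) ∷ (x₁₃ ⁺) ∷ []) ∷
      ((x₀₂ ⁻) ∷ (x₁₂ ⁻) ∷ o       ∷ (x₂₃ ⁺) ∷ []) ∷
      ((x₀₃ ⁻) ∷ (x₁₃ ⁻) ∷ (x₂₃ ⁻) ∷ o       ∷ []) ∷ []

  private
    -- Off the diagonal A i j + A j i = 1, so with x = A i j - A j i the doubled entries are 1 + x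
    -- and 1 - x.
    plus minus : Carrier → Carrier
    plus x  = 1# + x
    minus x = 1# - x

    symPlus symMinus : ∀ {m} → Polynomial m → Polynomial m
    symPlus x  = con (1 , 0) :+ x
    symMinus x = con (1 , 0) :- x

  -- The second elementary symmetric functions of x₀₁, x₁₂, x₂₀ and of the three terms of
  -- the Pfaffian of the skew-symmetric matrix with entries xᵢⱼ.
  triple : (x₀₁ x₀₂ x₁₂ : Carrier) → Carrier
  triple x₀₁ x₀₂ x₁₂ = x₀₁ * x₁₂ + (- (x₁₂ * x₀₂) + - (x₀₂ * x₀₁))

  quadruple : (x₀₁ x₀₂ x₀₃ x₁₂ x₁₃ x₂₃ : Carrier) → Carrier
  quadruple x₀₁ x₀₂ x₀₃ x₁₂ x₁₃ x₂₃ = p * q + (q * r + r * p)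
    where
    p = x₀₁ * x₂₃
    q = - (x₀₂ * x₁₃)
    r = x₀₃ * x₁₂

  private
    symTriple : ∀ {m} (x₀₁ x₀₂ x₁₂ : Polynomial m) → Polynomial m
    symTriple x₀₁ x₀₂ x₁₂ = x₀₁ :* x₁₂ :+ (:- (x₁₂ :* x₀₂) :+ :- (x₀₂ :* x₀₁))

    symQuadruple : ∀ {m} (x₀₁ x₀₂ x₀₃ x₁₂ x₁₃ x₂₃ : Polynomial m) → Polynomial m
    symQuadruple x₀₁ x₀₂ x₀₃ x₁₂ x₁₃ x₂₃ = p :* q :+ (q :* r :+ r :* p)
      where
      p = x₀₁ :* x₂₃
      q = :- (x₀₂ :* x₁₃)
      r = x₀₃ :* x₁₂

  det-pattern₂ : ∀ x → det (pattern₂ 0# plus minus x) ≈ x * x - 1#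
  det-pattern₂ = solve 1 (λ x →
    symDet (pattern₂ (con (0 , 0)) symPlus symMinus x) := x :* x :- con (1 , 0)) refl

  det-pattern₃ : ∀ x y z → det (pattern₃ 0# plus minus x y z) ≈ (1# + 1#) + (1# + 1#) * triple x y z
  det-pattern₃ = solve 3 (λ x y z →
    symDet (pattern₃ (con (0 , 0)) symPlus symMinus x y z) :=
    (con (1 , 0) :+ con (1 , 0)) :+ (con (1 , 0) :+ con (1 , 0)) :* symTriple x y z) refl

  private
    squares₄ : (x₀₁ x₀₂ x₀₃ x₁₂ x₁₃ x₂₃ : Carrier) → Carrier
    squares₄ a b c d e f =
      - (1# + (1# + 1#)) + (- (a + (b + (c + (d + (e + f))))) + (a * f + (b * e + c * d)))

    triples₄ : (x₀₁ x₀₂ x₀₃ x₁₂ x₁₃ x₂₃ : Carrier) → Carrier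
    triples₄ a b c d e f = triple a b d + (triple a c e + (triple b c f + triple d e f))

  -- The products of opposite squares and twice `quadruple` form the square of the Pfaffian. All
  -- terms but `quadruple` are determined by orders 2 and 3, hence can be subtracted.
  det-pattern₄ : ∀ a b c d e f → det (pattern₄ 0# plus minus a b c d e f) ≈
    squares₄ (a * a) (b * b) (c * c) (d * d) (e * e) (f * f)
    + (- ((1# + 1#) * triples₄ a b c d e f) + (1# + 1#) * quadruple a b c d e f)
  det-pattern₄ = solve 6 (λ a b c d e f →
    symDet (pattern₄ (con (0 , 0)) symPlus symMinus a b c d e f) :=
    symSquares (a :* a) (b :* b) (c :* c) (d :* d) (e :* e) (f :* f)
    :+ (:- (two :* (symTriple a b d :+ (symTriple a c e :+ (symTriple b c f :+ symTriple d e f))))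
        :+ two :* symQuadruple a b c d e f)) refl
    where
    one two : ∀ {m} → Polynomial m
    one = con (1 , 0)
    two = one :+ one
    symSquares : ∀ {m} (x₀₁ x₀₂ x₀₃ x₁₂ x₁₃ x₂₃ : Polynomial m) → Polynomial m
    symSquares a b c d e f =
      :- (one :+ (one :+ one)) :+ (:- (a :+ (b :+ (c :+ (d :+ (e :+ f))))) :+ (a :* f :+ (b :* e :+ c :* d)))

  double-cancel : ∀ {x y} → (1# + 1#) * x ≈ (1# + 1#) * y → x ≈ y
  double-cancel {x} {y} 2x≈2y = x-y≈0⇒x≈y (x*y≈0⇒y≈0 1+1≉0 (begin
    (1# + 1#) * (x - y)               ≈⟨ solve 3 (λ t x y → t :* (x :- y) := t :* x :- t :* y) refl (1# + 1#) x y ⟩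
    (1# + 1#) * x - (1# + 1#) * y     ≈⟨ +-congʳ 2x≈2y ⟩
    (1# + 1#) * y - (1# + 1#) * y     ≈⟨ -‿inverseʳ _ ⟩
    0#                                ∎))

  det-scale : ∀ {n} t (M : Matrix n) → det (λ i j → t * M i j) ≈ t ^ n * det M
  det-scale {zero}  t M = sym (*-identityʳ 1#)
  det-scale {suc n} t M = begin
    det (λ i j → t * M i j)
      ≈⟨ (sum-cong-≋ λ j → trans (*-congˡ {s j} (*-congˡ {t * M zero j} (det-scale t (cofactor M zero j))))
           (solve 5 (λ s t x p d → s :* (t :* x :* (p :* d)) := t :* p :* (s :* (x :* d))) refl _ _ _ _ _)) ⟩
    ∑[ j < suc n ] (t * t ^ n * (s j * (M zero j * det (cofactor M zero j))))
      ≈⟨ *-distribˡ-sum (t * t ^ n) (λ j → s j * (M zero j * det (cofactor M zero j))) ⟨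
    t ^ suc n * det M ∎
    where
    s : Fin (suc n) → Carrier
    s j = (- 1#) ^ toℕ j

  skew : ∀ {n} → Matrix n → Matrix n
  skew M i j = M i j - M j i

  skew-neg : ∀ {n} (M : Matrix n) i j → skew M j i ≈ - skew M i j
  skew-neg M i j = solve 2 (λ x y → y :- x := :- (x :- y)) refl (M i j) (M j i)

  Injection : ∀ {m n} → (Fin m → Fin n) → Set
  Injection f = ∀ {i j} → f i ≡ f j → i ≡ j

  -- Injective tuples allow vertices to be named in any order, and the bound `U` lets the hypothesis
  -- be restricted in the induction.
  SmallMinors : ∀ {n} → Subset n → Matrix n → Matrix n → Set ℓ₁
  SmallMinors {n} U A B = ∀ {m} → m ℕ.≤ 4 → (f : Fin m → Fin n) → Injection f → (∀ i → f i ∈ U) →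
    det (λ i j → A (f i) (f j)) ≈ det (λ i j → B (f i) (f j))

  private
    shift : ∀ {m n} (f : Fin m → Fin (suc n)) → (∀ i → f i ≢ zero) → ∃[ g ] ∀ i → f i ≡ suc (g i)
    shift f f≢0 = (λ i → proj₁ (pred (f i) (f≢0 i))) , λ i → proj₂ (pred (f i) (f≢0 i))
      where
      pred : ∀ {n} (i : Fin (suc n)) → i ≢ zero → ∃[ j ] i ≡ suc j
      pred zero    i≢0 = contradiction ≡.refl i≢0
      pred (suc j) i≢0 = j , ≡.refl

    Increasing : ∀ {m n} → (Fin m → Fin n) → Set
    Increasing f = ∀ i j → i Fin.< j → f i Fin.< f j

    unshift : ∀ {m n} {f : Fin m → Fin (suc n)} {g : Fin m → Fin n} →
      (∀ i → f i ≡ suc (g i)) → Increasing f → Increasing g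
    unshift f≡g inc i j i<j = ℕ.s<s⁻¹ (≡.subst₂ Fin._<_ (f≡g i) (f≡g j) (inc i j i<j))

    increasing⇒enum : ∀ {m n} (f : Fin m → Fin n) → Increasing f →
      ∃[ X ] Σ[ e ∈ m ≡ ∣ X ∣ ] (∀ i → f i ≡ enum X (≡.subst Fin e i))
    increasing⇒enum {zero} {zero} f inc = Vec.[] , ≡.refl , λ ()
    increasing⇒enum {suc m} {zero} f inc with () ← f zero
    increasing⇒enum {zero} {suc n} f inc with increasing⇒enum {zero} {n} (λ ()) (λ ())
    ... | X , e , h = outside Vec.∷ X , e , λ ()
    increasing⇒enum {suc m} {suc n} f inc with f zero in f₀
    ... | zero with shift (f ∘ suc) (λ i fi≡0 → ℕ.<⇒≢ (inc zero (suc i) (s≤s z≤n)) (≡.cong toℕ (≡.trans f₀ (≡.sym fi≡0))))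
    ... | g , f≡g with increasing⇒enum g (unshift f≡g λ i j i<j → inc (suc i) (suc j) (s≤s i<j))
    ... | X , ≡.refl , h = inside Vec.∷ X , ≡.refl , λ { zero → f₀ ; (suc i) → ≡.trans (f≡g i) (≡.cong suc (h i)) }
    increasing⇒enum {suc m} {suc n} f inc | suc _ with shift f nonzero
      where
      nonzero : ∀ i → f i ≢ zero
      nonzero zero    e = contradiction (≡.trans (≡.sym f₀) e) λ ()
      nonzero (suc i) e = contradiction (≡.subst (toℕ (f zero) ℕ.<_) (≡.cong toℕ e) (inc zero (suc i) (s≤s z≤n))) λ ()
    ... | g , f≡g with increasing⇒enum g (unshift f≡g inc)
    ... | X , e , h = outside Vec.∷ X , e , λ i → ≡.trans (f≡g i) (≡.cong suc (h i))

  -- Sorting the tuple conjugates the matrix by a permutation, which leaves the determinant alone,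
  -- and an increasing tuple enumerates its image.
  samePrincipalMinorsUpTo⇒smallMinors : ∀ {n} {U} {A B : Matrix n} →
    SamePrincipalMinorsUpTo 4 A B → SmallMinors U A B
  samePrincipalMinorsUpTo⇒smallMinors same {zero} m≤4 f inj _ = refl
  samePrincipalMinorsUpTo⇒smallMinors {A = A} {B} same {suc m} m≤4 f inj _ with sort (toℕ ∘ f)
  ... | g , G , sorted with increasing⇒enum (f ∘ g) increasing
    where
    increasing : Increasing (f ∘ g)
    increasing i j i<j = ℕ.≤∧≢⇒< (sorted i j i<j)
      λ e → ℕ.<⇒≢ i<j (≡.cong toℕ (Signed.injective G (inj (Fin.toℕ-injective e))))
  ... | X , m≡∣X∣ , h = begin
    det (λ i j → A (f i) (f j))              ≈⟨ toEnum A X m≡∣X∣ h ⟩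
    det (A [ X ])                            ≈⟨ same X (≡.subst (1 ℕ.≤_) m≡∣X∣ (s≤s z≤n)) (≡.subst (ℕ._≤ 4) m≡∣X∣ m≤4) ⟩
    det (B [ X ])                            ≈⟨ toEnum B X m≡∣X∣ h ⟨
    det (λ i j → B (f i) (f j))              ∎
    where
    toEnum : ∀ M X (e : suc m ≡ ∣ X ∣) → (∀ i → f (g i) ≡ enum X (≡.subst Fin e i)) →
      det (λ i j → M (f i) (f j)) ≈ det (M [ X ])
    toEnum M X e h = trans (sym (Signed.det-conjugate G (λ i j → M (f i) (f j)))) (along e h)
      where
      along : ∀ {k} {f′ : Fin k → _} (e : suc m ≡ k) → (∀ i → f (g i) ≡ f′ (≡.subst Fin e i)) →
        det (λ i j → M (f (g i)) (f (g j))) ≈ det (λ i j → M (f′ i) (f′ j))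
      along ≡.refl h = det-cong λ i j → reflexive (≡.cong₂ M (h i) (h j))

  ∷-injection : ∀ {m n} {x} {f : Fin m → Fin n} → (∀ i → x ≢ f i) → Injection f → Injection (x ∷ f)
  ∷-injection x∉f inj {zero}  {zero}  e = ≡.refl
  ∷-injection x∉f inj {zero}  {suc j} e = contradiction e (x∉f j)
  ∷-injection x∉f inj {suc i} {zero}  e = contradiction (≡.sym e) (x∉f i)
  ∷-injection x∉f inj {suc i} {suc j} e = ≡.cong suc (inj e)

  module _ {n} {A : Matrix n} (tournament : IsGeneralizedTournament A) where
    open IsGeneralizedTournament tournament

    complementary : ∀ {i j} → i ≢ j → A i j + A j i ≈ 1#
    complementary {i} {j} i≢j = trans (M+Mᵗ i j) (trans (+-congˡ (-‿cong (reflexive off-diagonal)))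
      (trans (+-congˡ -0#≈0#) (+-identityʳ 1#)))
      where
      off-diagonal : I n i j ≡ 0#
      off-diagonal rewrite dec-false (i Fin.≟ j) i≢j = ≡.refl

    diagonal : ∀ i → A i i ≈ 0#
    diagonal i = double-cancel (begin
      (1# + 1#) * A i i  ≈⟨ solve 1 (λ x → (con (1 , 0) :+ con (1 , 0)) :* x := x :+ x) refl (A i i) ⟩
      A i i + A i i      ≈⟨ M+Mᵗ i i ⟩
      1# - I n i i       ≈⟨ +-congˡ (-‿cong (reflexive on-diagonal)) ⟩
      1# - 1#            ≈⟨ -‿inverseʳ 1# ⟩
      0#                 ≈⟨ zeroʳ _ ⟨
      (1# + 1#) * 0#     ∎)
      where
      on-diagonal : I n i i ≡ 1#
      on-diagonal rewrite dec-true (i Fin.≟ i) ≡.refl = ≡.refl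

    double-diagonal : ∀ i → (1# + 1#) * A i i ≈ 0#
    double-diagonal i = trans (*-congˡ (diagonal i)) (zeroʳ _)

    double-above : ∀ {i j} → i ≢ j → (1# + 1#) * A i j ≈ plus (skew A i j)
    double-above {i} {j} i≢j = trans
      (solve 2 (λ x y → (con (1 , 0) :+ con (1 , 0)) :* x := x :+ y :+ (x :- y)) refl (A i j) (A j i))
      (+-congʳ (complementary i≢j))

    double-below : ∀ {i j} → i ≢ j → (1# + 1#) * A j i ≈ minus (skew A i j)
    double-below {i} {j} i≢j = trans
      (solve 2 (λ x y → (con (1 , 0) :+ con (1 , 0)) :* y := x :+ y :- (x :- y)) refl (A i j) (A j i))
      (+-congʳ (complementary i≢j))

    double-pattern₂ : ∀ {i j} → i ≢ j → let f = i ∷ j ∷ [] in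
      (λ k l → (1# + 1#) * A (f k) (f l)) ≋ pattern₂ 0# plus minus (skew A i j)
    double-pattern₂ i≢j zero       zero       = double-diagonal _
    double-pattern₂ i≢j zero       (suc zero) = double-above i≢j
    double-pattern₂ i≢j (suc zero) zero       = double-below i≢j
    double-pattern₂ i≢j (suc zero) (suc zero) = double-diagonal _

    double-pattern₃ : ∀ {i j k} → i ≢ j → i ≢ k → j ≢ k → let f = i ∷ j ∷ k ∷ [] in
      (λ k l → (1# + 1#) * A (f k) (f l)) ≋ pattern₃ 0# plus minus (skew A i j) (skew A i k) (skew A j k)
    double-pattern₃ ij ik jk zero             zero             = double-diagonal _
    double-pattern₃ ij ik jk zero             (suc zero)       = double-above ij
    double-pattern₃ ij ik jk zero             (suc (suc zero)) = double-above ik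
    double-pattern₃ ij ik jk (suc zero)       zero             = double-below ij
    double-pattern₃ ij ik jk (suc zero)       (suc zero)       = double-diagonal _
    double-pattern₃ ij ik jk (suc zero)       (suc (suc zero)) = double-above jk
    double-pattern₃ ij ik jk (suc (suc zero)) zero             = double-below ik
    double-pattern₃ ij ik jk (suc (suc zero)) (suc zero)       = double-below jk
    double-pattern₃ ij ik jk (suc (suc zero)) (suc (suc zero)) = double-diagonal _

    double-pattern₄ : ∀ {i j k l} → i ≢ j → i ≢ k → i ≢ l → j ≢ k → j ≢ l → k ≢ l → let f = i ∷ j ∷ k ∷ l ∷ [] in
      (λ a b → (1# + 1#) * A (f a) (f b)) ≋
      pattern₄ 0# plus minus (skew A i j) (skew A i k) (skew A i l) (skew A j k) (skew A j l) (skew A k l)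
    double-pattern₄ ij ik il jk jl kl zero                   zero                   = double-diagonal _
    double-pattern₄ ij ik il jk jl kl zero                   (suc zero)             = double-above ij
    double-pattern₄ ij ik il jk jl kl zero                   (suc (suc zero))       = double-above ik
    double-pattern₄ ij ik il jk jl kl zero                   (suc (suc (suc zero))) = double-above il
    double-pattern₄ ij ik il jk jl kl (suc zero)             zero                   = double-below ij
    double-pattern₄ ij ik il jk jl kl (suc zero)             (suc zero)             = double-diagonal _
    double-pattern₄ ij ik il jk jl kl (suc zero)             (suc (suc zero))       = double-above jk
    double-pattern₄ ij ik il jk jl kl (suc zero)             (suc (suc (suc zero))) = double-above jl
    double-pattern₄ ij ik il jk jl kl (suc (suc zero))       zero                   = double-below ik
    double-pattern₄ ij ik il jk jl kl (suc (suc zero))       (suc zero)             = double-below jk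
    double-pattern₄ ij ik il jk jl kl (suc (suc zero))       (suc (suc zero))       = double-diagonal _
    double-pattern₄ ij ik il jk jl kl (suc (suc zero))       (suc (suc (suc zero))) = double-above kl
    double-pattern₄ ij ik il jk jl kl (suc (suc (suc zero))) zero                   = double-below il
    double-pattern₄ ij ik il jk jl kl (suc (suc (suc zero))) (suc zero)             = double-below jl
    double-pattern₄ ij ik il jk jl kl (suc (suc (suc zero))) (suc (suc zero))       = double-below kl
    double-pattern₄ ij ik il jk jl kl (suc (suc (suc zero))) (suc (suc (suc zero))) = double-diagonal _

  -- The way back from weights to entries: off the diagonal an entry is half of 1 plus its weight.
  double-entry : ∀ {n} {A B : Matrix n} → IsGeneralizedTournament A → IsGeneralizedTournament B →
    ∀ {i j k l} → i ≢ j → k ≢ l → skew A i j ≈ skew B k l → A i j ≈ B k l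
  double-entry TA TB i≢j k≢l eq = double-cancel
    (trans (double-above TA i≢j) (trans (+-congˡ eq) (sym (double-above TB k≢l))))

  module _ {n} {U : Subset n} {A B : Matrix n}
    (TA : IsGeneralizedTournament A) (TB : IsGeneralizedTournament B) (same : SmallMinors U A B) where

    private
      det-doubled : ∀ {m} {P Q : Matrix m} (f : Fin m → Fin n) → m ℕ.≤ 4 → Injection f → (∀ i → f i ∈ U) →
        (λ k l → (1# + 1#) * A (f k) (f l)) ≋ P → (λ k l → (1# + 1#) * B (f k) (f l)) ≋ Q →
        det P ≈ det Q
      det-doubled {m} {P} {Q} f m≤4 inj f∈U 2A≋P 2B≋Q = begin
        det P                                             ≈⟨ det-cong 2A≋P ⟨
        det (λ k l → (1# + 1#) * A (f k) (f l))           ≈⟨ det-scale _ (λ k l → A (f k) (f l)) ⟩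
        (1# + 1#) ^ m * det (λ k l → A (f k) (f l))       ≈⟨ *-congˡ (same m≤4 f inj f∈U) ⟩
        (1# + 1#) ^ m * det (λ k l → B (f k) (f l))       ≈⟨ det-scale _ (λ k l → B (f k) (f l)) ⟨
        det (λ k l → (1# + 1#) * B (f k) (f l))           ≈⟨ det-cong 2B≋Q ⟩
        det Q                                             ∎

      injection₁ : ∀ {i : Fin n} → Injection (i ∷ [])
      injection₁ = ∷-injection (λ ()) λ { {()} }

      injection₂ : ∀ {i j : Fin n} → i ≢ j → Injection (i ∷ j ∷ [])
      injection₂ i≢j = ∷-injection (λ { zero → i≢j }) injection₁

      injection₃ : ∀ {i j k : Fin n} → i ≢ j → i ≢ k → j ≢ k → Injection (i ∷ j ∷ k ∷ [])
      injection₃ i≢j i≢k j≢k = ∷-injection (λ { zero → i≢j ; (suc zero) → i≢k }) (injection₂ j≢k)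

    square-agrees : ∀ {i j} → i ∈ U → j ∈ U → i ≢ j → skew A i j * skew A i j ≈ skew B i j * skew B i j
    square-agrees {i} {j} i∈U j∈U i≢j = x-y≈0⇒x≈y (begin
      x * x - y * y                 ≈⟨ solve 2 (λ x y → x :- y := (x :- con (1 , 0)) :- (y :- con (1 , 0))) refl _ _ ⟩
      (x * x - 1#) - (y * y - 1#)   ≈⟨ +-congʳ equal ⟩
      (y * y - 1#) - (y * y - 1#)   ≈⟨ -‿inverseʳ _ ⟩
      0#                            ∎)
      where
      x = skew A i j
      y = skew B i j
      equal : x * x - 1# ≈ y * y - 1#
      equal = trans (sym (det-pattern₂ x)) (trans (det-doubled (i ∷ j ∷ []) (s≤s (s≤s z≤n))
        (injection₂ i≢j) (λ { zero → i∈U ; (suc zero) → j∈U })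
        (double-pattern₂ TA i≢j) (double-pattern₂ TB i≢j)) (det-pattern₂ y))

    triple-agrees : ∀ {i j k} → i ∈ U → j ∈ U → k ∈ U → i ≢ j → i ≢ k → j ≢ k →
      triple (skew A i j) (skew A i k) (skew A j k) ≈ triple (skew B i j) (skew B i k) (skew B j k)
    triple-agrees {i} {j} {k} i∈U j∈U k∈U i≢j i≢k j≢k = double-cancel (begin
      two * s                     ≈⟨ peel two (two * s) ⟩
      - two + (two + two * s)     ≈⟨ +-congˡ equal ⟩
      - two + (two + two * t)     ≈⟨ peel two (two * t) ⟨
      two * t                     ∎)
      where
      two = 1# + 1#
      s = triple (skew A i j) (skew A i k) (skew A j k)
      t = triple (skew B i j) (skew B i k) (skew B j k)
      peel : ∀ x y → y ≈ - x + (x + y)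
      peel = solve 2 (λ x y → y := :- x :+ (x :+ y)) refl
      equal : two + two * s ≈ two + two * t
      equal = trans (sym (det-pattern₃ _ _ _)) (trans (det-doubled (i ∷ j ∷ k ∷ []) (s≤s (s≤s (s≤s z≤n)))
        (injection₃ i≢j i≢k j≢k) (λ { zero → i∈U ; (suc zero) → j∈U ; (suc (suc zero)) → k∈U })
        (double-pattern₃ TA i≢j i≢k j≢k) (double-pattern₃ TB i≢j i≢k j≢k)) (det-pattern₃ _ _ _))

    quadruple-agrees : ∀ {i j k l} → i ∈ U → j ∈ U → k ∈ U → l ∈ U →
      i ≢ j → i ≢ k → i ≢ l → j ≢ k → j ≢ l → k ≢ l →
      quadruple (skew A i j) (skew A i k) (skew A i l) (skew A j k) (skew A j l) (skew A k l) ≈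
      quadruple (skew B i j) (skew B i k) (skew B i l) (skew B j k) (skew B j l) (skew B k l)
    quadruple-agrees {i} {j} {k} {l} i∈U j∈U k∈U l∈U i≢j i≢k i≢l j≢k j≢l k≢l = double-cancel (begin
      two * quadA                                                       ≈⟨ peel sqA trA (two * quadA) ⟩
      - sqA + (trA + (sqA + (- trA + two * quadA)))                     ≈⟨ +-cong (-‿cong squares) (+-cong triples equal) ⟩
      - sqB + (trB + (sqB + (- trB + two * quadB)))                     ≈⟨ peel sqB trB (two * quadB) ⟨
      two * quadB                                                       ∎)
      where
      two = 1# + 1#
      quadA = quadruple (skew A i j) (skew A i k) (skew A i l) (skew A j k) (skew A j l) (skew A k l)
      quadB = quadruple (skew B i j) (skew B i k) (skew B i l) (skew B j k) (skew B j l) (skew B k l)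
      sq : Matrix n → Carrier
      sq M = squares₄ (skew M i j * skew M i j) (skew M i k * skew M i k) (skew M i l * skew M i l)
                      (skew M j k * skew M j k) (skew M j l * skew M j l) (skew M k l * skew M k l)
      sqA = sq A
      sqB = sq B
      trA = two * triples₄ (skew A i j) (skew A i k) (skew A i l) (skew A j k) (skew A j l) (skew A k l)
      trB = two * triples₄ (skew B i j) (skew B i k) (skew B i l) (skew B j k) (skew B j l) (skew B k l)
      peel : ∀ s t x → x ≈ - s + (t + (s + (- t + x)))
      peel = solve 3 (λ s t x → x := :- s :+ (t :+ (s :+ (:- t :+ x)))) refl
      squares₄-cong : ∀ {a b c d e f a′ b′ c′ d′ e′ f′} → a ≈ a′ → b ≈ b′ → c ≈ c′ → d ≈ d′ → e ≈ e′ → f ≈ f′ →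
        squares₄ a b c d e f ≈ squares₄ a′ b′ c′ d′ e′ f′
      squares₄-cong a b c d e f = +-congˡ (+-cong
        (-‿cong (+-cong a (+-cong b (+-cong c (+-cong d (+-cong e f))))))
        (+-cong (*-cong a f) (+-cong (*-cong b e) (*-cong c d))))
      squares : sqA ≈ sqB
      squares = squares₄-cong (square-agrees i∈U j∈U i≢j) (square-agrees i∈U k∈U i≢k) (square-agrees i∈U l∈U i≢l)
        (square-agrees j∈U k∈U j≢k) (square-agrees j∈U l∈U j≢l) (square-agrees k∈U l∈U k≢l)
      triples : trA ≈ trB
      triples = *-congˡ (+-cong (triple-agrees i∈U j∈U k∈U i≢j i≢k j≢k) (+-cong (triple-agrees i∈U j∈U l∈U i≢j i≢l j≢l)
        (+-cong (triple-agrees i∈U k∈U l∈U i≢k i≢l k≢l) (triple-agrees j∈U k∈U l∈U j≢k j≢l k≢l))))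
      equal : sqA + (- trA + two * quadA) ≈ sqB + (- trB + two * quadB)
      equal = trans (sym (det-pattern₄ _ _ _ _ _ _)) (trans (det-doubled (i ∷ j ∷ k ∷ l ∷ []) ℕ.≤-refl
        (∷-injection (λ { zero → i≢j ; (suc zero) → i≢k ; (suc (suc zero)) → i≢l }) (injection₃ j≢k j≢l k≢l))
        (λ { zero → i∈U ; (suc zero) → j∈U ; (suc (suc zero)) → k∈U ; (suc (suc (suc zero))) → l∈U })
        (double-pattern₄ TA i≢j i≢k i≢l j≢k j≢l k≢l) (double-pattern₄ TB i≢j i≢k i≢l j≢k j≢l k≢l))
        (det-pattern₄ _ _ _ _ _ _))

-- Two-coloured pairs and the extension of a cut by one vertex.

module _ {n} {p} {P : Pred (Fin n) p} (P? : Decidable P) where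
  comprehension : Subset n
  comprehension = Vec.tabulate (λ i → does (P? i))

  ∈-comprehension⁺ : ∀ {i} → P i → i ∈ comprehension
  ∈-comprehension⁺ {i} Pi = Vec.lookup⇒[]= i _ (≡.trans (Vec.lookup∘tabulate _ i) (dec-true (P? i) Pi))

  ∈-comprehension⁻ : ∀ {i} → i ∈ comprehension → P i
  ∈-comprehension⁻ {i} i∈ with P? i in eq
  ... | yes Pi = Pi
  ... | no _ = contradiction
    (≡.trans (≡.sym (≡.cong does eq)) (≡.trans (≡.sym (Vec.lookup∘tabulate _ i)) (Vec.[]=⇒lookup i∈))) λ ()

-- Two colours on the pairs of vertices, compatible with a classification Same of the
-- ordered pairs by their weight; To singles out one nonzero weight.
record Colouring (n : ℕ) ℓ : Set (Level.suc ℓ) where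
  field
    U         : Subset n
    Same      : (i j k l : Fin n) → Set ℓ
    same-sym   : ∀ {i j k l} → Same i j k l → Same k l i j
    same-trans : ∀ {i j k l r s} → Same i j k l → Same k l r s → Same i j r s
    same-flip  : ∀ {i j k l} → Same i j k l → Same j i l k
    Col       : Bool → Fin n → Fin n → Set ℓ
    Col?      : ∀ c i j → Dec (Col c i j)
    col-sym   : ∀ {c i j} → Col c i j → Col c j i
    col-excl  : ∀ {c i j} → Col c i j → Col (not c) i j → ⊥
    -- A triangle with both colours is fully coloured, and its two pairs of the majority colour have
    -- equal weights, read from their common vertex outwards or inwards.
    mix       : ∀ {c i j k} → Col c i j → Col (not c) j k →
                (Same i j i k × Col c i k) ⊎ (Same j k i k × Col (not c) i k)
    -- Colour `c` forms the path `v`, `g`, `q`, `p` and the other colour the path `q`, `v`, `p`,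
    -- `g`. The equalities assumed are those that `mix` gives in the four triangles.
    quad      : ∀ {c g p q v} → Col c g v → Col c g q → Col c p q →
                Same g v g q → Same g q p q →
                Col (not c) p v → Col (not c) q v → Col (not c) g p →
                Same p v q v → Same v p g p → Same g v p v ⊎ Same g v v p
    To        : Fin n → Fin n → Set ℓ
    To?       : ∀ i j → Dec (To i j)
    to-resp   : ∀ {i j k l} → Same i j k l → To i j → To k l
    to-same   : ∀ {i j k l} → To i j → To k l → Same i j k l
    to-col    : ∀ {i j} c → i ∈ U → j ∈ U → To i j → Col c i j ⊎ Col (not c) i j

  mix′ : ∀ {c i j k} → Col (not c) i j → Col c j k →
         (Same j k i k × Col c i k) ⊎ (Same i j i k × Col (not c) i k)
  mix′ ij jk with mix (col-sym jk) (col-sym ij)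
  ... | inj₁ (s , ki) = inj₁ (same-flip s , col-sym ki)
  ... | inj₂ (s , ki) = inj₂ (same-flip s , col-sym ki)

  record Cut (W : Subset n) : Set ℓ where
    field
      left     : Subset n
      {low}    : Fin n
      low∈W    : low ∈ W
      low∈left : low ∈ left
      {high}   : Fin n
      high∈W   : high ∈ W
      high∉left : high ∉ left
      cross    : ∀ {i j} → i ∈ W → j ∈ W → i ∈ left → j ∉ left → To i j

-- Duality: reversing the distinguished direction exchanges the sides of a cut, so what is shown for
-- one side holds for the other.
reverse : ∀ {n ℓ} → Colouring n ℓ → Colouring n ℓ
reverse T = record
  { U = U ; Same = Same ; same-sym = same-sym ; same-trans = same-trans ; same-flip = same-flip
  ; Col = Col ; Col? = Col? ; col-sym = col-sym ; col-excl = col-excl ; mix = mix ; quad = quad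
  ; To = flip To ; To? = λ i j → To? j i
  ; to-resp = λ s → to-resp (same-flip s)
  ; to-same = λ ij kl → same-flip (to-same ij kl)
  ; to-col = λ c i∈U j∈U ji → [ inj₁ ∘ col-sym , inj₂ ∘ col-sym ]′ (to-col c j∈U i∈U ji)
  }
  where open Colouring T

reverse-cut : ∀ {n ℓ} {T : Colouring n ℓ} {W} → Colouring.Cut (reverse T) W → Colouring.Cut T W
reverse-cut cut = record
  { left = ∁ left ; low∈W = high∈W ; low∈left = Subset.x∉p⇒x∈∁p high∉left
  ; high∈W = low∈W ; high∉left = λ low∈∁ → Subset.x∈∁p⇒x∉p low∈∁ low∈left
  ; cross = λ i∈W j∈W i∈∁ j∉∁ → cross j∈W i∈W (Subset.x∉∁p⇒x∈p j∉∁) (Subset.x∈∁p⇒x∉p i∈∁)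
  }
  where open Colouring.Cut cut

record Setting {n ℓ} (T : Colouring n ℓ) : Set ℓ where
  open Colouring T
  field
    P Q   : Subset n
    v     : Fin n
    P⊆U   : P ⊆ U
    Q⊆U   : Q ⊆ U
    v∈U   : v ∈ U
    v∉P   : v ∉ P
    v∉Q   : v ∉ Q
    P→Q   : ∀ {p q} → p ∈ P → q ∈ Q → To p q

  W⁺ : Subset n
  W⁺ = (P ∪ Q) ∪ ⁅ v ⁆

  P⊆W⁺ : P ⊆ W⁺
  P⊆W⁺ = Subset.x∈p∪q⁺ ∘ inj₁ ∘ Subset.x∈p∪q⁺ ∘ inj₁

  v∈W⁺ : v ∈ W⁺
  v∈W⁺ = Subset.x∈p∪q⁺ (inj₂ (Subset.x∈⁅x⁆ v))

  W⁺⁻ : ∀ {i} → i ∈ W⁺ → (i ∈ P ⊎ i ∈ Q) ⊎ i ≡ v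
  W⁺⁻ i∈ with Subset.x∈p∪q⁻ (P ∪ Q) ⁅ v ⁆ i∈
  ... | inj₁ i∈PQ = inj₁ (Subset.x∈p∪q⁻ P Q i∈PQ)
  ... | inj₂ i∈v  = inj₂ (Subset.x∈⁅y⁆⇒x≡y v i∈v)

  -- Bad vertices of `P` keep `v` from joining the side of `Q`, and those of `Q` keep it from
  -- joining the side of `P`.
  Bad Bad′ : Fin n → Set ℓ
  Bad p  = p ∈ P × ¬ To p v
  Bad′ q = q ∈ Q × ¬ To v q

  Bad? : Decidable Bad
  Bad? p = (p ∈? P) ×-dec ¬? (To? p v)

  Bad′? : Decidable Bad′
  Bad′? q = (q ∈? Q) ×-dec ¬? (To? v q)

  cut-without-bad : ∃ (_∈ P) → ¬ ∃ Bad → Cut W⁺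
  cut-without-bad (p , p∈P) no-bad = record
    { left = P ; low∈W = P⊆W⁺ p∈P ; low∈left = p∈P ; high∈W = v∈W⁺ ; high∉left = v∉P ; cross = cross }
    where
    cross : ∀ {i j} → i ∈ W⁺ → j ∈ W⁺ → i ∈ P → j ∉ P → To i j
    cross {i} i∈ j∈ i∈P j∉P with W⁺⁻ j∈
    ... | inj₁ (inj₁ j∈P) = contradiction j∈P j∉P
    ... | inj₁ (inj₂ j∈Q) = P→Q i∈P j∈Q
    ... | inj₂ ≡.refl = decidable-stable (To? _ _) λ ¬iv → no-bad (i , i∈P , ¬iv)

module Side {n ℓ} {T : Colouring n ℓ} (S : Setting T) (c : Bool) where
  open Colouring T
  open Setting S

  private
    C D : Fin n → Fin n → Set ℓ
    C = Col c
    D = Col (not c)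

    C? : ∀ i j → Dec (C i j)
    C? = Col? c
    D? : ∀ i j → Dec (D i j)
    D? = Col? (not c)

  -- The seeds of the left side of a new cut.
  Good : Fin n → Set ℓ
  Good g = g ∈ P × To g v × C g v

  Good? : Decidable Good
  Good? g = (g ∈? P) ×-dec (To? g v ×-dec C? g v)

  Dominated : Fin n → Fin n → Set ℓ
  Dominated g p = To g p × C g p

  Dominated? : ∀ g p → Dec (Dominated g p)
  Dominated? g p = To? g p ×-dec C? g p

  Undominated : Set ℓ
  Undominated = ∃[ g ] ∃[ p ] Good g × Bad p × ¬ Dominated g p

  undominated? : Dec Undominated
  undominated? = Fin.any? λ g → Fin.any? λ p → Good? g ×-dec (Bad? p ×-dec ¬? (Dominated? g p))

  -- By `mix` the pair `p q`, which has the weight of the cut, would share it with `p v` or with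
  -- `v q`, and that vertex would not be bad.
  bad-not-CD : ∀ {p q} → Bad p → Bad′ q → C p v → D v q → ⊥
  bad-not-CD (p∈P , ¬pv) (q∈Q , ¬vq) pv vq with mix pv vq
  ... | inj₁ (s , _) = ¬pv (to-resp (same-sym s) (P→Q p∈P q∈Q))
  ... | inj₂ (s , _) = ¬vq (to-resp (same-sym s) (P→Q p∈P q∈Q))

  bad-not-DC : ∀ {p q} → Bad p → Bad′ q → D p v → C v q → ⊥
  bad-not-DC (p∈P , ¬pv) (q∈Q , ¬vq) pv vq with mix′ pv vq
  ... | inj₁ (s , _) = ¬vq (to-resp (same-sym s) (P→Q p∈P q∈Q))
  ... | inj₂ (s , _) = ¬pv (to-resp (same-sym s) (P→Q p∈P q∈Q))

  good-bad′ : ∀ {g q} → Good g → Bad′ q → ¬ C q v → C g q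
  good-bad′ (g∈P , gv , gvC) (q∈Q , ¬vq) ¬qvC with to-col c (P⊆U g∈P) (Q⊆U q∈Q) (P→Q g∈P q∈Q)
  ... | inj₁ gqC = gqC
  ... | inj₂ gqD with mix (col-sym gvC) gqD
  ... | inj₁ (_ , vqC) = contradiction (col-sym vqC) ¬qvC
  ... | inj₂ (s , _)   = contradiction (to-resp s (P→Q g∈P q∈Q)) ¬vq

  good-bad-D : ∀ {g p} → Good g → Bad p → D g p → Same p g p v × D p v
  good-bad-D (_ , gv , gvC) (_ , ¬pv) gpD with mix′ (col-sym gpD) gvC
  ... | inj₁ (s , _) = contradiction (to-resp s gv) ¬pv
  ... | inj₂ (s , d) = s , d

  private
    dominated-D : ∀ {g p q} → Good g → Bad p → Bad′ q → ¬ C q v → D p q → Dominated g p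
    dominated-D G@(g∈P , _) B@(p∈P , ¬pv) B′@(q∈Q , _) ¬qvC pqD with mix (good-bad′ G B′ ¬qvC) (col-sym pqD)
    ... | inj₁ (s , gpC) = to-resp s (P→Q g∈P q∈Q) , gpC
    ... | inj₂ (s , gpD) = contradiction
      (to-resp (same-trans (same-flip s) (proj₁ (good-bad-D G B gpD))) (P→Q p∈P q∈Q)) ¬pv

    -- Without domination, `mix` completes the two paths of `quad`, and either of its answers gives
    -- `p v` or `v q` the weight of the cut.
    dominated-C : ∀ {g p q} → Good g → Bad p → Bad′ q → ¬ C q v → C p q → D p v → Dominated g p
    dominated-C G@(g∈P , gv , gvC) B@(p∈P , ¬pv) B′@(q∈Q , ¬vq) ¬qvC pqC pvD with mix (col-sym pqC) pvD
    ... | inj₁ (_ , qvC) = contradiction qvC ¬qvC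
    ... | inj₂ (pv≈qv , qvD) with mix gvC (col-sym pvD)
    ... | inj₁ (s , gpC) = to-resp s gv , gpC
    ... | inj₂ (vp≈gp , gpD) with quad gvC (good-bad′ G B′ ¬qvC) pqC (to-same gv (P→Q g∈P q∈Q))
                                    (to-same (P→Q g∈P q∈Q) (P→Q p∈P q∈Q)) pvD qvD gpD pv≈qv vp≈gp
    ... | inj₁ s = contradiction (to-resp s gv) ¬pv
    ... | inj₂ s = contradiction (to-resp (same-trans s (same-flip pv≈qv)) gv) ¬vq

  -- The second alternative cannot be excluded from these four vertices: there `p` and `q` are both
  -- uncoloured towards `v`. Later steps rule it out by comparing several bad vertices.
  dominated : ∀ {g p q} → Good g → Bad p → Bad′ q → ¬ C p v → ¬ C q v →
              Dominated g p ⊎ (C p q × ¬ D p v × ¬ D q v)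
  dominated {g} {p} {q} G B B′ ¬pvC ¬qvC with to-col c (P⊆U (proj₁ B)) (Q⊆U (proj₁ B′)) (P→Q (proj₁ B) (proj₁ B′))
  ... | inj₂ pqD = inj₁ (dominated-D G B B′ ¬qvC pqD)
  ... | inj₁ pqC with D? p v | D? q v
  ... | yes pvD | _ = inj₁ (dominated-C G B B′ ¬qvC pqC pvD)
  ... | no ¬pvD | no ¬qvD = inj₂ (pqC , ¬pvD , ¬qvD)
  ... | no ¬pvD | yes qvD with mix pqC qvD
  ... | inj₁ (_ , pvC) = contradiction pvC ¬pvC
  ... | inj₂ (_ , pvD) = contradiction pvD ¬pvD

  -- By mix, a vertex of the other colour that points to a good vertex g points to
  -- everything that g dominates.
  cut-of-domination : ∃ Good → ¬ Undominated → Cut W⁺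
  cut-of-domination (g₀ , G₀@(g₀∈P , g₀v , g₀vC)) ¬undominated = record
    { left = comprehension Left?
    ; low∈W = P⊆W⁺ g₀∈P ; low∈left = ∈-comprehension⁺ Left? (g₀∈P , g₀v , inj₁ g₀vC)
    ; high∈W = v∈W⁺ ; high∉left = λ v∈ → v∉P (proj₁ (∈-comprehension⁻ Left? v∈))
    ; cross = λ {i} {j} _ j∈ i∈left j∉left →
        cross (∈-comprehension⁻ Left? i∈left) (λ L → j∉left (∈-comprehension⁺ Left? L)) (W⁺⁻ j∈)
    }
    where
    Above : Fin n → Fin n → Set ℓ
    Above i g = Good g × (To i g × D i g)
    Above? : ∀ i → Decidable (Above i)
    Above? i g = Good? g ×-dec (To? i g ×-dec D? i g)
    Left : Fin n → Set ℓ
    Left i = i ∈ P × (To i v × (C i v ⊎ (∃ (Above i))))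
    Left? : Decidable Left
    Left? i = (i ∈? P) ×-dec (To? i v ×-dec (C? i v ⊎-dec Fin.any? (Above? i)))
    extend : ∀ {i j} → Left i → (∀ {g} → Good g → Dominated g j) → To i j
    extend (i∈P , iv , inj₁ ivC) dom = proj₁ (dom (i∈P , iv , ivC))
    extend (i∈P , iv , inj₂ (g , G , ig , igD)) dom with mix′ igD (proj₂ (dom G))
    ... | inj₁ (s , _) = to-resp s (proj₁ (dom G))
    ... | inj₂ (s , _) = to-resp s ig
    cross : ∀ {i j} → Left i → ¬ Left j → (j ∈ P ⊎ j ∈ Q) ⊎ j ≡ v → To i j
    cross (_ , iv , _) _ (inj₂ ≡.refl) = iv
    cross (i∈P , _) _ (inj₁ (inj₂ j∈Q)) = P→Q i∈P j∈Q
    -- Such a `j` is either bad, hence dominated by hypothesis, or points to `v` in the other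
    -- colour; then a good vertex that did not dominate it would lie below it and put it on the
    -- left.
    cross {i} {j} L ¬L (inj₁ (inj₁ j∈P)) with To? j v
    ... | no ¬jv = extend L λ {g} G → decidable-stable (Dominated? g j) λ ¬d → ¬undominated (g , j , G , (j∈P , ¬jv) , ¬d)
    ... | yes jv with to-col c (P⊆U j∈P) v∈U jv
    ... | inj₁ jvC = contradiction (j∈P , jv , inj₁ jvC) ¬L
    ... | inj₂ jvD = extend L dom
      where
      dom : ∀ {g} → Good g → Dominated g j
      dom {g} G@(g∈P , gv , gvC) with mix gvC (col-sym jvD)
      ... | inj₁ (s , gjC) = to-resp s gv , gjC
      ... | inj₂ (s , gjD) = contradiction
        (j∈P , jv , inj₂ (g , G , to-resp (same-flip s) jv , col-sym gjD)) ¬L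

  module _ {q₀} (B₀ : Bad′ q₀) where
    private
      D-bad-q₀ : ∀ {p} → Bad p → ¬ C q₀ v → ¬ D q₀ v → D p v → D p q₀
      D-bad-q₀ B ¬qvC ¬qvD pvD with to-col c (P⊆U (proj₁ B)) (Q⊆U (proj₁ B₀)) (P→Q (proj₁ B) (proj₁ B₀))
      ... | inj₂ pqD = pqD
      ... | inj₁ pqC with mix (col-sym pqC) pvD
      ... | inj₁ (_ , qvC) = contradiction qvC ¬qvC
      ... | inj₂ (_ , qvD) = contradiction qvD ¬qvD

      C-bad-q₀ : ∀ {p} → Bad p → ¬ C q₀ v → ¬ D q₀ v → C p v → C p q₀
      C-bad-q₀ B ¬qvC ¬qvD pvC with to-col c (P⊆U (proj₁ B)) (Q⊆U (proj₁ B₀)) (P→Q (proj₁ B) (proj₁ B₀))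
      ... | inj₁ pqC = pqC
      ... | inj₂ pqD with mix′ (col-sym pqD) pvC
      ... | inj₁ (_ , qvC) = contradiction qvC ¬qvC
      ... | inj₂ (_ , qvD) = contradiction qvD ¬qvD

    D-bad⇒bad′-not-C : ∀ {p₁} → Bad p₁ → D p₁ v → ∀ {q} → Bad′ q → ¬ C q v
    D-bad⇒bad′-not-C B₁ p₁vD B′ qvC = bad-not-DC B₁ B′ p₁vD (col-sym qvC)

    -- Otherwise `q₀` is uncoloured towards `v`, and both `q₀` and `v` are joined to `p₁` in `D` and
    -- to `p` in `C`. The colour of `p₁ p` decides, in both triangles alike, which weight is copied
    -- to it; so `v` has to `p₁` or to `p` the weight that `q₀` has, against badness.
    D-bad⇒bad-not-C : ∀ {p₁} → Bad p₁ → D p₁ v → ∀ {p} → Bad p → ¬ C p v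
    D-bad⇒bad-not-C {p₁} B₁@(p₁∈P , ¬p₁v) p₁vD {p} B@(p∈P , ¬pv) pvC
      with mix′ (D-bad-q₀ B₁ ¬qvC ¬qvD p₁vD) (col-sym (C-bad-q₀ B ¬qvC ¬qvD pvC)) | mix′ p₁vD (col-sym pvC)
      where
      ¬qvC : ¬ C q₀ v
      ¬qvC = D-bad⇒bad′-not-C B₁ p₁vD B₀
      ¬qvD : ¬ D q₀ v
      ¬qvD qvD = bad-not-CD B B₀ pvC (col-sym qvD)
    ... | inj₁ (s , _) | inj₁ (t , _) = ¬pv (to-resp (same-flip (same-trans s (same-sym t))) (P→Q p∈P (proj₁ B₀)))
    ... | inj₁ (_ , x) | inj₂ (_ , y) = col-excl x y
    ... | inj₂ (_ , y) | inj₁ (_ , x) = col-excl x y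
    ... | inj₂ (s , _) | inj₂ (t , _) = ¬p₁v (to-resp (same-trans s (same-sym t)) (P→Q p₁∈P (proj₁ B₀)))

    -- A `D`-coloured bad vertex of `Q` excludes the second alternative of `dominated` at once. If
    -- the coloured vertex is `p₁` in `P`, then `g` dominates `p₁`. A pair `p₁ p` of colour `C`
    -- would colour `p v`; of colour `D` it makes `g` dominate `p` or again colours `p v`.
    dominated-if-D-bad : (∀ {p} → Bad p → ¬ C p v) → (∀ {q} → Bad′ q → ¬ C q v) →
      (∃[ p ] Bad p × D p v) ⊎ (∃[ q ] Bad′ q × D q v) → ¬ Undominated
    dominated-if-D-bad ¬C ¬C′ (inj₂ (q₁ , B′ , q₁vD)) (g , p , G , B , ¬dom) with dominated G B B′ (¬C B) (¬C′ B′)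
    ... | inj₁ dom = ¬dom dom
    ... | inj₂ (_ , _ , ¬q₁vD) = ¬q₁vD q₁vD
    dominated-if-D-bad ¬C ¬C′ (inj₁ (p₁ , B₁ , p₁vD)) (g , p , G , B , ¬dom)
      with dominated G B B₀ (¬C B) (¬C′ B₀) | dominated G B₁ B₀ (¬C B₁) (¬C′ B₀)
    ... | inj₁ dom | _ = ¬dom dom
    ... | inj₂ _ | inj₂ (_ , ¬p₁vD , _) = ¬p₁vD p₁vD
    ... | inj₂ (pqC , ¬pvD , ¬qvD) | inj₁ (gp₁ , gp₁C) with mix′ (D-bad-q₀ B₁ (¬C′ B₀) ¬qvD p₁vD) (col-sym pqC)
    ... | inj₁ (_ , p₁pC) with mix (col-sym p₁pC) p₁vD
    ...   | inj₁ (_ , pvC) = ¬C B pvC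
    ...   | inj₂ (_ , pvD) = ¬pvD pvD
    dominated-if-D-bad ¬C ¬C′ (inj₁ (p₁ , B₁ , p₁vD)) (g , p , G , B , ¬dom)
        | inj₂ (pqC , ¬pvD , ¬qvD) | inj₁ (gp₁ , gp₁C) | inj₂ (_ , p₁pD) with mix gp₁C p₁pD
    ...   | inj₁ (s , gpC) = ¬dom (to-resp s gp₁ , gpC)
    ...   | inj₂ (_ , gpD) = ¬pvD (proj₂ (good-bad-D G B gpD))

module _ {n ℓ} {T : Colouring n ℓ} where
  open Colouring T

  reverse-setting : Setting T → Setting (reverse T)
  reverse-setting S = record
    { P = Q ; Q = P ; v = v ; P⊆U = Q⊆U ; Q⊆U = P⊆U ; v∈U = v∈U ; v∉P = v∉Q ; v∉Q = v∉P
    ; P→Q = λ q∈Q p∈P → P→Q p∈P q∈Q }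
    where open Setting S

  unreverse-cut : (S : Setting T) → Colouring.Cut (reverse T) (Setting.W⁺ (reverse-setting S)) → Cut (Setting.W⁺ S)
  unreverse-cut S cut = ≡.subst Cut (≡.cong (_∪ ⁅ v ⁆) (Subset.∪-comm Q P)) (reverse-cut {T = T} cut)
    where open Setting S

  module _ (S : Setting T) where
    open Setting S
    private
      module L = Side S
      module R = Side (reverse-setting S)

    Nonzero : Bool → Set ℓ
    Nonzero c = (∃[ p ] Bad p × Col c p v) ⊎ (∃[ q ] Bad′ q × Col c q v)

    nonzero? : ∀ c → Dec (Nonzero c)
    nonzero? c = Fin.any? (λ p → Bad? p ×-dec Col? c p v) ⊎-dec Fin.any? (λ q → Bad′? q ×-dec Col? c q v)

    -- One bad vertex of colour `not c` towards `v` keeps all bad vertices from having colour `c`;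
    -- hence `u` is good on its side.
    cut-if-nonzero-bad : ∀ c → ∃ Bad → ∃ Bad′ → Nonzero (not c) →
      ∃[ u ] (u ∈ P ⊎ u ∈ Q) × Col c u v → Cut W⁺
    cut-if-nonzero-bad c (p₀ , B₀) (q₀ , B₀′) nonzero (u , u∈ , uvC) = conclude u∈
      where
      ¬C : ∀ {p} → Bad p → ¬ Col c p v
      ¬C B = [ (λ (_ , B₁ , d) → L.D-bad⇒bad-not-C c B₀′ B₁ d B)
             , (λ (_ , B₁ , d) → R.D-bad⇒bad′-not-C c B₀ B₁ d B) ]′ nonzero
      ¬C′ : ∀ {q} → Bad′ q → ¬ Col c q v
      ¬C′ B′ = [ (λ (_ , B₁ , d) → L.D-bad⇒bad′-not-C c B₀′ B₁ d B′)
               , (λ (_ , B₁ , d) → R.D-bad⇒bad-not-C c B₀ B₁ d B′) ]′ nonzero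
      conclude : u ∈ P ⊎ u ∈ Q → Cut W⁺
      conclude (inj₁ u∈P) with To? u v
      ... | no ¬uv = contradiction uvC (¬C (u∈P , ¬uv))
      ... | yes uv = L.cut-of-domination c (u , u∈P , uv , uvC) (L.dominated-if-D-bad c B₀′ ¬C ¬C′ nonzero)
      conclude (inj₂ u∈Q) with To? v u
      ... | no ¬vu = contradiction uvC (¬C′ (u∈Q , ¬vu))
      ... | yes vu = unreverse-cut S
        (R.cut-of-domination c (u , u∈Q , vu , uvC) (R.dominated-if-D-bad c B₀ ¬C′ ¬C (swap nonzero)))

    AllZero : Set ℓ
    AllZero = ∀ c → ¬ Nonzero c

    undominated⇒same-colour : AllZero → ∀ c → L.Undominated c → ∃[ p ] Bad p × (∀ {q} → Bad′ q → Col c p q)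
    undominated⇒same-colour zeros c (g , p , G , B , ¬dom) = p , B , λ {q} B′ →
      [ (λ dom → contradiction dom ¬dom) , proj₁ ]′
      (L.dominated c G B B′ (λ pv → zeros c (inj₁ (p , B , pv))) (λ qv → zeros c (inj₂ (q , B′ , qv))))

    -- The pairs `p q` and `p′ q` then have opposite colours, so that `g` dominates `p` and `h`
    -- dominates `p′`. The pair of `g` and `h` is directed by `mix`, and whichever of the two points
    -- to the other also dominates what that one dominates.
    undominated-not-both : AllZero → ∃ Bad′ → L.Undominated true → ¬ L.Undominated false
    undominated-not-both zeros (q , B′) (h , p , H@(_ , hv , hvT) , B , ¬hp) (g , p′ , G@(_ , gv , gvF) , B₁ , ¬gp′)
      with L.dominated true H B₁ B′ (λ x → zeros true (inj₁ (p′ , B₁ , x))) (λ x → zeros true (inj₂ (q , B′ , x)))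
         | L.dominated true H B B′ (λ x → zeros true (inj₁ (p , B , x))) (λ x → zeros true (inj₂ (q , B′ , x)))
         | L.dominated false G B₁ B′ (λ x → zeros false (inj₁ (p′ , B₁ , x))) (λ x → zeros false (inj₂ (q , B′ , x)))
         | L.dominated false G B B′ (λ x → zeros false (inj₁ (p , B , x))) (λ x → zeros false (inj₂ (q , B′ , x)))
    ... | _ | inj₁ hp | _ | _ = ¬hp hp
    ... | _ | _ | inj₁ gp′ | _ = ¬gp′ gp′
    ... | _ | inj₂ (pqT , _) | _ | inj₂ (pqF , _) = col-excl {true} pqT pqF
    ... | inj₂ (p′qT , _) | _ | inj₂ (p′qF , _) | _ = col-excl {true} p′qT p′qF
    ... | inj₁ (hp′ , hp′T) | inj₂ _ | inj₂ _ | inj₁ (gp , gpF) with mix {false} gvF (col-sym hvT)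
    ... | inj₁ (s , ghF) with mix {false} ghF hp′T
    ...   | inj₁ (t , gp′F) = ¬gp′ (to-resp t (to-resp s gv) , gp′F)
    ...   | inj₂ (t , gp′T) = zeros true (inj₁ (p′ , B₁ , proj₂ (L.good-bad-D false G B₁ gp′T)))
    undominated-not-both zeros (q , B′) (h , p , H@(_ , hv , hvT) , B , ¬hp) (g , p′ , G@(_ , gv , gvF) , B₁ , ¬gp′)
        | inj₁ (hp′ , hp′T) | inj₂ _ | inj₂ _ | inj₁ (gp , gpF) | inj₂ (s , ghT) with mix {true} (col-sym ghT) gpF
    ...   | inj₁ (t , hpT) = ¬hp (to-resp t (to-resp (same-flip s) hv) , hpT)
    ...   | inj₂ (t , hpF) = zeros false (inj₁ (p , B , proj₂ (L.good-bad-D true H B hpF)))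

module _ {n ℓ} {T : Colouring n ℓ} (S : Setting T) where
  open Colouring T
  open Setting S

  private
    S′ = reverse-setting S
    module L = Side S
    module R = Side S′

    Coloured : Bool → Subset n → Set ℓ
    Coloured c X = ∃[ u ] u ∈ X × Col c u v

    reverse-zeros : AllZero S → AllZero S′
    reverse-zeros zeros c = zeros c ∘ swap

    good : AllZero S → ∀ c → Coloured c P → ∃ (L.Good c)
    good zeros c (u , u∈P , uvC) with To? u v
    ... | yes uv = u , u∈P , uv , uvC
    ... | no ¬uv = contradiction (inj₁ (u , (u∈P , ¬uv) , uvC)) (zeros c)

    good′ : AllZero S → ∀ c → Coloured c Q → ∃ (R.Good c)
    good′ zeros c (u , u∈Q , uvC) with To? v u
    ... | yes vu = u , u∈Q , vu , uvC
    ... | no ¬vu = contradiction (inj₂ (u , (u∈Q , ¬vu) , uvC)) (zeros c)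

    -- Failures on both sides would give a bad `p` joined to all bad vertices of `Q` in `c`, and a
    -- bad `q` joined to all those of `P` in `not c`; the pair `p q` is contradictory.
    cut-two-sided : AllZero S → ∀ c → Coloured c P → Coloured (not c) Q → Cut W⁺
    cut-two-sided zeros c X Y with L.undominated? c | R.undominated? (not c)
    ... | no ¬x | _ = L.cut-of-domination c (good zeros c X) ¬x
    ... | yes _ | no ¬y = unreverse-cut S (R.cut-of-domination (not c) (good′ zeros (not c) Y) ¬y)
    ... | yes x | yes y with undominated⇒same-colour S zeros c x | undominated⇒same-colour S′ (reverse-zeros zeros) (not c) y
    ... | p , B , pC | q , B′ , qD = ⊥-elim (col-excl (pC B′) (col-sym (qD B)))

    cut-zero-bad : AllZero S → ∃ Bad → ∃ Bad′ → (∀ c → Coloured c P ⊎ Coloured c Q) → Cut W⁺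
    cut-zero-bad zeros B₀ B₀′ coloured with coloured true | coloured false
    ... | inj₁ X | inj₂ Y = cut-two-sided zeros true X Y
    ... | inj₂ Y | inj₁ X = cut-two-sided zeros false X Y
    ... | inj₁ X | inj₁ Y with L.undominated? true | L.undominated? false
    ...   | no ¬x | _ = L.cut-of-domination true (good zeros true X) ¬x
    ...   | yes _ | no ¬y = L.cut-of-domination false (good zeros false Y) ¬y
    ...   | yes x | yes y = contradiction y (undominated-not-both S zeros B₀′ x)
    cut-zero-bad zeros B₀ B₀′ coloured | inj₂ X | inj₂ Y with R.undominated? true | R.undominated? false
    ...   | no ¬x | _ = unreverse-cut S (R.cut-of-domination true (good′ zeros true X) ¬x)
    ...   | yes _ | no ¬y = unreverse-cut S (R.cut-of-domination false (good′ zeros false Y) ¬y)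
    ...   | yes x | yes y = contradiction y (undominated-not-both S′ (reverse-zeros zeros) B₀ x)

  cut-mixed-vertex : ∃ (_∈ P) → ∃ (_∈ Q) → (∀ c → ∃[ u ] (u ∈ P ⊎ u ∈ Q) × Col c u v) → Cut W⁺
  cut-mixed-vertex p∈P q∈Q coloured with Fin.any? Bad? | Fin.any? Bad′?
  ... | no ¬b | _ = cut-without-bad p∈P ¬b
  ... | yes _ | no ¬b′ = unreverse-cut S (Setting.cut-without-bad S′ q∈Q ¬b′)
  ... | yes b | yes b′ with nonzero? S true | nonzero? S false
  ... | yes z | _ = cut-if-nonzero-bad S false b b′ z (coloured false)
  ... | no _ | yes z = cut-if-nonzero-bad S true b b′ z (coloured true)
  ... | no ¬z | no ¬z′ = cut-zero-bad (λ { true → ¬z ; false → ¬z′ }) b b′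
    λ c → split (coloured c)
    where
    split : ∀ {c} → ∃[ u ] (u ∈ P ⊎ u ∈ Q) × Col c u v → Coloured c P ⊎ Coloured c Q
    split (u , inj₁ u∈P , uv) = inj₁ (u , u∈P , uv)
    split (u , inj₂ u∈Q , uv) = inj₂ (u , u∈Q , uv)

module _ {n ℓ} (T : Colouring n ℓ) where
  open Colouring T

  cut-extends : ∀ {W v} → W ⊆ U → v ∈ U → v ∉ W → (∀ c → ∃[ u ] u ∈ W × Col c u v) → Cut W → Cut (W ∪ ⁅ v ⁆)
  cut-extends {W} {v} W⊆U v∈U v∉W coloured cut = ≡.subst (λ X → Cut (X ∪ ⁅ v ⁆)) PQ≡W
    (cut-mixed-vertex S (low , ∈P low∈W low∈left) (high , ∈Q high∈W high∉left)
      λ c → let (u , u∈W , uv) = coloured c in u , split u∈W , uv)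
    where
    open Cut cut
    P Q : Subset n
    P = W ∩ left
    Q = W ∩ ∁ left
    ∈P : ∀ {i} → i ∈ W → i ∈ left → i ∈ P
    ∈P i∈W i∈left = Subset.x∈p∩q⁺ (i∈W , i∈left)
    ∈Q : ∀ {i} → i ∈ W → i ∉ left → i ∈ Q
    ∈Q i∈W i∉left = Subset.x∈p∩q⁺ (i∈W , Subset.x∉p⇒x∈∁p i∉left)
    P⊆W : P ⊆ W
    P⊆W = Subset.p∩q⊆p W left
    Q⊆W : Q ⊆ W
    Q⊆W = Subset.p∩q⊆p W (∁ left)
    split : ∀ {i} → i ∈ W → i ∈ P ⊎ i ∈ Q
    split {i} i∈W with i ∈? left
    ... | yes i∈left = inj₁ (∈P i∈W i∈left)
    ... | no i∉left  = inj₂ (∈Q i∈W i∉left)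
    PQ≡W : P ∪ Q ≡ W
    PQ≡W = Subset.⊆-antisym
      (λ i∈ → [ P⊆W , Q⊆W ]′ (Subset.x∈p∪q⁻ P Q i∈)) (λ i∈W → Subset.x∈p∪q⁺ (split i∈W))
    S : Setting T
    S = record
      { P = P ; Q = Q ; v = v ; P⊆U = W⊆U ∘ P⊆W ; Q⊆U = W⊆U ∘ Q⊆W ; v∈U = v∈U
      ; v∉P = v∉W ∘ P⊆W ; v∉Q = v∉W ∘ Q⊆W
      ; P→Q = λ i∈P j∈Q → cross (P⊆W i∈P) (Q⊆W j∈Q) (proj₂ (Subset.x∈p∩q⁻ W left i∈P))
                             (Subset.x∈∁p⇒x∉p (proj₂ (Subset.x∈p∩q⁻ W (∁ left) j∈Q)))
      }

-- The colouring defined by two matrices with equal small minors.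

module Comparison {c ℓ₁ ℓ₂} (ℝ : CompleteOrderedField c ℓ₁ ℓ₂) where
  open CompleteOrderedField ℝ hiding (zero)
  open RealMatrices ℝ
  open IntegerCoefficients commutativeRing using (solve; _:=_; con; _:+_; _:*_; :-_; _:-_)
  open Determinant ℝ
  open ClanInversion ℝ
  open SmallMinors ℝ
  open IsDecTotalOrder isDecTotalOrder using (_≟_)
  open RingProperties ring using (-0#≈0#; -‿involutive)
  open SetoidReasoning setoid

  signed : Bool → Carrier → Carrier
  signed true  x = x
  signed false x = - x

  signed-cong : ∀ c {x y} → x ≈ y → signed c x ≈ signed c y
  signed-cong true  x≈y = x≈y
  signed-cong false x≈y = -‿cong x≈y

  signed-neg : ∀ c x → signed c (- x) ≈ - signed c x
  signed-neg true  x = refl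
  signed-neg false x = refl

  signed-0 : ∀ c → signed c 0# ≈ 0#
  signed-0 true  = refl
  signed-0 false = -0#≈0#

  signed-exclusive : ∀ c {x} → signed c x ≈ signed (not c) x → x ≈ 0#
  signed-exclusive true  x≈-x = x≈-x⇒x≈0 x≈-x
  signed-exclusive false -x≈x = x≈-x⇒x≈0 (sym -x≈x)

  signed-square : ∀ c {x y} → x * x ≈ y * y → ¬ y ≈ signed (not c) x → y ≈ signed c x
  signed-square c {x} {y} x²≈y² y≉ with x*y≈0⇒x≈0∨y≈0 (y - x) (y + x) (begin
    (y - x) * (y + x)  ≈⟨ solve 2 (λ x y → (y :- x) :* (y :+ x) := y :* y :- x :* x) refl x y ⟩
    y * y - x * x      ≈⟨ +-congˡ (-‿cong x²≈y²) ⟩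
    y * y - y * y      ≈⟨ -‿inverseʳ _ ⟩
    0#                 ∎)
  signed-square true  x²≈y² y≉ | inj₁ y-x≈0 = x-y≈0⇒x≈y y-x≈0
  signed-square false x²≈y² y≉ | inj₁ y-x≈0 = contradiction (x-y≈0⇒x≈y y-x≈0) y≉
  signed-square true  x²≈y² y≉ | inj₂ y+x≈0 = contradiction (x-y≈0⇒x≈y (trans (+-congˡ (-‿involutive _)) y+x≈0)) y≉
  signed-square false x²≈y² y≉ | inj₂ y+x≈0 = x-y≈0⇒x≈y (trans (+-congˡ (-‿involutive _)) y+x≈0)

  triple-cong : ∀ {x y z x′ y′ z′} → x ≈ x′ → y ≈ y′ → z ≈ z′ → triple x y z ≈ triple x′ y′ z′
  triple-cong x y z = +-cong (*-cong x z) (+-cong (-‿cong (*-cong z y)) (-‿cong (*-cong y x)))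

  quadruple-cong : ∀ {a b c d e f a′ b′ c′ d′ e′ f′} → a ≈ a′ → b ≈ b′ → c ≈ c′ → d ≈ d′ → e ≈ e′ → f ≈ f′ →
    quadruple a b c d e f ≈ quadruple a′ b′ c′ d′ e′ f′
  quadruple-cong a b c d e f = +-cong (*-cong p q) (+-cong (*-cong q r) (*-cong r p))
    where
    p = *-cong a f
    q = -‿cong (*-cong b e)
    r = *-cong c d

  -- Being of degree 4, `quadruple` ignores a change of all signs, which reduces the colour `false`
  -- to `true`.
  quadruple-negated : ∀ s x → quadruple (- s) (- x) (- x) (- x) s s ≈ quadruple s x x x (- s) (- s)
  quadruple-negated = solve 2 (λ s x →
    (:- s :* s) :* (:- (:- x :* s)) :+ ((:- (:- x :* s)) :* (:- x :* :- x) :+ (:- x :* :- x) :* (:- s :* s)) :=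
    (s :* :- s) :* (:- (x :* :- s)) :+ ((:- (x :* :- s)) :* (x :* x) :+ (x :* x) :* (s :* :- s))) refl

  -- The difference of the two sides factors as -2 s x (x - s) (x + s).
  quadruple-reversal : ∀ {s x} → ¬ s ≈ 0# → ¬ x ≈ 0# →
    quadruple (- s) x x x s s ≈ quadruple s x x x (- s) (- s) → x ≈ s ⊎ x ≈ - s
  quadruple-reversal {s} {x} s≉0 x≉0 e = [ inj₁ , inj₂ ∘ x-y≈0⇒x≈y ∘ trans (+-congˡ (-‿involutive s)) ]′
    (map₁ x-y≈0⇒x≈y (x*y≈0⇒x≈0∨y≈0 (x - s) (x + s) (x*y≈0⇒y≈0 x≉0 (x*y≈0⇒y≈0 s≉0 (x*y≈0⇒y≈0 -2≉0 (begin
      - (1# + 1#) * (s * (x * ((x - s) * (x + s))))             ≈⟨ difference s x ⟩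
      quadruple (- s) x x x s s - quadruple s x x x (- s) (- s) ≈⟨ +-congʳ e ⟩
      quadruple s x x x (- s) (- s) - quadruple s x x x (- s) (- s) ≈⟨ -‿inverseʳ _ ⟩
      0#                                                        ∎))))))
    where
    -2≉0 : ¬ - (1# + 1#) ≈ 0#
    -2≉0 -2≈0 = 1+1≉0 (trans (sym (-‿involutive _)) (trans (-‿cong -2≈0) -0#≈0#))
    difference : ∀ s x → - (1# + 1#) * (s * (x * ((x - s) * (x + s)))) ≈
      quadruple (- s) x x x s s - quadruple s x x x (- s) (- s)
    difference = solve 2 (λ s x →
      :- (con (1 , 0) :+ con (1 , 0)) :* (s :* (x :* ((x :- s) :* (x :+ s)))) :=
      (:- s :* s) :* (:- (x :* s)) :+ ((:- (x :* s)) :* (x :* x) :+ (x :* x) :* (:- s :* s)) :-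
      ((s :* :- s) :* (:- (x :* :- s)) :+ ((:- (x :* :- s)) :* (x :* x) :+ (x :* x) :* (s :* :- s)))) refl

  module _ {n} {U : Subset n} {A B : Matrix n}
    (TA : IsGeneralizedTournament A) (TB : IsGeneralizedTournament B) (same : SmallMinors U A B) where

    private
      a b : Matrix n
      a = skew A
      b = skew B

      skew-0 : ∀ (M : Matrix n) i → skew M i i ≈ 0#
      skew-0 M i = -‿inverseʳ (M i i)

      a-flip : ∀ {i j k l} → a i j ≈ a k l → a j i ≈ a l k
      a-flip e = trans (skew-neg A _ _) (trans (-‿cong e) (sym (skew-neg A _ _)))

    -- The colour true records that B keeps the (nonzero) weight of the pair, false that
    -- B reverses it; pairs of weight 0 have no colour.
    record Colour (c : Bool) (i j : Fin n) : Set ℓ₁ where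
      constructor colour
      field
        source∈U : i ∈ U
        target∈U : j ∈ U
        b≉       : ¬ b i j ≈ signed (not c) (a i j)

    open Colour

    Colour? : ∀ c i j → Dec (Colour c i j)
    Colour? c i j = map′ (λ (i∈U , j∈U , b≉) → colour i∈U j∈U b≉) (λ (colour i∈U j∈U b≉) → i∈U , j∈U , b≉)
      ((i ∈? U) ×-dec ((j ∈? U) ×-dec ¬? (b i j ≟ signed (not c) (a i j))))

    uncoloured : ∀ {c i j} → i ∈ U → j ∈ U → ¬ Colour c i j → b i j ≈ signed (not c) (a i j)
    uncoloured i∈U j∈U ¬ij = decidable-stable (_ ≟ _) λ ≉ → ¬ij (colour i∈U j∈U ≉)

    coloured : ∀ c {i j} → i ∈ U → j ∈ U → b i j ≈ signed c (a i j) → ¬ a i j ≈ 0# → Colour c i j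
    coloured c i∈U j∈U b≈ a≉0 = colour i∈U j∈U λ b≈′ → a≉0 (signed-exclusive c (trans (sym b≈) b≈′))

    colour-sym : ∀ {c i j} → Colour c i j → Colour c j i
    colour-sym {c} {i} {j} (colour i∈U j∈U b≉) = colour j∈U i∈U λ b≈ → b≉ (begin
      b i j                          ≈⟨ skew-neg B j i ⟩
      - b j i                        ≈⟨ -‿cong b≈ ⟩
      - signed (not c) (a j i)       ≈⟨ signed-neg (not c) _ ⟨
      signed (not c) (- a j i)       ≈⟨ signed-cong (not c) (skew-neg A j i) ⟨
      signed (not c) (a i j)         ∎)

    colour-≢ : ∀ {c i j} → Colour c i j → i ≢ j
    colour-≢ {c} {i} (colour _ _ b≉) ≡.refl = b≉
      (trans (skew-0 B i) (sym (trans (signed-cong (not c) (skew-0 A i)) (signed-0 (not c)))))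

    colour-value : ∀ {c i j} → Colour c i j → b i j ≈ signed c (a i j)
    colour-value {c} C@(colour i∈U j∈U b≉) = signed-square c (square-agrees TA TB same i∈U j∈U (colour-≢ C)) b≉

    colour-≉0 : ∀ {c i j} → Colour c i j → ¬ a i j ≈ 0#
    colour-≉0 {c} C@(colour _ _ b≉) a≈0 = b≉ (trans (colour-value C)
      (trans (zero≈ c) (sym (zero≈ (not c)))))
      where
      zero≈ : ∀ c → signed c (a _ _) ≈ 0#
      zero≈ c = trans (signed-cong c a≈0) (signed-0 c)

    colour-excl : ∀ {c i j} → Colour c i j → Colour (not c) i j → ⊥
    colour-excl {true}  C (colour _ _ b≉) = b≉ (colour-value C)
    colour-excl {false} C (colour _ _ b≉) = b≉ (colour-value C)

    nonzero⇒coloured : ∀ c {i j} → i ∈ U → j ∈ U → ¬ a i j ≈ 0# → Colour c i j ⊎ Colour (not c) i j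
    nonzero⇒coloured c {i} {j} i∈U j∈U a≉0 with Colour? c i j
    ... | yes C = inj₁ C
    ... | no ¬C = inj₂ (coloured (not c) i∈U j∈U (uncoloured i∈U j∈U ¬C) a≉0)

    -- Up to a global sign, which the quadratic `triple` ignores, `B` keeps x = `a i j` and reverses
    -- the other two weights y and z; weight 0 counts as reversed. The two triples differ by 2 x (z
    -- - y), and x is nonzero.
    odd-pair⇒same-weight : ∀ {c i j k} → Colour c i j → k ∈ U → ¬ Colour c i k → ¬ Colour c j k → a i k ≈ a j k
    odd-pair⇒same-weight {c} {i} {j} {k} C@(colour i∈U j∈U _) k∈U ¬ik ¬jk = sym (x-y≈0⇒x≈y
      (x*y≈0⇒y≈0 1+1≉0 (x*y≈0⇒y≈0 (colour-≉0 C) (begin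
        x * ((1# + 1#) * (z - y))                 ≈⟨ difference x y z ⟩
        triple x y z - triple x (- y) (- z)       ≈⟨ +-congʳ agrees ⟩
        triple (b i j) (b i k) (b j k) - triple x (- y) (- z)   ≈⟨ +-congʳ (flipped c (colour-value C) (uncoloured i∈U k∈U ¬ik) (uncoloured j∈U k∈U ¬jk)) ⟩
        triple x (- y) (- z) - triple x (- y) (- z)   ≈⟨ -‿inverseʳ _ ⟩
        0#                                        ∎))))
      where
      x = a i j
      y = a i k
      z = a j k
      agrees : triple x y z ≈ triple (b i j) (b i k) (b j k)
      agrees = triple-agrees TA TB same i∈U j∈U k∈U (colour-≢ C)
        (λ { ≡.refl → ¬jk (colour-sym C) }) (λ { ≡.refl → ¬ik C })
      triple-neg : ∀ x y z → triple (- x) (- y) (- z) ≈ triple x y z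
      triple-neg = solve 3 (λ x y z →
        :- x :* :- z :+ (:- (:- z :* :- y) :+ :- (:- y :* :- x)) := x :* z :+ (:- (z :* y) :+ :- (y :* x))) refl
      difference : ∀ x y z → x * ((1# + 1#) * (z - y)) ≈ triple x y z - triple x (- y) (- z)
      difference = solve 3 (λ x y z →
        x :* ((con (1 , 0) :+ con (1 , 0)) :* (z :- y)) :=
        x :* z :+ (:- (z :* y) :+ :- (y :* x)) :- (x :* :- z :+ (:- (:- z :* :- y) :+ :- (:- y :* x)))) refl
      flipped : ∀ c {x′ y′ z′} → x′ ≈ signed c x → y′ ≈ signed (not c) y → z′ ≈ signed (not c) z →
        triple x′ y′ z′ ≈ triple x (- y) (- z)
      flipped true  ex ey ez = triple-cong ex ey ez
      flipped false ex ey ez = trans (triple-cong ex (trans ey (sym (-‿involutive y))) (trans ez (sym (-‿involutive z))))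
        (triple-neg x (- y) (- z))

    private
      Same : (i j k l : Fin n) → Set ℓ₁
      Same i j k l = a i j ≈ a k l

    mix-colours : ∀ {c i j k} → Colour c i j → Colour (not c) j k →
      (Same i j i k × Colour c i k) ⊎ (Same j k i k × Colour (not c) i k)
    mix-colours {c} {i} {j} {k} ij@(colour i∈U _ _) jk@(colour _ k∈U _) with Colour? c i k
    ... | yes ik = inj₁ (a-flip (odd-pair⇒same-weight jk i∈U
      (colour-excl (colour-sym ij)) (colour-excl (colour-sym ik))) , ik)
    ... | no ¬ik = inj₂ (sym ik≈jk , coloured (not c) i∈U k∈U (uncoloured i∈U k∈U ¬ik)
      λ ik≈0 → colour-≉0 jk (trans (sym ik≈jk) ik≈0))
      where
      ik≈jk : a i k ≈ a j k
      ik≈jk = odd-pair⇒same-weight ij k∈U ¬ik (λ jk′ → colour-excl jk′ jk)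

    quadruple-colours : ∀ {c g p q v} → Colour c g v → Colour c g q → Colour c p q →
      Same g v g q → Same g q p q →
      Colour (not c) p v → Colour (not c) q v → Colour (not c) g p →
      Same p v q v → Same v p g p → Same g v p v ⊎ Same g v v p
    quadruple-colours {c} {g} {p} {q} {v} gv@(colour g∈U v∈U _) gq@(colour _ q∈U _) pq@(colour p∈U _ _) gv≈gq gq≈pq pv qv gp pv≈qv vp≈gp =
      [ inj₁ , (λ x≈-s → inj₂ (trans x≈-s (sym (skew-neg A p v)))) ]′
      (quadruple-reversal (colour-≉0 pv) (colour-≉0 gv) (trans (sym weightsA) (trans agrees
        (weightsB c (colour-value gp) (colour-value gq) (colour-value gv) (colour-value pq) (colour-value pv) (colour-value qv)))))
      where
      s = a p v
      x = a g v
      gp≈ : a g p ≈ - s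
      gp≈ = trans (sym vp≈gp) (skew-neg A p v)
      gq≈ : a g q ≈ x
      gq≈ = sym gv≈gq
      pq≈ : a p q ≈ x
      pq≈ = trans (sym gq≈pq) gq≈
      qv≈ : a q v ≈ s
      qv≈ = sym pv≈qv
      weightsA : quadruple (a g p) (a g q) (a g v) (a p q) (a p v) (a q v) ≈ quadruple (- s) x x x s s
      weightsA = quadruple-cong gp≈ gq≈ refl pq≈ refl qv≈
      agrees : quadruple (a g p) (a g q) (a g v) (a p q) (a p v) (a q v) ≈
               quadruple (b g p) (b g q) (b g v) (b p q) (b p v) (b q v)
      agrees = quadruple-agrees TA TB same g∈U p∈U q∈U v∈U
        (colour-≢ gp) (colour-≢ gq) (colour-≢ gv) (colour-≢ pq) (colour-≢ pv) (colour-≢ qv)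
      weightsB : ∀ c {gp′ gq′ gv′ pq′ pv′ qv′} → gp′ ≈ signed (not c) (a g p) → gq′ ≈ signed c (a g q) →
        gv′ ≈ signed c (a g v) → pq′ ≈ signed c (a p q) → pv′ ≈ signed (not c) (a p v) → qv′ ≈ signed (not c) (a q v) →
        quadruple gp′ gq′ gv′ pq′ pv′ qv′ ≈ quadruple s x x x (- s) (- s)
      weightsB true e₁ e₂ e₃ e₄ e₅ e₆ = quadruple-cong (trans e₁ (trans (-‿cong gp≈) (-‿involutive s)))
        (trans e₂ gq≈) e₃ (trans e₄ pq≈) e₅ (trans e₆ (-‿cong qv≈))
      weightsB false e₁ e₂ e₃ e₄ e₅ e₆ = trans (quadruple-cong (trans e₁ gp≈)
        (trans e₂ (-‿cong gq≈)) e₃ (trans e₄ (-‿cong pq≈)) e₅ (trans e₆ qv≈)) (quadruple-negated s x)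

    colouring : ∀ x → ¬ x ≈ 0# → Colouring n ℓ₁
    colouring x x≉0 = record
      { U = U ; Same = Same ; same-sym = sym ; same-trans = trans ; same-flip = a-flip
      ; Col = Colour ; Col? = Colour? ; col-sym = colour-sym ; col-excl = colour-excl
      ; mix = mix-colours ; quad = quadruple-colours
      ; To = λ i j → a i j ≈ x ; To? = λ i j → a i j ≟ x
      ; to-resp = λ s t → trans (sym s) t ; to-same = λ s t → trans s (sym t)
      ; to-col = λ c i∈U j∈U ij≈x → nonzero⇒coloured c i∈U j∈U (λ ij≈0 → x≉0 (trans (sym ij≈x) ij≈0))
      }

    -- Invariant of a set grown along pairs of colour `c`: a vertex by which it cannot be grown does
    -- not distinguish its elements.
    Tight : Bool → Subset n → Set ℓ₁
    Tight c X = ∀ {v} → v ∈ U → v ∉ X → (∀ {i} → i ∈ X → ¬ Colour c i v) →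
      ∀ {i j} → i ∈ X → j ∈ X → a i v ≈ a j v

    record CommonModule (i₀ j₀ : Fin n) : Set ℓ₁ where
      field
        X         : Subset n
        X⊆U       : X ⊆ U
        i₀∈X      : i₀ ∈ X
        j₀∈X      : j₀ ∈ X
        {outer}   : Fin n
        outer∈U   : outer ∈ U
        outer∉X   : outer ∉ X
        uniform-a : ∀ {v} → v ∈ U → v ∉ X → ∀ {i j} → i ∈ X → j ∈ X → a i v ≈ a j v
        uniform-b : ∀ {v} → v ∈ U → v ∉ X → ∀ {i j} → i ∈ X → j ∈ X → b i v ≈ b j v

    Crossing : Bool → Subset n → Set ℓ₁
    Crossing c W = ∃[ i ] ∃[ j ] i ∈ W × j ∉ W × Colour c i j

    -- Connectedness by bipartitions, not by paths. The crossing pair may leave `X`; for `X` equal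
    -- to `U` this is connectedness of the graph of colour `c`.
    Connected : Bool → Subset n → Set ℓ₁
    Connected c X = ∀ W → (∃[ i ] i ∈ X × i ∈ W) → (∃[ j ] j ∈ X × j ∉ W) → Crossing c W

    private
      pair-∪ : ∀ {X : Subset n} {v i} → i ∈ X ∪ ⁅ v ⁆ → i ∈ X ⊎ i ≡ v
      pair-∪ {X} {v} i∈ = [ inj₁ , inj₂ ∘ Subset.x∈⁅y⁆⇒x≡y v ]′ (Subset.x∈p∪q⁻ X ⁅ v ⁆ i∈)

      ∪-new : ∀ (X : Subset n) v → v ∈ X ∪ ⁅ v ⁆
      ∪-new X v = Subset.x∈p∪q⁺ {p = X} (inj₂ (Subset.x∈⁅x⁆ v))

      ∪-old : ∀ {X : Subset n} v → X ⊆ X ∪ ⁅ v ⁆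
      ∪-old v = Subset.p⊆p∪q ⁅ v ⁆

      ∪-⊆ : ∀ {X v} → X ⊆ U → v ∈ U → X ∪ ⁅ v ⁆ ⊆ U
      ∪-⊆ X⊆U v∈U i∈ = [ X⊆U , (λ { ≡.refl → v∈U }) ]′ (pair-∪ i∈)

    tight-singleton : ∀ {c} i → Tight c ⁅ i ⁆
    tight-singleton i _ _ _ j∈ k∈ with Subset.x∈⁅y⁆⇒x≡y i j∈ | Subset.x∈⁅y⁆⇒x≡y i k∈
    ... | ≡.refl | ≡.refl = refl

    tight-extend : ∀ {c X u v} → Tight c X → u ∈ X → Colour c u v → Tight c (X ∪ ⁅ v ⁆)
    tight-extend {c} {X} {u} {v} tight u∈X uv {w} w∈U w∉ ¬c i∈ j∈ = trans (to-u i∈) (sym (to-u j∈))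
      where
      to-u : ∀ {i} → i ∈ X ∪ ⁅ v ⁆ → a i w ≈ a u w
      to-u i∈ with pair-∪ i∈
      ... | inj₁ i∈X = tight w∈U (w∉ ∘ ∪-old v) (¬c ∘ ∪-old v) i∈X u∈X
      ... | inj₂ ≡.refl = sym (odd-pair⇒same-weight uv w∈U (¬c (∪-old v u∈X)) (¬c (∪-new X v)))

    connected-singleton : ∀ {c} i → Connected c ⁅ i ⁆
    connected-singleton i W (j , j∈ , j∈W) (k , k∈ , k∉W) with Subset.x∈⁅y⁆⇒x≡y i j∈ | Subset.x∈⁅y⁆⇒x≡y i k∈
    ... | ≡.refl | ≡.refl = contradiction j∈W k∉W

    connected-extend : ∀ {c X u v} → Connected c X → u ∈ X → Colour c u v → Connected c (X ∪ ⁅ v ⁆)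
    connected-extend {c} {X} {u} {v} connected u∈X uv W (i , i∈ , i∈W) (j , j∈ , j∉W) with u ∈? W | v ∈? W
    ... | yes u∈W | no v∉W = u , v , u∈W , v∉W , uv
    ... | no u∉W | yes v∈W = v , u , v∈W , u∉W , colour-sym uv
    ... | yes u∈W | yes v∈W = connected W (u , u∈X , u∈W)
      (j , [ id , (λ { ≡.refl → contradiction v∈W j∉W }) ]′ (pair-∪ j∈) , j∉W)
    ... | no u∉W | no v∉W = connected W
      (i , [ id , (λ { ≡.refl → contradiction i∈W v∉W }) ]′ (pair-∪ i∈) , i∈W) (u , u∈X , u∉W)

    -- The component of the given pair is grown until it is closed. If it is proper, it is uniform
    -- for `A` by tightness, and for `B` because no pair leaving it has colour `c`, so that all
    -- these weights change by the same sign.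
    module-or-connected : ∀ {c i₀ j₀} → Colour c i₀ j₀ → CommonModule i₀ j₀ ⊎ Connected c U
    module-or-connected {c} {i₀} {j₀} C@(colour i₀∈U j₀∈U _) = grow (⁅ i₀ ⁆ ∪ ⁅ j₀ ⁆) (⊃-wellFounded _)
      (∪-⊆ (λ i∈ → ≡.subst (_∈ U) (≡.sym (Subset.x∈⁅y⁆⇒x≡y i₀ i∈)) i₀∈U) j₀∈U)
      (∪-old j₀ (Subset.x∈⁅x⁆ i₀)) (∪-new ⁅ i₀ ⁆ j₀)
      (tight-extend (tight-singleton i₀) (Subset.x∈⁅x⁆ i₀) C)
      (connected-extend (connected-singleton i₀) (Subset.x∈⁅x⁆ i₀) C)
      where
      grow : ∀ X → Acc _⊃_ X → X ⊆ U → i₀ ∈ X → j₀ ∈ X → Tight c X → Connected c X →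
        CommonModule i₀ j₀ ⊎ Connected c U
      grow X (acc rec) X⊆U i₀∈X j₀∈X tight connected
        with Fin.any? (λ v → ¬? (v ∈? X) ×-dec Fin.any? (λ u → (u ∈? X) ×-dec Colour? c u v))
      ... | yes (v , v∉X , u , u∈X , uv@(colour _ v∈U _)) =
        grow (X ∪ ⁅ v ⁆) (rec (∪-old v , v , ∪-new X v , v∉X)) (∪-⊆ X⊆U v∈U) (∪-old v i₀∈X) (∪-old v j₀∈X)
          (tight-extend tight u∈X uv) (connected-extend connected u∈X uv)
      ... | no closed with Fin.any? (λ v → (v ∈? U) ×-dec ¬? (v ∈? X))
      ... | no full = inj₂ λ W (i , i∈U , i∈W) (j , j∈U , j∉W) → connected W (i , inX i∈U , i∈W) (j , inX j∈U , j∉W)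
        where
        inX : ∀ {i} → i ∈ U → i ∈ X
        inX {i} i∈U = decidable-stable (i ∈? X) λ i∉X → full (i , i∈U , i∉X)
      ... | yes (v , v∈U , v∉X) = inj₁ record
        { X = X ; X⊆U = X⊆U ; i₀∈X = i₀∈X ; j₀∈X = j₀∈X ; outer∈U = v∈U ; outer∉X = v∉X
        ; uniform-a = uniform-a
        ; uniform-b = λ w∈U w∉X i∈X j∈X → trans (value w∈U w∉X i∈X)
            (trans (signed-cong (not c) (uniform-a w∈U w∉X i∈X j∈X)) (sym (value w∈U w∉X j∈X)))
        }
        where
        uncrossed : ∀ {w i} → w ∉ X → i ∈ X → ¬ Colour c i w
        uncrossed w∉X i∈X iw = closed (_ , w∉X , _ , i∈X , iw)
        uniform-a : ∀ {w} → w ∈ U → w ∉ X → ∀ {i j} → i ∈ X → j ∈ X → a i w ≈ a j w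
        uniform-a w∈U w∉X = tight w∈U w∉X (uncrossed w∉X)
        value : ∀ {w i} → w ∈ U → w ∉ X → i ∈ X → b i w ≈ signed (not c) (a i w)
        value w∈U w∉X i∈X = uncoloured (X⊆U i∈X) w∈U (uncrossed w∉X i∈X)

    -- A `Colouring` is tied to one weight, whereas the weight of the cut may change while the set
    -- grows.
    CutOf : Carrier → Subset n → Set ℓ₁
    CutOf x W = ∃[ L ] (∃[ l ] l ∈ W × l ∈ L) × (∃[ h ] h ∈ W × h ∉ L) ×
      (∀ {i j} → i ∈ W → j ∈ W → i ∈ L → j ∉ L → a i j ≈ x)

    private
      either-colour : ∀ {p} (P : Bool → Set p) c → P c → P (not c) → ∀ d → P d
      either-colour P true  x y true  = x
      either-colour P true  x y false = y
      either-colour P false x y true  = y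
      either-colour P false x y false = x

      fromCut : ∀ {x} (x≉0 : ¬ x ≈ 0#) {W} → Colouring.Cut (colouring x x≉0) W → CutOf x W
      fromCut _ cut = left , (_ , low∈W , low∈left) , (_ , high∈W , high∉left) , cross
        where open Colouring.Cut cut

      cutOf-extends : ∀ {x} → ¬ x ≈ 0# → ∀ {W v} → W ⊆ U → v ∈ U → v ∉ W →
        (∀ c → ∃[ u ] u ∈ W × Colour c u v) → CutOf x W → CutOf x (W ∪ ⁅ v ⁆)
      cutOf-extends {x} x≉0 W⊆U v∈U v∉W mixed (L , (l , l∈W , l∈L) , (h , h∈W , h∉L) , cross) =
        fromCut x≉0 (cut-extends (colouring x x≉0) W⊆U v∈U v∉W mixed cut)
        where
        cut : Colouring.Cut (colouring x x≉0) _
        cut = record { left = L ; low∈W = l∈W ; low∈left = l∈L ; high∈W = h∈W ; high∉left = h∉L ; cross = cross }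

      cut-singleton : ∀ {W v x} → ∃ (_∈ W) → v ∉ W → (∀ {i} → i ∈ W → a v i ≈ x) → CutOf x (W ∪ ⁅ v ⁆)
      cut-singleton {W} {v} (w , w∈W) v∉W v→W = ⁅ v ⁆ , (v , ∪-new W v , Subset.x∈⁅x⁆ v) ,
        (w , ∪-old v w∈W , λ w∈v → v∉W (≡.subst (_∈ W) (Subset.x∈⁅y⁆⇒x≡y v w∈v) w∈W)) , cross
        where
        cross : ∀ {i j} → i ∈ W ∪ ⁅ v ⁆ → j ∈ W ∪ ⁅ v ⁆ → i ∈ ⁅ v ⁆ → j ∉ ⁅ v ⁆ → a i j ≈ _
        cross i∈ j∈ i∈v j∉v with Subset.x∈⁅y⁆⇒x≡y v i∈v | pair-∪ j∈
        ... | ≡.refl | inj₁ j∈W = v→W j∈W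
        ... | ≡.refl | inj₂ ≡.refl = contradiction (Subset.x∈⁅x⁆ v) j∉v

    -- A vertex joined to W by a pair of colour d = not c either sees both colours in W, or
    -- sees no c and is then uniform on W by tightness, which is a new cut of its own; the
    -- roles of the colours are exchanged in the latter case.
    connected⇒cut : ∀ {c i₀ j₀} → Colour c i₀ j₀ → (∀ d → Connected d U) → ∃[ x ] CutOf x U
    connected⇒cut {c} {i₀} {j₀} C@(colour i₀∈U j₀∈U _) connected = grow (⁅ j₀ ⁆ ∪ ⁅ i₀ ⁆) (⊃-wellFounded _) c
      (colour-≉0 C) (∪-⊆ (λ j∈ → ≡.subst (_∈ U) (≡.sym (Subset.x∈⁅y⁆⇒x≡y j₀ j∈)) j₀∈U) i₀∈U)
      (cut-singleton (j₀ , Subset.x∈⁅x⁆ j₀) (λ i₀∈ → colour-≢ C (Subset.x∈⁅y⁆⇒x≡y j₀ i₀∈))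
        λ j∈ → reflexive (≡.cong (a i₀) (Subset.x∈⁅y⁆⇒x≡y j₀ j∈)))
      (tight-extend (tight-singleton j₀) (Subset.x∈⁅x⁆ j₀) (colour-sym C))
      where
      grow : ∀ W → Acc _⊃_ W → ∀ c {x} → ¬ x ≈ 0# → W ⊆ U → CutOf x W → Tight c W → ∃[ x ] CutOf x U
      grow W (acc rec) c {x} x≉0 W⊆U cut tight with Fin.any? (λ v → (v ∈? U) ×-dec ¬? (v ∈? W))
      ... | no full = x , ≡.subst (CutOf x) (Subset.⊆-antisym W⊆U
        λ {i} i∈U → decidable-stable (i ∈? W) λ i∉W → full (i , i∈U , i∉W)) cut
      ... | yes (o , o∈U , o∉W) with connected (not c) W (let (_ , (l , l∈W , _) , _) = cut in l , W⊆U l∈W , l∈W) (o , o∈U , o∉W)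
      ... | u , v , u∈W , v∉W , uv@(colour u∈U v∈U _) with Fin.any? (λ u′ → (u′ ∈? W) ×-dec Colour? c u′ v)
      ... | yes (u′ , u′∈W , u′v) = grow (W ∪ ⁅ v ⁆) (rec (∪-old v , v , ∪-new W v , v∉W)) c x≉0 (∪-⊆ W⊆U v∈U)
        (cutOf-extends x≉0 W⊆U v∈U v∉W (either-colour _ c (u′ , u′∈W , u′v) (u , u∈W , uv)) cut)
        (tight-extend tight u′∈W u′v)
      ... | no ¬c = grow (W ∪ ⁅ v ⁆) (rec (∪-old v , v , ∪-new W v , v∉W)) (not c)
        (colour-≉0 (colour-sym uv)) (∪-⊆ W⊆U v∈U)
        (cut-singleton (u , u∈W) v∉W λ i∈W → a-flip (uniform i∈W u∈W))
        tight′
        where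
        uniform : ∀ {i j} → i ∈ W → j ∈ W → a i v ≈ a j v
        uniform = tight v∈U v∉W λ i∈W iv → ¬c (_ , i∈W , iv)
        all-coloured : ∀ {i} → i ∈ W → Colour (not c) i v
        all-coloured i∈W = coloured (not c) (W⊆U i∈W) v∈U
          (uncoloured (W⊆U i∈W) v∈U λ iv → ¬c (_ , i∈W , iv))
          λ iv≈0 → colour-≉0 uv (trans (uniform u∈W i∈W) iv≈0)
        -- Every element of `W` is joined to `v` in `not c`, so each of these pairs is the odd one
        -- in its triangle with `w`, and `w` has the same weight to that element as to `v`.
        tight′ : Tight (not c) (W ∪ ⁅ v ⁆)
        tight′ {w} w∈U w∉ ¬d i∈ j∈ = trans (to-v i∈) (sym (to-v j∈))
          where
          to-v : ∀ {i} → i ∈ W ∪ ⁅ v ⁆ → a i w ≈ a v w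
          to-v i∈ with pair-∪ i∈
          ... | inj₁ i∈W = odd-pair⇒same-weight (all-coloured i∈W) w∈U (¬d (∪-old v i∈W)) (¬d (∪-new W v))
          ... | inj₂ ≡.refl = refl

-- Chains of clan inversions, in a clan and in a quotient.

module Inversions {c ℓ₁ ℓ₂} (ℝ : CompleteOrderedField c ℓ₁ ℓ₂) where
  open CompleteOrderedField ℝ hiding (zero)
  open RealMatrices ℝ
  open Determinant ℝ
  open ClanInversion ℝ
  open SmallMinors ℝ
  open SetoidReasoning setoid
  open Comparison ℝ

  module _ {n} (M : Matrix n) (Y : Subset n) where
    inv-inside : ∀ {i j} → i ∈ Y → j ∈ Y → Inv M Y i j ≡ M j i
    inv-inside {i} {j} i∈Y j∈Y rewrite dec-true (i ∈? Y) i∈Y | dec-true (j ∈? Y) j∈Y = ≡.refl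

    inv-outsideˡ : ∀ {i j} → i ∉ Y → Inv M Y i j ≡ M i j
    inv-outsideˡ {i} {j} i∉Y rewrite dec-false (i ∈? Y) i∉Y = ≡.refl

    inv-outsideʳ : ∀ {i j} → j ∉ Y → Inv M Y i j ≡ M i j
    inv-outsideʳ {i} {j} j∉Y rewrite dec-false (j ∈? Y) j∉Y with i ∈? Y
    ... | yes _ = ≡.refl
    ... | no _  = ≡.refl

    inv-cases : ∀ i j → (Inv M Y i j ≡ M i j × Inv M Y j i ≡ M j i) ⊎ (Inv M Y i j ≡ M j i × Inv M Y j i ≡ M i j)
    inv-cases i j = cases (i ∈? Y) (j ∈? Y)
      where
      cases : Dec (i ∈ Y) → Dec (j ∈ Y) → _
      cases (no i∉Y)  _         = inj₁ (inv-outsideˡ i∉Y , inv-outsideʳ i∉Y)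
      cases (yes _)   (no j∉Y)  = inj₁ (inv-outsideʳ j∉Y , inv-outsideˡ j∉Y)
      cases (yes i∈Y) (yes j∈Y) = inj₂ (inv-inside i∈Y j∈Y , inv-inside j∈Y i∈Y)

    inv-tournament : IsGeneralizedTournament M → IsGeneralizedTournament (Inv M Y)
    inv-tournament T = record { nonNeg = nonNeg′ ; M+Mᵗ = M+Mᵗ′ }
      where
      open IsGeneralizedTournament T
      nonNeg′ : ∀ i j → 0# ≤ Inv M Y i j
      nonNeg′ i j with inv-cases i j
      ... | inj₁ (e , _) = ≡.subst (0# ≤_) (≡.sym e) (nonNeg i j)
      ... | inj₂ (e , _) = ≡.subst (0# ≤_) (≡.sym e) (nonNeg j i)
      M+Mᵗ′ : ∀ i j → Inv M Y i j + Inv M Y j i ≈ J n i j - I n i j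
      M+Mᵗ′ i j with inv-cases i j
      ... | inj₁ (e , f) = trans (reflexive (≡.cong₂ _+_ e f)) (M+Mᵗ i j)
      ... | inj₂ (e , f) = trans (reflexive (≡.cong₂ _+_ e f)) (trans (+-comm _ _) (M+Mᵗ i j))

  inv-agree : ∀ {n} {A A′ : Matrix n} {Y Y′ : Subset n} {i j} →
    (i ∈ Y → i ∈ Y′) → (i ∈ Y′ → i ∈ Y) → (j ∈ Y → j ∈ Y′) → (j ∈ Y′ → j ∈ Y) →
    A i j ≈ A′ i j → A j i ≈ A′ j i → Inv A Y i j ≈ Inv A′ Y′ i j
  inv-agree {A = A} {A′} {Y} {Y′} {i} {j} i→ i← j→ j← ij ji with i ∈? Y | j ∈? Y
  ... | yes i∈Y | yes j∈Y = trans ji (reflexive (≡.sym (inv-inside A′ Y′ (i→ i∈Y) (j→ j∈Y))))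
  ... | no i∉Y | _ = trans ij (reflexive (≡.sym (inv-outsideˡ A′ Y′ (i∉Y ∘ i←))))
  ... | yes _ | no j∉Y = trans ij (reflexive (≡.sym (inv-outsideʳ A′ Y′ (j∉Y ∘ j←))))

  ClanIn : ∀ {n} → Subset n → Matrix n → Subset n → Set ℓ₁
  ClanIn U A X = ∀ {i j k} → i ∈ X → j ∈ X → k ∈ U → k ∉ X → A i k ≈ A j k × A k i ≈ A k j

  -- For an outer vertex in `Y` the row and column conditions trade places; for one outside `Y`
  -- nothing changes.
  inv-clan-⊆ : ∀ {n} {U X Y : Subset n} {A : Matrix n} → X ⊆ Y → ClanIn U A X → ClanIn U (Inv A Y) X
  inv-clan-⊆ {Y = Y} {A} X⊆Y clan {i} {j} {k} i∈X j∈X k∈U k∉X = cases (k ∈? Y)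
    where
    i∈Y = X⊆Y i∈X
    j∈Y = X⊆Y j∈X
    ik,ki : A i k ≈ A j k × A k i ≈ A k j
    ik,ki = clan i∈X j∈X k∈U k∉X
    cases : Dec (k ∈ Y) → Inv A Y i k ≈ Inv A Y j k × Inv A Y k i ≈ Inv A Y k j
    cases (yes k∈Y) =
      ≡.subst₂ _≈_ (≡.sym (inv-inside A Y i∈Y k∈Y)) (≡.sym (inv-inside A Y j∈Y k∈Y)) (proj₂ ik,ki) ,
      ≡.subst₂ _≈_ (≡.sym (inv-inside A Y k∈Y i∈Y)) (≡.sym (inv-inside A Y k∈Y j∈Y)) (proj₁ ik,ki)
    cases (no k∉Y) =
      ≡.subst₂ _≈_ (≡.sym (inv-outsideʳ A Y k∉Y)) (≡.sym (inv-outsideʳ A Y k∉Y)) (proj₁ ik,ki) ,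
      ≡.subst₂ _≈_ (≡.sym (inv-outsideˡ A Y k∉Y)) (≡.sym (inv-outsideˡ A Y k∉Y)) (proj₂ ik,ki)

  inv-clan-disjoint : ∀ {n} {U X Y : Subset n} {A : Matrix n} → (∀ {i} → i ∈ X → i ∉ Y) →
    ClanIn U A X → ClanIn U (Inv A Y) X
  inv-clan-disjoint {Y = Y} {A} disjoint clan i∈X j∈X k∈U k∉X with clan i∈X j∈X k∈U k∉X
  ... | ik , ki =
    ≡.subst₂ _≈_ (≡.sym (inv-outsideˡ A Y (disjoint i∈X))) (≡.sym (inv-outsideˡ A Y (disjoint j∈X))) ik ,
    ≡.subst₂ _≈_ (≡.sym (inv-outsideʳ A Y (disjoint i∈X))) (≡.sym (inv-outsideʳ A Y (disjoint j∈X))) ki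

  Agree : ∀ {n} → Subset n → Matrix n → Matrix n → Set ℓ₁
  Agree U A B = ∀ {i j} → i ∈ U → j ∈ U → A i j ≈ B i j

  -- The inverted sets lie in `U`, so a chain for a part alters no entry with an index outside it.
  -- The matrices in between are exact; agreement up to `≈` is asked only at the end.
  data Chain {n} (U : Subset n) : Matrix n → Matrix n → Set (c Level.⊔ ℓ₁) where
    done   : ∀ {A} → Chain U A A
    invert : ∀ {A C} Y → Y ⊆ U → ClanIn U A Y → Chain U (Inv A Y) C → Chain U A C

  _++_ : ∀ {n} {U : Subset n} {A B C} → Chain U A B → Chain U B C → Chain U A C
  done                ++ ds = ds
  invert Y Y⊆U cl cs  ++ ds = invert Y Y⊆U cl (cs ++ ds)

  module _ {n} {U : Subset n} where
    chain-tournament : ∀ {A C} → Chain U A C → IsGeneralizedTournament A → IsGeneralizedTournament C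
    chain-tournament done              T = T
    chain-tournament (invert Y _ _ cs) T = chain-tournament cs (inv-tournament _ Y T)

    clan⇒transposedOnClan : ∀ {m} {A : Matrix n} {Y} (f : Fin m → Fin n) → (∀ i → f i ∈ U) → ClanIn U A Y →
      TransposedOnClan (λ i → does (f i ∈? Y)) (λ i j → A (f i) (f j)) (λ i j → Inv A Y (f i) (f j))
    clan⇒transposedOnClan {A = A} {Y} f f∈U clan = record
      { rows       = λ i j k → proj₁ (clan (member i) (member j) (f∈U _) (nonmember k))
      ; columns    = λ i j k → proj₂ (clan (member i) (member j) (f∈U _) (nonmember k))
      ; transposed = λ i j → reflexive (inv-inside A Y (member i) (member j))
      ; unchangedʳ = λ i → reflexive (inv-outsideˡ A Y (nonmember i))
      ; unchangedᶜ = λ j → reflexive (inv-outsideʳ A Y (nonmember j))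
      }
      where
      member : ∀ {i} → does (i ∈? Y) ≡ true → i ∈ Y
      member {i} e with yes i∈Y ← i ∈? Y = i∈Y
      nonmember : ∀ {i} → does (i ∈? Y) ≡ false → i ∉ Y
      nonmember {i} e with no i∉Y ← i ∈? Y = i∉Y

    chain-det : ∀ {m} {A C} → Chain U A C → (f : Fin m → Fin n) → (∀ i → f i ∈ U) →
      det (λ i j → A (f i) (f j)) ≈ det (λ i j → C (f i) (f j))
    chain-det done                 f f∈U = refl
    chain-det (invert Y _ clan cs) f f∈U =
      trans (det-transposedOnClan (clan⇒transposedOnClan f f∈U clan)) (chain-det cs f f∈U)

    chain-smallMinors : ∀ {A B C} → Chain U A C → SmallMinors U A B → SmallMinors U C B
    chain-smallMinors cs same m≤4 f inj f∈U = trans (sym (chain-det cs f f∈U)) (same m≤4 f inj f∈U)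

    chain-outside : ∀ {A C} → Chain U A C → ∀ {i j} → i ∉ U ⊎ j ∉ U → C i j ≈ A i j
    chain-outside done                _  = refl
    chain-outside {A} (invert Y Y⊆U _ cs) ∉U = trans (chain-outside cs ∉U) (reflexive
      ([ (λ i∉U → inv-outsideˡ A Y (i∉U ∘ Y⊆U)) , (λ j∉U → inv-outsideʳ A Y (j∉U ∘ Y⊆U)) ]′ ∉U))

  restrict : ∀ {n} {U V : Subset n} {A B} → V ⊆ U → SmallMinors U A B → SmallMinors V A B
  restrict V⊆U same m≤4 f inj f∈V = same m≤4 f inj (V⊆U ∘ f∈V)

  -- A vertex outside the clan `X` does not distinguish elements of `X`, so clans within `X` are
  -- clans in `U`. Inverting them leaves the entries between `X` and the rest alone, so `X` remains
  -- a clan.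
  chain-in-clan : ∀ {n} {U X : Subset n} {A C} → X ⊆ U → ClanIn U A X → Chain X A C → Chain U A C
  chain-in-clan X⊆U clan done = done
  chain-in-clan {U = U} {X} {A} X⊆U clan (invert Y Y⊆X clanY cs) =
    invert Y (X⊆U ∘ Y⊆X) clanU (chain-in-clan X⊆U clanX cs)
    where
    clanU : ClanIn U A Y
    clanU {k = k} i∈Y j∈Y k∈U k∉Y with k ∈? X
    ... | yes k∈X = clanY i∈Y j∈Y k∈X k∉Y
    ... | no k∉X  = clan (Y⊆X i∈Y) (Y⊆X j∈Y) k∈U k∉X
    clanX : ClanIn U (Inv A Y) X
    clanX {i} {j} {k} i∈X j∈X k∈U k∉X with clan i∈X j∈X k∈U k∉X
    ... | ik , ki =
      ≡.subst₂ _≈_ (≡.sym (inv-outsideʳ A Y (k∉X ∘ Y⊆X))) (≡.sym (inv-outsideʳ A Y (k∉X ∘ Y⊆X))) ik ,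
      ≡.subst₂ _≈_ (≡.sym (inv-outsideˡ A Y (k∉X ∘ Y⊆X))) (≡.sym (inv-outsideˡ A Y (k∉X ∘ Y⊆X))) ki

  -- V is a transversal of the quotient of U by the clan X, with representative x₀.
  module Quotient {n} {U X V : Subset n} {x₀ : Fin n} (X⊆U : X ⊆ U) (V⊆U : V ⊆ U)
    (x₀∈X : x₀ ∈ X) (x₀∈V : x₀ ∈ V) (V∩X : ∀ {i} → i ∈ V → i ∈ X → i ≡ x₀)
    (cover : ∀ {i} → i ∈ U → i ∉ X → i ∈ V) where

    -- The inversion of `Y` lifts to that of `Y ∪ X` or of `Y`, according to whether `Y` contains
    -- the representative. The lift also transposes `X`, so the lifted matrix `A₁` is tied to `A` on
    -- `V` only.
    chain-from-quotient : ∀ {A A₁ C} → Agree V A₁ A → ClanIn U A₁ X → Chain V A C →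
      ∃[ C₁ ] Chain U A₁ C₁ × Agree V C₁ C × ClanIn U C₁ X
    chain-from-quotient agree clanX done = _ , done , agree , clanX
    chain-from-quotient {A} {A₁} agree clanX (invert Y Y⊆V clanY cs) with x₀ ∈? Y
    ... | yes x₀∈Y with chain-from-quotient {A₁ = Inv A₁ (Y ∪ X)} agree′ (inv-clan-⊆ (Subset.q⊆p∪q Y X) clanX) cs
      where
      from∪ : ∀ {i} → i ∈ Y ∪ X → i ∈ Y ⊎ i ∈ X
      from∪ = Subset.x∈p∪q⁻ Y X
      into : ∀ {i} → i ∈ Y → i ∈ Y ∪ X
      into = Subset.p⊆p∪q X
      back : ∀ {i} → i ∈ V → i ∈ Y ∪ X → i ∈ Y
      back i∈V i∈ = [ id , (λ i∈X → ≡.subst (_∈ Y) (≡.sym (V∩X i∈V i∈X)) x₀∈Y) ]′ (from∪ i∈)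
      agree′ : Agree V (Inv A₁ (Y ∪ X)) (Inv A Y)
      agree′ i∈V j∈V = inv-agree {A = A₁} {A} (back i∈V) into (back j∈V) into (agree i∈V j∈V) (agree j∈V i∈V)
    ... | C₁ , ds , rest = C₁ , invert (Y ∪ X) Y∪X⊆U clan ds , rest
      where
      from∪ : ∀ {i} → i ∈ Y ∪ X → i ∈ Y ⊎ i ∈ X
      from∪ = Subset.x∈p∪q⁻ Y X
      Y∪X⊆U : Y ∪ X ⊆ U
      Y∪X⊆U i∈ = [ V⊆U ∘ Y⊆V , X⊆U ]′ (from∪ i∈)
      clan : ClanIn U A₁ (Y ∪ X)
      clan {i} {j} {k} i∈ j∈ k∈U k∉ =
        trans (proj₁ (to-x₀ i∈)) (sym (proj₁ (to-x₀ j∈))) , trans (proj₂ (to-x₀ i∈)) (sym (proj₂ (to-x₀ j∈)))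
        where
        k∉Y : k ∉ Y
        k∉Y = k∉ ∘ Subset.p⊆p∪q X
        k∉X : k ∉ X
        k∉X = k∉ ∘ Subset.q⊆p∪q Y X
        k∈V : k ∈ V
        k∈V = cover k∈U k∉X
        to-x₀ : ∀ {i} → i ∈ Y ∪ X → A₁ i k ≈ A₁ x₀ k × A₁ k i ≈ A₁ k x₀
        to-x₀ i∈ with from∪ i∈
        ... | inj₂ i∈X = clanX i∈X x₀∈X k∈U k∉X
        ... | inj₁ i∈Y with clanY i∈Y x₀∈Y k∈V k∉Y
        ... | ik , ki =
          trans (agree (Y⊆V i∈Y) k∈V) (trans ik (sym (agree x₀∈V k∈V))) ,
          trans (agree k∈V (Y⊆V i∈Y)) (trans ki (sym (agree k∈V x₀∈V)))
    chain-from-quotient {A} {A₁} agree clanX (invert Y Y⊆V clanY cs)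
        | no x₀∉Y with chain-from-quotient {A₁ = Inv A₁ Y} agree′ (inv-clan-disjoint (flip disjoint) clanX) cs
      where
      disjoint : ∀ {i} → i ∈ Y → i ∉ X
      disjoint i∈Y i∈X = x₀∉Y (≡.subst (_∈ Y) (V∩X (Y⊆V i∈Y) i∈X) i∈Y)
      agree′ : Agree V (Inv A₁ Y) (Inv A Y)
      agree′ i∈V j∈V = inv-agree {A = A₁} {A} {Y} {Y} id id id id (agree i∈V j∈V) (agree j∈V i∈V)
    ... | C₁ , ds , rest = C₁ , invert Y (V⊆U ∘ Y⊆V) clan ds , rest
      where
      disjoint : ∀ {i} → i ∈ Y → i ∉ X
      disjoint i∈Y i∈X = x₀∉Y (≡.subst (_∈ Y) (V∩X (Y⊆V i∈Y) i∈X) i∈Y)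
      clanV : ∀ {i j k} → i ∈ Y → j ∈ Y → k ∈ V → k ∉ Y → A₁ i k ≈ A₁ j k × A₁ k i ≈ A₁ k j
      clanV i∈Y j∈Y k∈V k∉Y with clanY i∈Y j∈Y k∈V k∉Y
      ... | ik , ki =
        trans (agree (Y⊆V i∈Y) k∈V) (trans ik (sym (agree (Y⊆V j∈Y) k∈V))) ,
        trans (agree k∈V (Y⊆V i∈Y)) (trans ki (sym (agree k∈V (Y⊆V j∈Y))))
      clan : ClanIn U A₁ Y
      clan {i} {j} {k} i∈Y j∈Y k∈U k∉Y with k ∈? X
      ... | no k∉X = clanV i∈Y j∈Y (cover k∈U k∉X) k∉Y
      ... | yes k∈X = trans (proj₂ (at i∈Y)) (trans (proj₁ i≈j) (sym (proj₂ (at j∈Y)))) ,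
                      trans (proj₁ (at i∈Y)) (trans (proj₂ i≈j) (sym (proj₁ (at j∈Y))))
        where
        at : ∀ {l} → l ∈ Y → A₁ k l ≈ A₁ x₀ l × A₁ l k ≈ A₁ l x₀
        at l∈Y = clanX k∈X x₀∈X (V⊆U (Y⊆V l∈Y)) (disjoint l∈Y)
        i≈j = clanV i∈Y j∈Y x₀∈V x₀∉Y

  clan-sequence : ∀ {n} {A C : Matrix n} → IsGeneralizedTournament A → Chain ⊤ A C → ClanInversionSequence A C
  clan-sequence {A = A} T done = 0 , (λ _ → A) , (λ _ _ → refl) , (λ _ _ → refl) , (λ _ → T) , λ ()
  clan-sequence {A = A} T (invert Y _ clan cs) with clan-sequence (inv-tournament A Y T) cs
  ... | m , S , S₀ , Sₘ , tournament , steps = suc m , A ∷ S , (λ _ _ → refl) , Sₘ ,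
    (λ { zero → T ; (suc k) → tournament k }) ,
    λ { zero → Y , (λ i j k i∈ j∈ k∉ → clan i∈ j∈ Subset.∈⊤ k∉) , S₀
      ; (suc k) → steps k }

  clan-sequence⇒samePrincipalMinors : ∀ {n} {A B : Matrix n} → ClanInversionSequence A B → SamePrincipalMinors A B
  clan-sequence⇒samePrincipalMinors {n} {A} {B} (m , S , S₀ , Sₘ , _ , steps) X _ = begin
    det (A [ X ])              ≈⟨ det-cong (λ i j → S₀ (enum X i) (enum X j)) ⟨
    det (S zero [ X ])         ≈⟨ along m S steps ⟩
    det (S (fromℕ m) [ X ])    ≈⟨ det-cong (λ i j → Sₘ (enum X i) (enum X j)) ⟩
    det (B [ X ])              ∎
    where
    along : ∀ m (S : Fin (suc m) → Matrix n) →
      ((k : Fin m) → ∃[ Y ] (IsClan (S (inject₁ k)) Y × (S (suc k) ≋ Inv (S (inject₁ k)) Y))) →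
      det (S zero [ X ]) ≈ det (S (fromℕ m) [ X ])
    along zero    S steps = refl
    along (suc m) S steps with steps zero
    ... | Y , clan , S₁ = begin
      det (S zero [ X ])          ≈⟨ det-transposedOnClan (clan⇒transposedOnClan {U = ⊤} (enum X) (λ _ → Subset.∈⊤)
                                       (λ i∈ j∈ _ k∉ → clan _ _ _ i∈ j∈ k∉)) ⟩
      det (Inv (S zero) Y [ X ])  ≈⟨ det-cong (λ i j → S₁ (enum X i) (enum X j)) ⟨
      det (S (suc zero) [ X ])    ≈⟨ along m (S ∘ suc) (steps ∘ suc) ⟩
      det (S (fromℕ (suc m)) [ X ]) ∎

-- Reaching the second matrix by inversions.

module Reachability {c ℓ₁ ℓ₂} (ℝ : CompleteOrderedField c ℓ₁ ℓ₂) where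
  open CompleteOrderedField ℝ hiding (zero)
  open RealMatrices ℝ
  open IntegerCoefficients commutativeRing using (solve; _:=_; con; _:+_; _:*_; :-_; _:-_)
  open Determinant ℝ
  open ClanInversion ℝ
  open SmallMinors ℝ
  open IsDecTotalOrder isDecTotalOrder using (_≟_)
  open RingProperties ring using (-0#≈0#)
  open SetoidReasoning setoid
  open Comparison ℝ
  open Inversions ℝ

  Reachable : ∀ {n} → Subset n → Matrix n → Matrix n → Set (c Level.⊔ ℓ₁)
  Reachable U A B = ∃[ C ] Chain U A C × Agree U C B

  -- The first matrix varies because inversions already made replace it; the target `B` stays.
  ReachableBelow : ∀ {n} → Subset n → Matrix n → Set (c Level.⊔ ℓ₁ Level.⊔ ℓ₂)
  ReachableBelow {n} U B = ∀ V → V ⊂ U → ∀ {A : Matrix n} → IsGeneralizedTournament A → SmallMinors V A B → Reachable V A B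

  prepend : ∀ {n} {U : Subset n} {A B C} → Chain U A C → Reachable U C B → Reachable U A B
  prepend cs (D , ds , agree) = D , cs ++ ds , agree

  private
    ∈∉⇒≢ : ∀ {n} {X : Subset n} {i j} → i ∈ X → j ∉ X → i ≢ j
    ∈∉⇒≢ i∈X j∉X ≡.refl = j∉X i∈X

    skew-flip : ∀ {n} {M N : Matrix n} {i j k l} → skew M i j ≈ skew N k l → skew M j i ≈ skew N l k
    skew-flip {M = M} {N} e = trans (skew-neg M _ _) (trans (-‿cong e) (sym (skew-neg N _ _)))

    skew-cong : ∀ {n} {M N : Matrix n} {i j} → M i j ≈ N i j → M j i ≈ N j i → skew M i j ≈ skew N i j
    skew-cong ij ji = +-cong ij (-‿cong ji)

  clan-of-skew : ∀ {n} {U X : Subset n} {A : Matrix n} → IsGeneralizedTournament A →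
    (∀ {k} → k ∈ U → k ∉ X → ∀ {i j} → i ∈ X → j ∈ X → skew A i k ≈ skew A j k) → ClanIn U A X
  clan-of-skew {A = A} T uniform i∈X j∈X k∈U k∉X =
    double-entry T T i≢k j≢k ik≈jk , double-entry T T (i≢k ∘ ≡.sym) (j≢k ∘ ≡.sym) (skew-flip {M = A} {A} ik≈jk)
    where
    i≢k = ∈∉⇒≢ i∈X k∉X
    j≢k = ∈∉⇒≢ j∈X k∉X
    ik≈jk = uniform k∈U k∉X i∈X j∈X

  module _ {n} {U : Subset n} {B : Matrix n} (TB : IsGeneralizedTournament B) (below : ReachableBelow U B) where

    -- The quotient comes first, since lifting its chain may transpose `X`. The chain inside `X`
    -- then disturbs nothing else. Entries between `X` and the rest agree because they can be read
    -- off at `i₀` in both matrices.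
    reachable-by-module : ∀ {A} (TA : IsGeneralizedTournament A) (same : SmallMinors U A B) →
      ∀ {i₀ j₀} → i₀ ≢ j₀ → CommonModule TA TB same i₀ j₀ → Reachable U A B
    reachable-by-module {A} TA same {i₀} {j₀} i₀≢j₀ M =
      contract (below V (V⊆U , j₀ , X⊆U j₀∈X , j₀∉V) TA (restrict {A = A} {B} V⊆U same))
      where
      open CommonModule M
      V : Subset n
      V = (U ∩ ∁ X) ∪ ⁅ i₀ ⁆
      V⁻ : ∀ {i} → i ∈ V → (i ∈ U × i ∉ X) ⊎ i ≡ i₀
      V⁻ i∈ with Subset.x∈p∪q⁻ (U ∩ ∁ X) ⁅ i₀ ⁆ i∈
      ... | inj₁ i∈′ = let (i∈U , i∈∁X) = Subset.x∈p∩q⁻ U (∁ X) i∈′ in inj₁ (i∈U , Subset.x∈∁p⇒x∉p i∈∁X)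
      ... | inj₂ i∈′ = inj₂ (Subset.x∈⁅y⁆⇒x≡y i₀ i∈′)
      V⁺ : ∀ {i} → i ∈ U → i ∉ X → i ∈ V
      V⁺ i∈U i∉X = Subset.p⊆p∪q ⁅ i₀ ⁆ (Subset.x∈p∩q⁺ (i∈U , Subset.x∉p⇒x∈∁p i∉X))
      i₀∈V : i₀ ∈ V
      i₀∈V = Subset.q⊆p∪q (U ∩ ∁ X) ⁅ i₀ ⁆ (Subset.x∈⁅x⁆ i₀)
      V⊆U : V ⊆ U
      V⊆U i∈V = [ proj₁ , (λ { ≡.refl → X⊆U i₀∈X }) ]′ (V⁻ i∈V)
      j₀∉V : j₀ ∉ V
      j₀∉V j₀∈V = [ (λ (_ , j₀∉X) → j₀∉X j₀∈X) , (λ j₀≡i₀ → i₀≢j₀ (≡.sym j₀≡i₀)) ]′ (V⁻ j₀∈V)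
      clanA : ClanIn U A X
      clanA = clan-of-skew TA uniform-a
      clanB : ClanIn U B X
      clanB = clan-of-skew TB uniform-b
      module Q = Quotient {U = U} {X} {V} {i₀} X⊆U V⊆U i₀∈X i₀∈V
        (λ i∈V i∈X → [ (λ (_ , i∉X) → contradiction i∈X i∉X) , id ]′ (V⁻ i∈V)) V⁺
      fill : ∀ {C₂} → Chain U A C₂ → Agree V C₂ B → ClanIn U C₂ X → Reachable X C₂ B → Reachable U A B
      fill {C₂} ds C₂≈B clan₂ (C₃ , es , C₃≈B) = C₃ , ds ++ chain-in-clan X⊆U clan₂ es , agree
        where
        agree : Agree U C₃ B
        agree {i} {j} i∈U j∈U with i ∈? X | j ∈? X
        ... | yes i∈X | yes j∈X = C₃≈B i∈X j∈X
        ... | no i∉X | no j∉X = trans (chain-outside es (inj₁ i∉X)) (C₂≈B (V⁺ i∈U i∉X) (V⁺ j∈U j∉X))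
        ... | yes i∈X | no j∉X = trans (chain-outside es (inj₂ j∉X)) (trans (proj₁ (clan₂ i∈X i₀∈X j∈U j∉X))
          (trans (C₂≈B i₀∈V (V⁺ j∈U j∉X)) (sym (proj₁ (clanB i∈X i₀∈X j∈U j∉X)))))
        ... | no i∉X | yes j∈X = trans (chain-outside es (inj₁ i∉X)) (trans (proj₂ (clan₂ j∈X i₀∈X i∈U i∉X))
          (trans (C₂≈B (V⁺ i∈U i∉X) i₀∈V) (sym (proj₂ (clanB j∈X i₀∈X i∈U i∉X)))))
      expand : ∀ {C₁} → Agree V C₁ B → ∃[ C₂ ] Chain U A C₂ × Agree V C₂ C₁ × ClanIn U C₂ X → Reachable U A B
      expand {C₁} C₁≈B (C₂ , ds , C₂≈C₁ , clan₂) = fill ds (λ i∈V j∈V → trans (C₂≈C₁ i∈V j∈V) (C₁≈B i∈V j∈V)) clan₂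
        (below X (X⊆U , _ , outer∈U , outer∉X) (chain-tournament ds TA)
          (restrict {A = C₂} {B} X⊆U (chain-smallMinors {A = A} {B} {C₂} ds same)))
      contract : Reachable V A B → Reachable U A B
      contract (C₁ , cs , C₁≈B) = expand C₁≈B (Q.chain-from-quotient (λ _ _ → refl) clanA cs)

    private
      triple-value : ∀ {x y′} → ¬ x ≈ 0# → - (x * x) ≈ x * x - (1# + 1#) * (x * y′) → y′ ≈ x
      triple-value {x} {y′} x≉0 e = x-y≈0⇒x≈y (x*y≈0⇒y≈0 x≉0 (x*y≈0⇒y≈0 1+1≉0 (begin
        (1# + 1#) * (x * (y′ - x))                          ≈⟨ solve 2 (λ x y′ →
            (con (1 , 0) :+ con (1 , 0)) :* (x :* (y′ :- x)) :=
            :- (x :* x) :- (x :* x :- (con (1 , 0) :+ con (1 , 0)) :* (x :* y′))) refl x y′ ⟩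
        - (x * x) - (x * x - (1# + 1#) * (x * y′))          ≈⟨ +-congʳ e ⟩
        x * x - (1# + 1#) * (x * y′) - (x * x - (1# + 1#) * (x * y′)) ≈⟨ -‿inverseʳ _ ⟩
        0#                                                  ∎)))

    module Block (P : Subset n) (P⊆U : P ⊆ U) {p₀ : Fin n} (p₀∈P : p₀ ∈ P)
                 {q₀ : Fin n} (q₀∈U : q₀ ∈ U) (q₀∉P : q₀ ∉ P) (x : Carrier) where
      Q : Subset n
      Q = U ∩ ∁ P
      Q⁺ : ∀ {i} → i ∈ U → i ∉ P → i ∈ Q
      Q⁺ i∈U i∉P = Subset.x∈p∩q⁺ (i∈U , Subset.x∉p⇒x∈∁p i∉P)
      Q⊆U : Q ⊆ U
      Q⊆U = Subset.p∩q⊆p U (∁ P)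
      Q∌P : ∀ {i} → i ∈ Q → i ∉ P
      Q∌P i∈Q = Subset.x∈∁p⇒x∉p (proj₂ (Subset.x∈p∩q⁻ U (∁ P) i∈Q))
      P∌Q : ∀ {i} → i ∈ P → i ∉ Q
      P∌Q i∈P i∈Q = Q∌P i∈Q i∈P
      P≢Q : ∀ {i j} → i ∈ P → j ∈ Q → i ≢ j
      P≢Q i∈P j∈Q = ∈∉⇒≢ i∈P (Q∌P j∈Q)

      Cross : Matrix n → Set ℓ₁
      Cross M = ∀ {i j} → i ∈ P → j ∈ Q → skew M i j ≈ x

      clanP : ∀ {M} → IsGeneralizedTournament M → Cross M → ClanIn U M P
      clanP TM crossM = clan-of-skew TM λ k∈U k∉P i∈P j∈P → trans (crossM i∈P (Q⁺ k∈U k∉P)) (sym (crossM j∈P (Q⁺ k∈U k∉P)))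

      clanQ : ∀ {M} → IsGeneralizedTournament M → Cross M → ClanIn U M Q
      clanQ {M} TM crossM = clan-of-skew TM λ {k} k∈U k∉Q i∈Q j∈Q →
        let k∈P = decidable-stable (k ∈? P) λ k∉P → k∉Q (Q⁺ k∈U k∉P) in
        skew-flip {M = M} {M} (trans (crossM k∈P i∈Q) (sym (crossM k∈P j∈Q)))

      -- Both sides of a cut are clans. The chains that induction gives for them change neither the
      -- other side nor the weights across, and they preserve the minors.
      align : ∀ {A} → IsGeneralizedTournament A → SmallMinors U A B → Cross A →
        (∀ {C} → IsGeneralizedTournament C → SmallMinors U C B → Agree P C B → Agree Q C B → Cross C → Reachable U C B) →
        Reachable U A B
      align {A} TA same crossA conclude =
        first (below P (P⊆U , q₀ , q₀∈U , q₀∉P) TA (restrict {A = A} {B} P⊆U same))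
        where
        second : ∀ {C₁} → Chain U A C₁ → Agree P C₁ B → Cross C₁ → IsGeneralizedTournament C₁ →
          Reachable Q C₁ B → Reachable U A B
        second {C₁} chain₁ C₁≈B cross₁ T₁ (C , cs , C≈B) = prepend chain
          (conclude (chain-tournament chain TA) (chain-smallMinors {A = A} {B} {C} chain same)
            (λ i∈P j∈P → trans (chain-outside cs (inj₁ (P∌Q i∈P))) (C₁≈B i∈P j∈P)) C≈B
            λ i∈P j∈Q → trans (skew-cong {M = C} {C₁} (chain-outside cs (inj₁ (P∌Q i∈P))) (chain-outside cs (inj₂ (P∌Q i∈P))))
              (cross₁ i∈P j∈Q))
          where
          chain : Chain U A C
          chain = chain₁ ++ chain-in-clan Q⊆U (clanQ T₁ cross₁) cs
        first : Reachable P A B → Reachable U A B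
        first (C₁ , cs , C₁≈B) = second chain C₁≈B cross₁ T₁
          (below Q (Q⊆U , _ , P⊆U p₀∈P , P∌Q p₀∈P) T₁
            (restrict {A = C₁} {B} Q⊆U (chain-smallMinors {A = A} {B} {C₁} chain same)))
          where
          chain : Chain U A C₁
          chain = chain-in-clan P⊆U (clanP TA crossA) cs
          T₁ : IsGeneralizedTournament C₁
          T₁ = chain-tournament chain TA
          cross₁ : Cross C₁
          cross₁ i∈P j∈Q = trans
            (skew-cong {M = C₁} {A} (chain-outside cs (inj₂ (Q∌P j∈Q))) (chain-outside cs (inj₁ (Q∌P j∈Q))))
            (crossA i∈P j∈Q)

      -- In B, the initial block P of C either is split by some vertex, which gives a smaller
      -- initial block of C, or it stands as a whole between R and the remaining vertices, and
      -- is moved there by the inversions of P ∪ R, P and R.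
      module Aligned {C : Matrix n} (T : IsGeneralizedTournament C) (sameC : SmallMinors U C B)
        (C≈B-on-P : Agree P C B) (C≈B-on-Q : Agree Q C B) (crossC : Cross C)
        (smaller : ∀ {P′} → P′ ⊂ P → ∃ (_∈ P′) → ∃[ q ] (q ∈ U × q ∉ P′) →
                   (∀ {i j} → i ∈ P′ → j ∈ U → j ∉ P′ → skew C i j ≈ x) → Reachable U C B) where
        reversed : ∀ {i j} → i ∈ P → j ∈ Q → ¬ skew B i j ≈ x → skew B i j ≈ - x
        reversed {i} {j} i∈P j∈Q ≉x = signed-square false
          (trans (*-cong (sym (crossC i∈P j∈Q)) (sym (crossC i∈P j∈Q)))
            (square-agrees T TB sameC (P⊆U i∈P) (Q⊆U j∈Q) (P≢Q i∈P j∈Q))) ≉x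

        x≉0 : ∀ {i j} → i ∈ P → j ∈ Q → ¬ skew B i j ≈ x → ¬ x ≈ 0#
        x≉0 i∈P j∈Q ≉x x≈0 = ≉x (trans (reversed i∈P j∈Q ≉x) (trans (-‿cong x≈0) (trans -0#≈0# (sym x≈0))))

        -- In `C` the weight of `i i′` cancels from the triple, which is - x². In `B` the two
        -- weights to `j` have opposite signs, and the triple is x² - 2 x y′ with y′ the weight
        -- sought.
        splits-P : ∀ {i i′ j} → i ∈ P → i′ ∈ P → j ∈ Q → skew B i j ≈ x → ¬ skew B i′ j ≈ x → skew B i i′ ≈ x
        splits-P {i} {i′} {j} i∈P i′∈P j∈Q ij≈x i′j≉x = triple-value (x≉0 i′∈P j∈Q i′j≉x) (begin
          - (x * x)                                       ≈⟨ solve 2 (λ x y → :- (x :* x) := y :* x :+ (:- (x :* x) :+ :- (x :* y))) refl x (skew C i i′) ⟩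
          triple (skew C i i′) x x                        ≈⟨ triple-cong refl (crossC i∈P j∈Q) (crossC i′∈P j∈Q) ⟨
          triple (skew C i i′) (skew C i j) (skew C i′ j) ≈⟨ triple-agrees T TB sameC (P⊆U i∈P) (P⊆U i′∈P) (Q⊆U j∈Q)
                                                               (λ { ≡.refl → i′j≉x ij≈x }) (P≢Q i∈P j∈Q) (P≢Q i′∈P j∈Q) ⟩
          triple (skew B i i′) (skew B i j) (skew B i′ j) ≈⟨ triple-cong refl ij≈x (reversed i′∈P j∈Q i′j≉x) ⟩
          triple (skew B i i′) x (- x)                    ≈⟨ solve 2 (λ x y → y :* :- x :+ (:- (:- x :* x) :+ :- (x :* y)) :=
                                                               x :* x :- (con (1 , 0) :+ con (1 , 0)) :* (x :* y)) refl x (skew B i i′) ⟩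
          x * x - (1# + 1#) * (x * skew B i i′)           ∎)

        splits-Q : ∀ {i j j′} → i ∈ P → j ∈ Q → j′ ∈ Q → ¬ skew B i j ≈ x → skew B i j′ ≈ x → skew B j j′ ≈ x
        splits-Q {i} {j} {j′} i∈P j∈Q j′∈Q ij≉x ij′≈x = triple-value (x≉0 i∈P j∈Q ij≉x) (begin
          - (x * x)                                       ≈⟨ solve 2 (λ x y → :- (x :* x) := x :* y :+ (:- (y :* x) :+ :- (x :* x))) refl x (skew C j j′) ⟩
          triple x x (skew C j j′)                        ≈⟨ triple-cong (crossC i∈P j∈Q) (crossC i∈P j′∈Q) refl ⟨
          triple (skew C i j) (skew C i j′) (skew C j j′) ≈⟨ triple-agrees T TB sameC (P⊆U i∈P) (Q⊆U j∈Q) (Q⊆U j′∈Q)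
                                                               (P≢Q i∈P j∈Q) (P≢Q i∈P j′∈Q) (λ { ≡.refl → ij≉x ij′≈x }) ⟩
          triple (skew B i j) (skew B i j′) (skew B j j′) ≈⟨ triple-cong (reversed i∈P j∈Q ij≉x) ij′≈x refl ⟩
          triple (- x) x (skew B j j′)                    ≈⟨ solve 2 (λ x y → :- x :* y :+ (:- (y :* x) :+ :- (x :* :- x)) :=
                                                               x :* x :- (con (1 , 0) :+ con (1 , 0)) :* (x :* y)) refl x (skew B j j′) ⟩
          x * x - (1# + 1#) * (x * skew B j j′)           ∎)

        module Split {i i′ j} (i∈P : i ∈ P) (i′∈P : i′ ∈ P) (j∈Q : j ∈ Q) (ij≈x : skew B i j ≈ x) (i′j≉x : ¬ skew B i′ j ≈ x) where
          Before? : Decidable (λ k → k ∈ P × skew B k j ≈ x)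
          Before? k = (k ∈? P) ×-dec (skew B k j ≟ x)
          P′ : Subset n
          P′ = comprehension Before?
          P′⁻ : ∀ {k} → k ∈ P′ → k ∈ P × skew B k j ≈ x
          P′⁻ = ∈-comprehension⁻ Before?
          cross′ : ∀ {k l} → k ∈ P′ → l ∈ U → l ∉ P′ → skew C k l ≈ x
          cross′ {k} {l} k∈P′ l∈U l∉P′ with P′⁻ k∈P′ | l ∈? P
          ... | k∈P , _ | no l∉P = crossC k∈P (Q⁺ l∈U l∉P)
          ... | k∈P , kj≈x | yes l∈P = trans (skew-cong {M = C} {B} (C≈B-on-P k∈P l∈P) (C≈B-on-P l∈P k∈P))
            (splits-P k∈P l∈P j∈Q kj≈x λ lj≈x → l∉P′ (∈-comprehension⁺ Before? (l∈P , lj≈x)))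
          i′∉P′ : i′ ∉ P′
          i′∉P′ i′∈ = i′j≉x (proj₂ (P′⁻ i′∈))
          result : Reachable U C B
          result = smaller ((proj₁ ∘ P′⁻) , i′ , i′∈P , i′∉P′) (i , ∈-comprehension⁺ Before? (i∈P , ij≈x))
            (i′ , P⊆U i′∈P , i′∉P′) cross′

        module Unsplit (unsplit : ∀ {i i′ j} → i ∈ P → i′ ∈ P → j ∈ Q → skew B i j ≈ x → skew B i′ j ≈ x) where
          R? : Decidable (λ j → j ∈ Q × ¬ skew B p₀ j ≈ x)
          R? j = (j ∈? Q) ×-dec ¬? (skew B p₀ j ≟ x)
          R : Subset n
          R = comprehension R?
          R⁻ : ∀ {j} → j ∈ R → j ∈ Q × ¬ skew B p₀ j ≈ x
          R⁻ = ∈-comprehension⁻ R?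
          R⊆Q : R ⊆ Q
          R⊆Q = proj₁ ∘ R⁻
          R∌P : ∀ {j} → j ∈ R → j ∉ P
          R∌P = Q∌P ∘ R⊆Q
          after : ∀ {j} → j ∈ Q → j ∉ R → ∀ {i} → i ∈ P → skew B i j ≈ x
          after {j} j∈Q j∉R i∈P = unsplit p₀∈P i∈P j∈Q
            (decidable-stable (_ ≟ _) λ ≉x → j∉R (∈-comprehension⁺ R? (j∈Q , ≉x)))
          before : ∀ {j} → j ∈ R → ∀ {i} → i ∈ P → skew B i j ≈ - x
          before j∈R i∈P = reversed i∈P (R⊆Q j∈R) λ ij≈x → proj₂ (R⁻ j∈R) (unsplit i∈P p₀∈P (R⊆Q j∈R) ij≈x)
          R→rest : ∀ {j k} → j ∈ R → k ∈ Q → k ∉ R → skew C j k ≈ x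
          R→rest j∈R k∈Q k∉R = trans (skew-cong {M = C} {B} (C≈B-on-Q (R⊆Q j∈R) k∈Q) (C≈B-on-Q k∈Q (R⊆Q j∈R)))
            (splits-Q p₀∈P (R⊆Q j∈R) k∈Q (proj₂ (R⁻ j∈R)) (after k∈Q k∉R p₀∈P))

          Y : Subset n
          Y = P ∪ R
          Y⁻ : ∀ {i} → i ∈ Y → i ∈ P ⊎ i ∈ R
          Y⁻ = Subset.x∈p∪q⁻ P R
          P⊆Y : P ⊆ Y
          P⊆Y = Subset.p⊆p∪q R
          R⊆Y : R ⊆ Y
          R⊆Y = Subset.q⊆p∪q P R
          Y⊆U : Y ⊆ U
          Y⊆U i∈Y = [ P⊆U , Q⊆U ∘ R⊆Q ]′ (Y⁻ i∈Y)
          clanY : ClanIn U C Y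
          clanY = clan-of-skew T λ {k} k∈U k∉Y i∈Y j∈Y → trans (to-x k∈U k∉Y i∈Y) (sym (to-x k∈U k∉Y j∈Y))
            where
            to-x : ∀ {i k} → k ∈ U → k ∉ Y → i ∈ Y → skew C i k ≈ x
            to-x k∈U k∉Y i∈Y = let k∈Q = Q⁺ k∈U (k∉Y ∘ P⊆Y) in
              [ (λ i∈P → crossC i∈P k∈Q) , (λ i∈R → R→rest i∈R k∈Q (k∉Y ∘ R⊆Y)) ]′ (Y⁻ i∈Y)
          clanR : ClanIn U C R
          clanR = clan-of-skew T λ {k} k∈U k∉R i∈R j∈R → uniform k∈U k∉R i∈R j∈R
            where
            uniform : ∀ {k} → k ∈ U → k ∉ R → ∀ {i j} → i ∈ R → j ∈ R → skew C i k ≈ skew C j k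
            uniform {k} k∈U k∉R i∈R j∈R with k ∈? P
            ... | yes k∈P = skew-flip {M = C} {C} (trans (crossC k∈P (R⊆Q i∈R)) (sym (crossC k∈P (R⊆Q j∈R))))
            ... | no k∉P = trans (R→rest i∈R (Q⁺ k∈U k∉P) k∉R) (sym (R→rest j∈R (Q⁺ k∈U k∉P) k∉R))

          -- Inverting `P ∪ R` exchanges the order of the blocks `P` and `R` but also transposes
          -- each of them; the two further inversions undo the latter.
          D₁ D₂ D₃ : Matrix n
          D₁ = Inv C Y
          D₂ = Inv D₁ P
          D₃ = Inv D₂ R
          moves : Chain U C D₃
          moves = invert Y Y⊆U clanY (invert P P⊆U (inv-clan-⊆ P⊆Y (clanP T crossC))
            (invert R (Q⊆U ∘ R⊆Q) (inv-clan-disjoint {A = D₁} R∌P (inv-clan-⊆ R⊆Y clanR)) done))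

          D₃-PP : ∀ {i j} → i ∈ P → j ∈ P → D₃ i j ≡ C i j
          D₃-PP {i} {j} i∈P j∈P = ≡.trans (inv-outsideˡ D₂ R {i} {j} (λ i∈R → R∌P i∈R i∈P))
            (≡.trans (inv-inside D₁ P i∈P j∈P) (inv-inside C Y (P⊆Y j∈P) (P⊆Y i∈P)))
          D₃-RR : ∀ {i j} → i ∈ R → j ∈ R → D₃ i j ≡ C i j
          D₃-RR {i} {j} i∈R j∈R = ≡.trans (inv-inside D₂ R i∈R j∈R)
            (≡.trans (inv-outsideˡ D₁ P {j} {i} (R∌P j∈R)) (inv-inside C Y (R⊆Y j∈R) (R⊆Y i∈R)))
          D₃-PR : ∀ {i j} → i ∈ P → j ∈ R → D₃ i j ≡ C j i
          D₃-PR {i} {j} i∈P j∈R = ≡.trans (inv-outsideˡ D₂ R {i} {j} (λ i∈R → R∌P i∈R i∈P))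
            (≡.trans (inv-outsideʳ D₁ P {i} {j} (R∌P j∈R)) (inv-inside C Y (P⊆Y i∈P) (R⊆Y j∈R)))
          D₃-RP : ∀ {i j} → i ∈ R → j ∈ P → D₃ i j ≡ C j i
          D₃-RP {i} {j} i∈R j∈P = ≡.trans (inv-outsideʳ D₂ R {i} {j} (λ j∈R → R∌P j∈R j∈P))
            (≡.trans (inv-outsideˡ D₁ P {i} {j} (R∌P i∈R)) (inv-inside C Y (R⊆Y i∈R) (P⊆Y j∈P)))
          D₃-outˡ : ∀ {i j} → i ∉ Y → D₃ i j ≡ C i j
          D₃-outˡ {i} {j} i∉Y = ≡.trans (inv-outsideˡ D₂ R {i} {j} (i∉Y ∘ R⊆Y)) (≡.trans (inv-outsideˡ D₁ P {i} {j} (i∉Y ∘ P⊆Y)) (inv-outsideˡ C Y {i} {j} i∉Y))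
          D₃-outʳ : ∀ {i j} → j ∉ Y → D₃ i j ≡ C i j
          D₃-outʳ {i} {j} j∉Y = ≡.trans (inv-outsideʳ D₂ R {i} {j} (j∉Y ∘ R⊆Y)) (≡.trans (inv-outsideʳ D₁ P {i} {j} (j∉Y ∘ P⊆Y)) (inv-outsideʳ C Y {i} {j} j∉Y))

          data Place (i : Fin n) : Set where
            inP : i ∈ P → Place i
            inR : i ∈ R → Place i
            inS : i ∈ Q → i ∉ R → i ∉ Y → Place i

          place : ∀ {i} → i ∈ U → Place i
          place {i} i∈U with i ∈? P | i ∈? R
          ... | yes i∈P | _       = inP i∈P
          ... | no _    | yes i∈R = inR i∈R
          ... | no i∉P  | no i∉R  = inS (Q⁺ i∈U i∉P) i∉R ([ i∉P , i∉R ]′ ∘ Y⁻)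

          P-R : ∀ {i j} → i ∈ P → j ∈ R → skew C j i ≈ skew B i j
          P-R i∈P j∈R = trans (skew-neg C _ _) (trans (-‿cong (crossC i∈P (R⊆Q j∈R))) (sym (before j∈R i∈P)))

          P-S : ∀ {i j} → i ∈ P → j ∈ Q → j ∉ R → skew C i j ≈ skew B i j
          P-S i∈P j∈Q j∉R = trans (crossC i∈P j∈Q) (sym (after j∈Q j∉R i∈P))

          agree : Agree U D₃ B
          agree i∈U j∈U with place i∈U | place j∈U
          ... | inP i∈P | inP j∈P = trans (reflexive (D₃-PP i∈P j∈P)) (C≈B-on-P i∈P j∈P)
          ... | inR i∈R | inR j∈R = trans (reflexive (D₃-RR i∈R j∈R)) (C≈B-on-Q (R⊆Q i∈R) (R⊆Q j∈R))
          ... | inP i∈P | inR j∈R = trans (reflexive (D₃-PR i∈P j∈R))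
            (double-entry T TB (P≢Q i∈P (R⊆Q j∈R) ∘ ≡.sym) (P≢Q i∈P (R⊆Q j∈R)) (P-R i∈P j∈R))
          ... | inR i∈R | inP j∈P = trans (reflexive (D₃-RP i∈R j∈P))
            (double-entry T TB (P≢Q j∈P (R⊆Q i∈R)) (P≢Q j∈P (R⊆Q i∈R) ∘ ≡.sym) (skew-flip {M = C} {B} (P-R j∈P i∈R)))
          ... | inS i∈Q _ i∉Y | inS j∈Q _ _ = trans (reflexive (D₃-outˡ i∉Y)) (C≈B-on-Q i∈Q j∈Q)
          ... | inS i∈Q _ i∉Y | inR j∈R = trans (reflexive (D₃-outˡ i∉Y)) (C≈B-on-Q i∈Q (R⊆Q j∈R))
          ... | inR i∈R | inS j∈Q _ j∉Y = trans (reflexive (D₃-outʳ j∉Y)) (C≈B-on-Q (R⊆Q i∈R) j∈Q)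
          ... | inP i∈P | inS j∈Q j∉R j∉Y = trans (reflexive (D₃-outʳ j∉Y))
            (double-entry T TB (P≢Q i∈P j∈Q) (P≢Q i∈P j∈Q) (P-S i∈P j∈Q j∉R))
          ... | inS i∈Q i∉R i∉Y | inP j∈P = trans (reflexive (D₃-outˡ i∉Y))
            (double-entry T TB (P≢Q j∈P i∈Q ∘ ≡.sym) (P≢Q j∈P i∈Q ∘ ≡.sym) (skew-flip {M = C} {B} (P-S j∈P i∈Q i∉R)))

          result : Reachable U C B
          result = D₃ , moves , agree

        conclude : Reachable U C B
        conclude with Fin.any? (λ i → (i ∈? P) ×-dec Fin.any? (λ i′ → (i′ ∈? P) ×-dec
                      Fin.any? (λ j → (j ∈? Q) ×-dec ((skew B i j ≟ x) ×-dec ¬? (skew B i′ j ≟ x)))))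
        ... | yes (i , i∈P , i′ , i′∈P , j , j∈Q , ij≈x , i′j≉x) = Split.result i∈P i′∈P j∈Q ij≈x i′j≉x
        ... | no unsplit = Unsplit.result λ {i} {i′} {j} i∈P i′∈P j∈Q ij≈x →
          decidable-stable (_ ≟ _) λ i′j≉x → unsplit (i , i∈P , i′ , i′∈P , j , j∈Q , ij≈x , i′j≉x)

    -- A recursion of its own, on the initial block: a split replaces `P` by a smaller block while
    -- `U` remains the same.
    reachable-by-cut : ∀ P → Acc _⊂_ P → ∀ {A} → IsGeneralizedTournament A → SmallMinors U A B →
      P ⊆ U → ∃ (_∈ P) → ∃[ q ] (q ∈ U × q ∉ P) →
      ∀ {x} → (∀ {i j} → i ∈ P → j ∈ U → j ∉ P → skew A i j ≈ x) → Reachable U A B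
    reachable-by-cut P (acc rec) TA same P⊆U (_ , p₀∈P) (_ , q₀∈U , q₀∉P) {x} cross =
      align TA same (λ i∈P j∈Q → cross i∈P (Q⊆U j∈Q) (Q∌P j∈Q)) λ T sameC C≈B-on-P C≈B-on-Q crossC →
        Aligned.conclude T sameC C≈B-on-P C≈B-on-Q crossC
          λ P′⊂P ne out cross′ → reachable-by-cut _ (rec P′⊂P) T sameC (P⊆U ∘ proj₁ P′⊂P) ne out cross′
      where open Block P P⊆U p₀∈P q₀∈U q₀∉P x

  -- Components are grown from an actual pair, so the cases in which one colour does not occur are
  -- settled beforehand. If no pair is reversed, the matrices agree on `U`; if none is kept, one
  -- inversion is enough.
  reachable : ∀ {n} (U : Subset n) → Acc _⊂_ U → ∀ {A B} → IsGeneralizedTournament A → IsGeneralizedTournament B →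
    SmallMinors U A B → Reachable U A B
  reachable {n} U (acc rec) {A} {B} TA TB same = decide
    (Fin.any? (λ i → Fin.any? (λ j → Colour? TA TB same false i j)))
    (Fin.any? (λ i → Fin.any? (λ j → Colour? TA TB same true i j)))
    where
    Pair : Bool → Fin n → Fin n → Set ℓ₁
    Pair = Colour TA TB same

    below : ReachableBelow U B
    below V V⊂U TA′ = reachable V (rec V⊂U) TA′ TB

    all-kept : (∀ {i j} → ¬ Pair false i j) → Agree U A B
    all-kept none {i} {j} i∈U j∈U with i Fin.≟ j
    ... | yes ≡.refl = trans (diagonal TA i) (sym (diagonal TB i))
    ... | no i≢j = double-entry TA TB i≢j i≢j (sym (uncoloured TA TB same i∈U j∈U none))

    all-reversed : (∀ {i j} → ¬ Pair true i j) → ∀ {i j} → i ∈ U → j ∈ U → A j i ≈ B i j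
    all-reversed none {i} {j} i∈U j∈U with i Fin.≟ j
    ... | yes ≡.refl = trans (diagonal TA i) (sym (diagonal TB i))
    ... | no i≢j = double-entry TA TB (i≢j ∘ ≡.sym) i≢j
      (trans (skew-neg A i j) (sym (uncoloured TA TB same i∈U j∈U none)))

    by-cut : ∃[ x ] CutOf TA TB same x U → Reachable U A B
    by-cut (x , L , (l , l∈U , l∈L) , (h , h∈U , h∉L) , cross) =
      reachable-by-cut TB below (U ∩ L) (⊂-wellFounded _) TA same (Subset.p∩q⊆p U L) (l , Subset.x∈p∩q⁺ (l∈U , l∈L))
        (h , h∈U , λ h∈ → h∉L (proj₂ (Subset.x∈p∩q⁻ U L h∈)))
        λ i∈ j∈U j∉ → cross (proj₁ (Subset.x∈p∩q⁻ U L i∈)) j∈U (proj₂ (Subset.x∈p∩q⁻ U L i∈))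
          λ j∈L → j∉ (Subset.x∈p∩q⁺ (j∈U , j∈L))

    combine : ∀ {i j k l} → Pair false i j → Pair true k l →
      CommonModule TA TB same i j ⊎ Connected TA TB same false U →
      CommonModule TA TB same k l ⊎ Connected TA TB same true U → Reachable U A B
    combine ij kl (inj₁ M)     _        = reachable-by-module TB below TA same (colour-≢ TA TB same ij) M
    combine ij kl (inj₂ _)     (inj₁ M) = reachable-by-module TB below TA same (colour-≢ TA TB same kl) M
    combine ij kl (inj₂ false-connected) (inj₂ true-connected) = by-cut
      (connected⇒cut TA TB same ij λ { true → true-connected ; false → false-connected })

    decide : Dec (∃[ i ] ∃[ j ] Pair false i j) → Dec (∃[ i ] ∃[ j ] Pair true i j) → Reachable U A B
    decide (no none) _ = A , done , all-kept λ ij → none (_ , _ , ij)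
    -- `U` is vacuously a clan relative to itself.
    decide (yes _) (no none) = Inv A U , invert U id (λ _ _ k∈U k∉U → contradiction k∈U k∉U) done ,
      λ i∈U j∈U → trans (reflexive (inv-inside A U i∈U j∈U)) (all-reversed (λ ij → none (_ , _ , ij)) i∈U j∈U)
    decide (yes (_ , _ , ij)) (yes (_ , _ , kl)) =
      combine ij kl (module-or-connected TA TB same ij) (module-or-connected TA TB same kl)

  module _ {n} {A B : Matrix n} (TA : IsGeneralizedTournament A) (TB : IsGeneralizedTournament B) where
    samePrincipalMinorsUpTo⇒clanSequence : SamePrincipalMinorsUpTo 4 A B → ClanInversionSequence A B
    samePrincipalMinorsUpTo⇒clanSequence same
      with C , cs , agree ← reachable ⊤ (⊂-wellFounded _) TA TB (samePrincipalMinorsUpTo⇒smallMinors {A = A} {B} same)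
      with m , S , S₀ , Sₘ , rest ← clan-sequence TA cs
      = m , S , S₀ , (λ i j → trans (Sₘ i j) (agree Subset.∈⊤ Subset.∈⊤)) , rest

  samePrincipalMinors⇒upTo : ∀ {n} (A B : Matrix n) → SamePrincipalMinors A B → SamePrincipalMinorsUpTo 4 A B
  samePrincipalMinors⇒upTo A B same X 1≤∣X∣ _ = same X (nonempty X 1≤∣X∣)
    where
    nonempty : ∀ {n} (X : Subset n) → 1 ℕ.≤ ∣ X ∣ → Nonempty X
    nonempty {n} X 1≤∣X∣ with Subset.nonempty? X
    ... | yes ne = ne
    ... | no ¬ne = contradiction
      (≡.subst (1 ℕ.≤_) (≡.trans (≡.cong ∣_∣ (Subset.Empty-unique ¬ne)) (Subset.∣⊥∣≡0 n)) 1≤∣X∣) λ ()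

-- The equivalence of the three assertions.

open import Data.Nat.Base using (_≤_)

theorem2p4 : ∀ {c ℓ₁ ℓ₂} (ℝ : CompleteOrderedField c ℓ₁ ℓ₂) →
    let open RealMatrices ℝ in
    (n : ℕ) → 1 ≤ n → (A B : Matrix n) →
    IsGeneralizedTournament A → IsGeneralizedTournament B →
    (SamePrincipalMinorsUpTo 4 A B ⇔ SamePrincipalMinors A B) ×
    (SamePrincipalMinors A B ⇔ ClanInversionSequence A B)
theorem2p4 ℝ n _ A B TA TB =
  mk⇔ (clan-sequence⇒samePrincipalMinors ∘ samePrincipalMinorsUpTo⇒clanSequence TA TB) (samePrincipalMinors⇒upTo A B) ,
  mk⇔ (samePrincipalMinorsUpTo⇒clanSequence TA TB ∘ samePrincipalMinors⇒upTo A B) clan-sequence⇒samePrincipalMinors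
  where
  open Inversions ℝ
  open Reachability ℝ
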